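{- Let $q$ be an odd prime power and $n$ a prime with $(q^n-1)/2$ even. Let $\beta\in\mathbb{F}_q^*$, let $m$ be an even divisor of $q^n-1$, let $Q=\frac{q^n-1}{q-1}$, and let $m_Q$ be the product of those primes dividing $m$ which divide $Q$. Then $$\mathcal{N}_\beta(m)\ \ge\ \theta(m)\,q^{\frac{n-1}{2}}\left\{q^{\frac{n-1}{2}}-4W(m)+2W(m_Q)+1\right\}.$$ Consequently $\mathcal{N}_\beta(q^n-1)>0$ whenever $q^{\frac{n-1}{2}}>4W(q^n-1)-2W(Q)-1$.
   Context: For a divisor $m$ of $q^n-1$, an element $\xi\in\mathbb{F}_{q^n}^*$ is called $m$-free if $\xi=\zeta^d$ with $d\mid m$ and $\zeta\in\mathbb{F}_{q^n}^*$ implies $d=1$ (the $(q^n-1)$-free elements are exactly the primitive elements). $\mathcal{N}_\beta(m)$ denotes the number of $m$-free elements $\xi\in\mathbb{F}_{q^n}^*$ such that $\mathrm{Tr}(\xi^2)=\beta$, where $\mathrm{Tr}:\mathbb{F}_{q^n}\to\mathbb{F}_q$ is the trace map. $\theta(m)=\phi(m)/m$ with $\phi$ Euler's function, and $W(m)=2^{\nu(m)}$ where $\nu(m)$ is the number of distinct prime divisors of $m$ (so $W(1)=1$). -}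

module Defs where

open import Level using (0ℓ)
open import Data.Nat as ℕ using (ℕ; zero; suc)
open import Data.Nat.Divisibility using (_∣_; _∣?_)
open import Data.Nat.DivMod using (_/_)
open import Data.Nat.GCD using (gcd)
open import Data.Nat.Primality using (Prime; prime?)
open import Data.Integer as ℤ using (ℤ; +_)
open import Data.Fin using (Fin)
open import Data.List using (List; []; _∷_; length; filter; upTo; map)
open import Data.Nat.ListAction using (product)
open import Data.List.Relation.Unary.Unique.Propositional using (Unique)
open import Data.List.Membership.Propositional using (_∈_)
open import Data.Product using (Σ; _×_)
open import Data.Sum using (_⊎_)
open import Function.Bundles using (_↔_; _⇔_)
open import Relation.Binary.PropositionalEquality using (_≡_; _≢_)
open import Relation.Nullary.Decidable using (_×-dec_)
open import Algebra.Core using (Op₁; Op₂)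
open import Algebra.Structures using (IsCommutativeRing)

record FiniteField (size : ℕ) : Set₁ where
  field
    Carrier : Set
    _+_ _*_ : Op₂ Carrier
    -_      : Op₁ Carrier
    0# 1#   : Carrier
    isCommutativeRing : IsCommutativeRing _≡_ _+_ _*_ -_ 0# 1#
    0≢1       : 0# ≢ 1#
    inverse   : ∀ x → x ≢ 0# → Σ Carrier (λ y → x * y ≡ 1#)
    enumerate : Fin size ↔ Carrier

module _ {size : ℕ} (F : FiniteField size) where
  open FiniteField F

  pow : Carrier → ℕ → Carrier
  pow x zero    = 1#
  pow x (suc k) = x * pow x k

  -- F_q inside F_{q^n}: the elements fixed by x ↦ x^q
  InSubfield : (q : ℕ) → Carrier → Set
  InSubfield q x = pow x q ≡ x

  Tr : (q n : ℕ) → Carrier → Carrier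
  Tr q zero    x = 0#
  Tr q (suc i) x = Tr q i x + pow x (q ℕ.^ i)

  IsFree : ℕ → Carrier → Set
  IsFree m ξ = ∀ (d : ℕ) (ζ : Carrier) → d ∣ m → ζ ≢ 0# → ξ ≡ pow ζ d → d ≡ 1

  -- L is a duplicate-free list of exactly the m-free ξ ∈ F* with
  -- Tr(ξ^2) = β; so length L = 𝒩_β(m).
  CountsN : (q n : ℕ) (β : Carrier) (m : ℕ) → List Carrier → Set
  CountsN q n β m L =
    Unique L × (∀ ξ → (ξ ∈ L) ⇔ ((ξ ≢ 0#) × IsFree m ξ × (Tr q n (pow ξ 2) ≡ β)))

φ : ℕ → ℕ
φ m = length (filter (λ k → gcd k m ℕ.≟ 1) (map suc (upTo m)))

-- the primes dividing m (for m ≥ 1), in increasing order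
primeDivisors : ℕ → List ℕ
primeDivisors m = filter (λ p → prime? p ×-dec (p ∣? m)) (upTo (suc m))

ν : ℕ → ℕ
ν m = length (primeDivisors m)

W : ℕ → ℕ
W m = 2 ℕ.^ ν m

-- Q = (q^n - 1)/(q - 1)  (only meaningful for q ≥ 2)
Qof : ℕ → ℕ → ℕ
Qof zero          n = 0
Qof (suc zero)    n = 0
Qof q@(suc (suc r)) n = (q ℕ.^ n ℕ.∸ 1) / suc r

mQ : ℕ → ℕ → ℕ
mQ m Q = product (filter (λ p → p ∣? Q) (primeDivisors m))

-- Comparisons with a square root √t (t : ℕ), using only integers.

-- X ≥ a·√t   (X a : ℤ)
GeMulSqrt : ℤ → ℤ → ℕ → Set
GeMulSqrt X a t =
    (a ℤ.≤ + 0 × (+ 0 ℤ.≤ X ⊎ X ℤ.* X ℤ.≤ a ℤ.* a ℤ.* + t))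
  ⊎ (+ 0 ℤ.< a × + 0 ℤ.≤ X × a ℤ.* a ℤ.* + t ℤ.≤ X ℤ.* X)

GeAffSqrt : ℤ → ℤ → ℤ → ℕ → Set
GeAffSqrt X Y a t = GeMulSqrt (X ℤ.- Y) a t

SqrtGt : ℕ → ℤ → Set
SqrtGt t K = K ℤ.< + 0 ⊎ (+ 0 ℤ.≤ K × K ℤ.* K ℤ.< + t)

{-# OPTIONS --safe #-}
module Submission where

-- Write N = qⁿ - 1, t = qⁿ⁻¹, r = ∏ p and Φ = ∏ (p - 1) over the primes p dividing m.  Since
-- W(m_Q) ≤ W(m), it suffices to prove |r 𝒩_β(m) - Φ t| ≤ Φ (2 W(m) - 1) √t.
--
-- Characters are replaced by integer-valued functions: the sum of the characters of order p is
-- c p = p [x is a p-th power] - 1, and the sum of those of squarefree order d is ∏ c p over p ∣ d.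
-- All these functions f on F* are positive definite, and so are their push-forwards under squaring.
-- If f is positive definite with ∑ f = 0, the Cauchy-Schwarz inequality for the form
-- ∑ f(x/y) v(x) w(y), applied to the point mass at 1 and the indicator of Y = {y : Tr y = β}, gives
-- (∑_{y ∈ Y} f(y))² ≤ f(1) ∑_{x,y ∈ Y} f(x/y).  The number of pairs in Y² with quotient w is t for
-- w = 1, zero for the other w in F_q, and t/q for w outside F_q; as ∑ f = 0 and ∑_{F_q*} f ≥ 0, the
-- double sum is at most t f(1).  So |∑_Y f| ≤ f(1) √t, with f(1) ≤ 2 ∏ (p - 1) for the push-forward
-- of ∏ c p.  Expanding r [ξ is m-free] = ∏ (p - 1 - c p ξ) and summing over Tr ξ² = β finishes.


open import Defs
open import Level using (0ℓ)
open import Algebra.Bundles using (CommutativeMonoid; CommutativeRing)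
import Algebra.Properties.CommutativeMonoid.Sum as MonoidSum
import Algebra.Properties.CommutativeSemigroup as CommutativeSemigroupProperties
import Algebra.Properties.CommutativeSemiring.Binomial as Binomial
import Algebra.Properties.CommutativeSemiring.Exp as Exp
import Algebra.Properties.Ring as RingProperties
import Algebra.Properties.Semiring.Mult as Mult
open import Data.Fin.Base using (Fin; zero; suc; toℕ; inject₁; fromℕ)
open import Data.Fin.Permutation using (Permutation; permutation)
import Data.Fin.Properties as Fin
open import Data.List.Base using ([]; _∷_; _++_; [_]; map; filter; upTo; applyUpTo; _∷ʳ_)
open import Data.List.Membership.Propositional using (_∈_)
open import Data.List.Membership.Propositional.Properties using (∈-∃++; ∈-++⁺ˡ; ∈-++⁺ʳ; ∈-++⁻; ∈-filter⁺; ∈-filter⁻; ∈-upTo⁺)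
open import Data.List.Properties using (map-upTo; applyUpTo-∷ʳ; filter-++; length-++; length-++-sucʳ)
open import Data.List.Relation.Unary.All as All using (All; []; _∷_)
import Data.List.Relation.Unary.All.Properties as All
open import Data.List.Relation.Unary.AllPairs using ([]; _∷_)
open import Data.List.Relation.Unary.Any using (here; there)
open import Data.List.Relation.Unary.Unique.Propositional using (Unique)
import Data.List.Relation.Unary.Unique.Propositional.Properties as Unique
open import Data.Maybe.Base using (nothing)
open import Data.Nat.Base as ℕ using (zero; suc; _!)
open import Data.Nat.Combinatorics using (_C_; nCk≡n!/k![n-k]!; k![n∸k]!∣n!; nCn≡1; nCk≡nC[n∸k])
open import Data.Nat.Coprimality using (Coprime; coprime-Bézout)
open import Data.Nat.DivMod using (m*[n/m]≡n; m/n*n≡m)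
open import Data.Nat.Divisibility using (_∣?_; divides; ∣-refl; ∣-trans; ∣⇒≤; ∣1⇒≡1; 1∣_; _∣0; 0∣⇒≡0; m∣m*n; n∣m*n; ∣m⇒∣m*n; ∣n⇒∣m*n; *-monoʳ-∣; ∣m+n∣m⇒∣n; ∣m∣n⇒∣m+n)
open import Data.Nat.GCD using (gcd; gcd[m,n]∣m; gcd[m,n]∣n; gcd-greatest; gcd[m,n]≢0; module Bézout)
open import Data.Nat.ListAction using (product)
open import Data.Nat.Primality using (prime?; prime[2]; ¬prime[0]; ¬prime[1]; prime⇒irreducible; prime⇒nonTrivial; prime⇒nonZero; euclidsLemma; productOfPrimes≢0)
open import Data.Nat.Primality.Factorisation using (factorise; factorisationHasAllPrimeFactors)
import Data.Nat.Properties as ℕ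
open import Data.Product.Base using (_,_; ∃; ∃₂; proj₁; proj₂)
open import Data.Sum.Base using (_⊎_; inj₁; inj₂; [_,_]′)
open import Data.Vec.Base using (Vec; []; _∷_; replicate)
open import Function.Base using (_∘_; _$_)
open import Function.Bundles using (_↔_; Inverse; _⇔_; Equivalence; mk⇔)
open import Relation.Binary.Definitions using (DecidableEquality)
open import Relation.Binary.PropositionalEquality as ≡ using (cong; cong₂)
open import Relation.Nullary using (Dec; yes; no; contradiction)
open import Relation.Nullary.Decidable using (map′; ¬?; _×-dec_)
open import Relation.Unary using (Decidable)
import Data.Integer.Tactic.RingSolver as ℤSolver
import Data.Nat.Tactic.RingSolver as ℕSolver
open import Tactic.RingSolver using (solve-∀)
open import Tactic.RingSolver.Core.AlmostCommutativeRing using (AlmostCommutativeRing; fromCommutativeRing)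

open import Data.Nat using (ℕ)
open import Data.Nat.Divisibility using (_∣_)
open import Data.Nat.DivMod using (_/_)
open import Data.Nat.Primality using (Prime)
open import Data.Integer as ℤ using (+_)
open import Data.List using (List; length)
open import Data.Product using (_×_)
open import Relation.Binary.PropositionalEquality using (_≡_; _≢_)
open import Relation.Nullary using (¬_)

-- The constant 2 W(m) - 1 has two sources. A nonzero y has 1 + c 2 y square roots; the quadratic
-- part costs √t once. Each of the W(m) - 1 nonempty sets of primes costs 2 √t, up to the common
-- factor Φ. The coefficient in the theorem is (2 W(m) - 1) + 2 (W(m) - W(m_Q)), so it is never
-- smaller.
--
-- Single characters would need complex values, but the sum over all characters of one order is an
-- integer. Its value at 1 is the number of characters in it, so f(1) √t is the same bound as
-- treating them one at a time. Positive definiteness records that f is a nonnegative combination of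
-- characters without naming any; it passes to products and push-forwards because N times the new
-- form is a sum of old forms at twisted test vectors.
--
-- No generator of F* is constructed. The exact counts (elements of F_q, trace fibres, p-th roots)
-- come from upper bounds on numbers of roots of polynomials: the total of the bounds leaves no
-- slack, so each bound is an equality.

module TraceOfSquares where

  open import Data.Integer.Base hiding (suc; _^_; _/_)
  open import Data.Integer.Properties hiding (_≟_)
  import Algebra.Properties.Semiring.Sum +-*-semiring as Sum

  -- Finite sums, reindexing and integer-valued indicators.

  module _ (M : CommutativeMonoid 0ℓ 0ℓ) where
    private
      module M = CommutativeMonoid M
    open CommutativeMonoid M using (_≈_; ε; ∙-cong; ∙-congˡ; identityˡ; identityʳ) renaming (Carrier to B)
    open MonoidSum M using (sum; sum-cong-≋; sum-replicate-zero; sum-permute; sum-cong-≗)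

    sum-single : ∀ {n} (i : Fin n) (f : Fin n → B) → (∀ j → j ≢ i → f j ≈ ε) → sum f ≈ f i
    sum-single {suc n} zero f h = M.trans
      (∙-congˡ (M.trans (sum-cong-≋ (λ j → h (suc j) (λ ()))) (sum-replicate-zero n))) (identityʳ (f zero))
    sum-single {suc n} (suc i) f h =
      M.trans (∙-cong (h zero (λ ()))
      (sum-single i (f ∘ suc) (λ j j≢i → h (suc j) (j≢i ∘ Fin.suc-injective)))) (identityˡ _)

    -- Stated over any commutative monoid because it serves three: integer sums, products of field
    -- elements and sums of field elements.
    sum-reindex : ∀ {n} {A : Set} (enum : Fin n ↔ A) (f : A → B) (σ τ : A → A) →
                  (∀ x → σ (τ x) ≡ x) → (∀ x → τ (σ x) ≡ x) →
                  sum (λ i → f (σ (Inverse.to enum i))) ≈ sum (λ i → f (Inverse.to enum i))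
    sum-reindex {n} enum f σ τ στ τσ =
      M.sym (M.trans (sum-permute (f ∘ to) π) (M.reflexive (sum-cong-≗ (λ i → cong f (to-from (σ (to i)))))))
      where
      to   = Inverse.to enum
      from = Inverse.from enum
      to-from : ∀ x → to (from x) ≡ x
      to-from x = Inverse.inverseˡ enum ≡.refl
      from-to : ∀ i → from (to i) ≡ i
      from-to i = Inverse.inverseʳ enum ≡.refl
      π : Permutation n n
      π = permutation (from ∘ σ ∘ to) (from ∘ τ ∘ to)
            (λ i → ≡.trans (cong (from ∘ σ) (to-from _)) (≡.trans (cong from (στ _)) (from-to i)))
            (λ i → ≡.trans (cong (from ∘ τ) (to-from _)) (≡.trans (cong from (τσ _)) (from-to i)))

  ⟦_⟧ : {P : Set} → Dec P → ℤ
  ⟦ yes _ ⟧ = 1ℤ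
  ⟦ no _ ⟧  = 0ℤ

  ⟦⟧-yes : {P : Set} (d : Dec P) → P → ⟦ d ⟧ ≡ 1ℤ
  ⟦⟧-yes (yes _) p = ≡.refl
  ⟦⟧-yes (no ¬p) p = contradiction p ¬p

  ⟦⟧-no : {P : Set} (d : Dec P) → ¬ P → ⟦ d ⟧ ≡ 0ℤ
  ⟦⟧-no (yes p) ¬p = contradiction p ¬p
  ⟦⟧-no (no _)  ¬p = ≡.refl

  ⟦⟧-cong : {P Q : Set} (d : Dec P) (e : Dec Q) → (P → Q) → (Q → P) → ⟦ d ⟧ ≡ ⟦ e ⟧
  ⟦⟧-cong (yes p) e f g = ≡.sym (⟦⟧-yes e (f p))
  ⟦⟧-cong (no ¬p) e f g = ≡.sym (⟦⟧-no e (¬p ∘ g))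

  ⟦⟧-nonneg : {P : Set} (d : Dec P) → 0ℤ ≤ ⟦ d ⟧
  ⟦⟧-nonneg (yes _) = +≤+ ℕ.z≤n
  ⟦⟧-nonneg (no _)  = ≤-refl

  ⟦⟧*-cong : {P : Set} (d : Dec P) {a b : ℤ} → (P → a ≡ b) → ⟦ d ⟧ * a ≡ ⟦ d ⟧ * b
  ⟦⟧*-cong (yes p) h = cong (1ℤ *_) (h p)
  ⟦⟧*-cong (no ¬p) h = ≡.refl

  square-nonneg : ∀ i → 0ℤ ≤ i * i
  square-nonneg (+ n)    = ≤-trans (+≤+ ℕ.z≤n) (≤-reflexive (pos-* n n))
  square-nonneg -[1+ n ] = +≤+ ℕ.z≤n

  *-nonneg : ∀ {i j} → 0ℤ ≤ i → 0ℤ ≤ j → 0ℤ ≤ i * j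
  *-nonneg {+ m} {+ n} _ _ = ≤-trans (+≤+ ℕ.z≤n) (≤-reflexive (pos-* m n))

  module FiniteSum {s : ℕ} {A : Set} (enum : Fin s ↔ A) where

    private
      to   = Inverse.to enum
      from = Inverse.from enum

      to-from : ∀ x → to (from x) ≡ x
      to-from x = Inverse.inverseˡ enum ≡.refl

      from-to : ∀ i → from (to i) ≡ i
      from-to i = Inverse.inverseʳ enum ≡.refl

    infix 4 _≟_

    abstract
      _≟_ : DecidableEquality A
      x ≟ y = map′ (λ e → ≡.trans (≡.sym (to-from x)) (≡.trans (cong to e) (to-from y))) (cong from)
        (from x Fin.≟ from y)

      search : {R : A → Set} → (∀ x → Dec (R x)) → Dec (∃ R)
      search {R} R? = map′ (λ (i , r) → to i , r) (λ (x , r) → from x , ≡.subst R (≡.sym (to-from x)) r)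
        (Fin.any? (R? ∘ to))

      ∑ : (A → ℤ) → ℤ
      ∑ f = Sum.sum (f ∘ to)

      ∑-cong : ∀ {f g} → (∀ x → f x ≡ g x) → ∑ f ≡ ∑ g
      ∑-cong h = Sum.sum-cong-≗ (h ∘ to)

      ∑-distrib-+ : ∀ f g → ∑ (λ x → f x + g x) ≡ ∑ f + ∑ g
      ∑-distrib-+ f g = Sum.∑-distrib-+ (f ∘ to) (g ∘ to)

      *-distribˡ-∑ : ∀ c f → c * ∑ f ≡ ∑ (λ x → c * f x)
      *-distribˡ-∑ c f = Sum.*-distribˡ-sum c (f ∘ to)

      *-distribʳ-∑ : ∀ c f → ∑ f * c ≡ ∑ (λ x → f x * c)
      *-distribʳ-∑ c f = Sum.*-distribʳ-sum c (f ∘ to)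

      ∑-comm : ∀ (f : A → A → ℤ) → ∑ (λ x → ∑ (f x)) ≡ ∑ (λ y → ∑ (λ x → f x y))
      ∑-comm f = Sum.∑-comm (λ i j → f (to i) (to j))

      ∑-zero : ∀ {f} → (∀ x → f x ≡ 0ℤ) → ∑ f ≡ 0ℤ
      ∑-zero h = ≡.trans (∑-cong h) (Sum.sum-replicate-zero s)

      ∑-distrib-- : ∀ f g → ∑ (λ x → f x - g x) ≡ ∑ f - ∑ g
      ∑-distrib-- f g = begin
        ∑ (λ x → f x - g x)                ≡⟨ ∑-cong (λ x → cong (λ e → f x + e) (≡.sym (-1*i≡-i (g x)))) ⟩
        ∑ (λ x → f x + -1ℤ * g x)          ≡⟨ ∑-distrib-+ f (λ x → -1ℤ * g x) ⟩
        ∑ f + ∑ (λ x → -1ℤ * g x)          ≡⟨ cong (λ e → ∑ f + e) (≡.sym (*-distribˡ-∑ -1ℤ g)) ⟩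
        ∑ f + -1ℤ * ∑ g                    ≡⟨ cong (λ e → ∑ f + e) (-1*i≡-i (∑ g)) ⟩
        ∑ f - ∑ g                          ∎
        where open ≡.≡-Reasoning

      private
        sum-mono : ∀ {n} {f g : Fin n → ℤ} → (∀ i → f i ≤ g i) → Sum.sum f ≤ Sum.sum g
        sum-mono {zero}  h = ≤-refl
        sum-mono {suc n} h = +-mono-≤ (h zero) (sum-mono (h ∘ suc))

        sum-const : ∀ n → Sum.sum {n} (λ _ → 1ℤ) ≡ + n
        sum-const zero    = ≡.refl
        sum-const (suc n) = cong (λ e → 1ℤ + e) (sum-const n)

      ∑-mono : ∀ {f g} → (∀ x → f x ≤ g x) → ∑ f ≤ ∑ g
      ∑-mono h = sum-mono (h ∘ to)

      ∑-nonneg : ∀ {f} → (∀ x → 0ℤ ≤ f x) → 0ℤ ≤ ∑ f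
      ∑-nonneg {f} h = ≤-trans (≤-reflexive (≡.sym (∑-zero {λ _ → 0ℤ} (λ _ → ≡.refl)))) (∑-mono h)

      ∑-one : ∑ (λ _ → 1ℤ) ≡ + s
      ∑-one = sum-const s

      ∑-permute : ∀ (f : A → ℤ) (σ τ : A → A) → (∀ x → σ (τ x) ≡ x) → (∀ x → τ (σ x) ≡ x) →
                  ∑ (λ x → f (σ x)) ≡ ∑ f
      ∑-permute = sum-reindex +-0-commutativeMonoid enum

      ∑-δ : ∀ a (f : A → ℤ) → ∑ (λ x → ⟦ x ≟ a ⟧ * f x) ≡ f a
      ∑-δ a f = begin
        ∑ (λ x → ⟦ x ≟ a ⟧ * f x)
          ≡⟨ sum-single +-0-commutativeMonoid (from a) _
               (λ i i≢ → cong (_* f (to i)) (⟦⟧-no (to i ≟ a)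
                 (λ e → i≢ (≡.trans (≡.sym (from-to i)) (cong from e))))) ⟩
        ⟦ to (from a) ≟ a ⟧ * f (to (from a))
          ≡⟨ cong₂ _*_ (⟦⟧-yes (to (from a) ≟ a) (to-from a)) (cong f (to-from a)) ⟩
        1ℤ * f a ≡⟨ *-identityˡ (f a) ⟩
        f a ∎
        where open ≡.≡-Reasoning

    ∑-⟦≟⟧ : ∀ a → ∑ (λ x → ⟦ x ≟ a ⟧) ≡ 1ℤ
    ∑-⟦≟⟧ a = ≡.trans (∑-cong (λ x → ≡.sym (*-identityʳ ⟦ x ≟ a ⟧))) (∑-δ a (λ _ → 1ℤ))

    -- Only z = φ x survives in the inner sum. With φ a power map, this carries a sum against a
    -- push-forward back to a sum over the base points.
    ∑-fibre : ∀ (φ : A → A) (f h : A → ℤ) →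
              ∑ (λ z → ∑ (λ x → ⟦ z ≟ φ x ⟧ * f x) * h z) ≡ ∑ (λ x → f x * h (φ x))
    ∑-fibre φ f h = begin
      ∑ (λ z → ∑ (λ x → ⟦ z ≟ φ x ⟧ * f x) * h z)
        ≡⟨ ∑-cong (λ z → *-distribʳ-∑ (h z) (λ x → ⟦ z ≟ φ x ⟧ * f x)) ⟩
      ∑ (λ z → ∑ (λ x → ⟦ z ≟ φ x ⟧ * f x * h z)) ≡⟨ ∑-comm _ ⟩
      ∑ (λ x → ∑ (λ z → ⟦ z ≟ φ x ⟧ * f x * h z))
        ≡⟨ ∑-cong (λ x → ≡.trans (∑-cong (λ z → *-assoc ⟦ z ≟ φ x ⟧ (f x) (h z)))
          (∑-δ (φ x) (λ z → f x * h z))) ⟩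
      ∑ (λ x → f x * h (φ x)) ∎
      where open ≡.≡-Reasoning

    -- The slack at one point is at most the total slack, which is at most 0. This turns upper
    -- bounds with the right total into exact counts.
    ∑-tight : ∀ {f g} → (∀ x → f x ≤ g x) → ∑ g ≤ ∑ f → ∀ x → f x ≡ g x
    ∑-tight {f} {g} f≤g ∑g≤∑f a = ≤-antisym (f≤g a) (i-j≤0⇒i≤j slack≤0)
      where
      pointwise : ∀ x → ⟦ x ≟ a ⟧ * (g x - f x) ≤ g x - f x
      pointwise x with x ≟ a
      ... | yes _ = ≤-reflexive (*-identityˡ _)
      ... | no _  = i≤j⇒0≤j-i (f≤g x)
      slack≤0 : g a - f a ≤ 0ℤ
      slack≤0 = ≤-trans (≤-reflexive (≡.sym (∑-δ a (λ x → g x - f x))))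
               (≤-trans (∑-mono pointwise)
               (≤-trans (≤-reflexive (∑-distrib-- g f)) (i≤j⇒i-j≤0 ∑g≤∑f)))

  -- Finite fields: inverses, Fermat's theorem and numbers of roots.

  module Field {s : ℕ} (F : FiniteField s) where
    open FiniteField F using (isCommutativeRing; 0≢1; inverse; enumerate) renaming (Carrier to A) public

    commutativeRing : CommutativeRing 0ℓ 0ℓ
    commutativeRing = record { isCommutativeRing = isCommutativeRing }

    almostCommutativeRing : AlmostCommutativeRing 0ℓ 0ℓ
    almostCommutativeRing = fromCommutativeRing commutativeRing (λ _ → nothing)

    open AlmostCommutativeRing almostCommutativeRing using (0#; 1#)
      renaming (_+_ to infixl 6 _⊕_; _*_ to infixl 7 _·_; -_ to infix 8 ⊖_) public
    module R = CommutativeRing commutativeRing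
    open FiniteSum enumerate public

    infixr 9 _^_
    _^_ : A → ℕ → A
    x ^ k = pow F x k

    private
      module E = Exp R.commutativeSemiring
      to   = Inverse.to enumerate
      from = Inverse.from enumerate

      to-from : ∀ x → to (from x) ≡ x
      to-from x = Inverse.inverseˡ enumerate ≡.refl

      from-to : ∀ i → from (to i) ≡ i
      from-to i = Inverse.inverseʳ enumerate ≡.refl

    ^-exp : ∀ x k → x ^ k ≡ x E.^ k
    ^-exp x zero    = ≡.refl
    ^-exp x (suc k) = cong (x ·_) (^-exp x k)

    ^-assoc : ∀ x m n → (x ^ m) ^ n ≡ x ^ (m ℕ.* n)
    ^-assoc x m n rewrite ^-exp (x ^ m) n | ^-exp x m | ^-exp x (m ℕ.* n) = E.^-assocʳ x m n

    ^-distrib-· : ∀ x y n → (x · y) ^ n ≡ x ^ n · y ^ n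
    ^-distrib-· x y n rewrite ^-exp (x · y) n | ^-exp x n | ^-exp y n = E.^-distrib-* x y n

    1^ : ∀ n → 1# ^ n ≡ 1#
    1^ zero    = ≡.refl
    1^ (suc n) = ≡.trans (R.*-identityˡ _) (1^ n)

    ^-comm : ∀ x m n → (x ^ m) ^ n ≡ (x ^ n) ^ m
    ^-comm x m n = ≡.trans (^-assoc x m n) (≡.trans (cong (x ^_) (ℕ.*-comm m n)) (≡.sym (^-assoc x n m)))

    x^1 : ∀ x → x ^ 1 ≡ x
    x^1 = R.*-identityʳ

    infix 10 _⁻¹
    -- Totalised by sending 0 to 0, which makes inversion an involution of the whole carrier and
    -- hence usable for reindexing sums.
    _⁻¹ : A → A
    x ⁻¹ with x ≟ 0#
    ... | yes _  = 0#
    ... | no x≢0 = proj₁ (inverse x x≢0)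

    ·-inverseʳ : ∀ {x} → x ≢ 0# → x · x ⁻¹ ≡ 1#
    ·-inverseʳ {x} x≢0 with x ≟ 0#
    ... | yes x≡0 = contradiction x≡0 x≢0
    ... | no x≢0′ = proj₂ (inverse x x≢0′)

    ·-inverseˡ : ∀ {x} → x ≢ 0# → x ⁻¹ · x ≡ 1#
    ·-inverseˡ {x} x≢0 = ≡.trans (R.*-comm (x ⁻¹) x) (·-inverseʳ x≢0)

    ·-cancelˡ : ∀ {a x y} → a ≢ 0# → a · x ≡ a · y → x ≡ y
    ·-cancelˡ {a} {x} {y} a≢0 e = begin
      x               ≡⟨ R.*-identityˡ x ⟨
      1# · x          ≡⟨ cong (_· x) (·-inverseˡ a≢0) ⟨
      a ⁻¹ · a · x    ≡⟨ R.*-assoc _ _ _ ⟩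
      a ⁻¹ · (a · x)  ≡⟨ cong (a ⁻¹ ·_) e ⟩
      a ⁻¹ · (a · y)  ≡⟨ R.*-assoc _ _ _ ⟨
      a ⁻¹ · a · y    ≡⟨ cong (_· y) (·-inverseˡ a≢0) ⟩
      1# · y          ≡⟨ R.*-identityˡ y ⟩
      y               ∎
      where open ≡.≡-Reasoning

    ·-nonzero : ∀ {x y} → x ≢ 0# → y ≢ 0# → x · y ≢ 0#
    ·-nonzero {x} x≢0 y≢0 e = y≢0 (·-cancelˡ x≢0 (≡.trans e (≡.sym (R.zeroʳ x))))

    ·≡1⇒nonzero : ∀ {x y} → x · y ≡ 1# → x ≢ 0#
    ·≡1⇒nonzero {x} {y} e x≡0 = 0≢1 (≡.trans (≡.sym (R.zeroˡ y)) (≡.trans (cong (_· y) (≡.sym x≡0)) e))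

    ^-nonzero : ∀ {x} n → x ≢ 0# → x ^ n ≢ 0#
    ^-nonzero zero    x≢0 = 0≢1 ∘ ≡.sym
    ^-nonzero (suc n) x≢0 = ·-nonzero x≢0 (^-nonzero n x≢0)

    ^≡0⇒≡0 : ∀ {x} n → x ^ n ≡ 0# → x ≡ 0#
    ^≡0⇒≡0 {x} n e with x ≟ 0#
    ... | yes x≡0 = x≡0
    ... | no x≢0  = contradiction e (^-nonzero n x≢0)

    0^ : ∀ n .{{_ : ℕ.NonZero n}} → 0# ^ n ≡ 0#
    0^ (suc n) = R.zeroˡ _

    ∑-scale : ∀ {a} → a ≢ 0# → ∀ (f : A → ℤ) → ∑ (λ x → f (x · a)) ≡ ∑ f
    ∑-scale {a} a≢0 f = ∑-permute f (_· a) (_· a ⁻¹)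
      (λ x → cancel x (·-inverseˡ a≢0)) (λ x → cancel x (·-inverseʳ a≢0))
      where
      cancel : ∀ x {b c} → b · c ≡ 1# → x · b · c ≡ x
      cancel x e = ≡.trans (R.*-assoc x _ _) (≡.trans (cong (x ·_) e) (R.*-identityʳ x))

    N : ℕ
    N = s ℕ.∸ 1

    s≡1+N : s ≡ suc N
    s≡1+N = ≡.sym (ℕ.suc-pred s {{Fin.nonZeroIndex (from 0#)}})

    private
      module Π = MonoidSum R.*-commutativeMonoid

      Π-nonzero : ∀ {n} (f : Fin n → A) → (∀ i → f i ≢ 0#) → Π.sum f ≢ 0#
      Π-nonzero {zero}  f h = 0≢1 ∘ ≡.sym
      Π-nonzero {suc n} f h = ·-nonzero (h zero) (Π-nonzero (f ∘ suc) (h ∘ suc))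

    -- Multiplication by a permutes the nonzero elements, so it does not change their product.
    x^s≡x : ∀ x → x ^ s ≡ x
    x^s≡x a with a ≟ 0#
    ... | yes ≡.refl = 0^ s {{Fin.nonZeroIndex (from 0#)}}
    ... | no a≢0 = ·-cancelˡ (Π-nonzero (w ∘ to) (w≢0 ∘ to)) $ begin
      Π.sum (w ∘ to) · a ^ s                          ≡⟨ R.*-comm _ _ ⟩
      a ^ s · Π.sum (w ∘ to)
        ≡⟨ cong (_· Π.sum (w ∘ to)) (≡.trans (^-exp a s) (≡.sym (Π.sum-replicate s))) ⟩
      Π.sum {s} (λ _ → a) · Π.sum (w ∘ to)            ≡⟨ Π.∑-distrib-+ {s} (λ _ → a) (w ∘ to) ⟨
      Π.sum (λ i → a · w (to i))                      ≡⟨ Π.sum-cong-≗ (split ∘ to) ⟩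
      Π.sum (λ i → w (to i · a) · d (to i))           ≡⟨ Π.∑-distrib-+ (λ i → w (to i · a)) (d ∘ to) ⟩
      Π.sum (λ i → w (to i · a)) · Π.sum (d ∘ to)     ≡⟨ ≡.cong₂ _·_ permuted isolated ⟩
      Π.sum (w ∘ to) · a                              ∎
      where
      open ≡.≡-Reasoning
      -- `w` replaces 0 by 1, so the product over the whole carrier is invertible. `d` repairs the
      -- identity at 0, where scaling by `a` has no effect, and leaves a single factor `a` against
      -- the s factors on the other side.
      w d : A → A
      w y with y ≟ 0#
      ... | yes _ = 1#
      ... | no _  = y
      d y with y ≟ 0#
      ... | yes _ = a
      ... | no _  = 1#
      w≢0 : ∀ y → w y ≢ 0#
      w≢0 y with y ≟ 0#
      ... | yes _  = 0≢1 ∘ ≡.sym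
      ... | no y≢0 = y≢0
      w-yes : w 0# ≡ 1#
      w-yes with 0# ≟ 0#
      ... | yes _  = ≡.refl
      ... | no 0≢0 = contradiction ≡.refl 0≢0
      w-no : ∀ {y} → y ≢ 0# → w y ≡ y
      w-no {y} y≢0 with y ≟ 0#
      ... | yes y≡0 = contradiction y≡0 y≢0
      ... | no _    = ≡.refl
      split : ∀ y → a · w y ≡ w (y · a) · d y
      split y with y ≟ 0#
      ... | yes ≡.refl = ≡.trans (R.*-comm a 1#) (cong (_· a) (≡.sym (≡.trans (cong w (R.zeroˡ a)) w-yes)))
      ... | no y≢0 = ≡.trans (R.*-comm a y)
        (≡.trans (≡.sym (w-no (·-nonzero y≢0 a≢0))) (≡.sym (R.*-identityʳ _)))
      permuted : Π.sum (λ i → w (to i · a)) ≡ Π.sum (w ∘ to)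
      permuted = sum-reindex R.*-commutativeMonoid enumerate w (_· a) (_· a ⁻¹)
        (λ x → ≡.trans (R.*-assoc x _ _) (≡.trans (cong (x ·_) (·-inverseˡ a≢0)) (R.*-identityʳ x)))
        (λ x → ≡.trans (R.*-assoc x _ _) (≡.trans (cong (x ·_) (·-inverseʳ a≢0)) (R.*-identityʳ x)))
      d-yes : d 0# ≡ a
      d-yes with 0# ≟ 0#
      ... | yes _  = ≡.refl
      ... | no 0≢0 = contradiction ≡.refl 0≢0
      d-no : ∀ {y} → y ≢ 0# → d y ≡ 1#
      d-no {y} y≢0 with y ≟ 0#
      ... | yes y≡0 = contradiction y≡0 y≢0
      ... | no _    = ≡.refl
      isolated : Π.sum (d ∘ to) ≡ a
      isolated = ≡.trans
        (sum-single R.*-commutativeMonoid (from 0#) (d ∘ to)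
          (λ i i≢ → d-no (λ e → i≢ (≡.trans (≡.sym (from-to i)) (cong from e)))))
        (≡.trans (cong d (to-from 0#)) d-yes)

    fermat : ∀ {x} → x ≢ 0# → x ^ N ≡ 1#
    fermat {x} x≢0 = ·-cancelˡ x≢0 $ begin
      x · x ^ N   ≡⟨ cong (x ^_) s≡1+N ⟨
      x ^ s       ≡⟨ x^s≡x x ⟩
      x           ≡⟨ R.*-identityʳ x ⟨
      x · 1#      ∎
      where open ≡.≡-Reasoning

    -- The coefficient vector of a monic polynomial omits the leading coefficient.
    eval : ∀ {d} → Vec A d → A → A
    eval []       x = 1#
    eval (c ∷ cs) x = c ⊕ x · eval cs x

    -- Synthetic division by x - r: by Horner's scheme the coefficients of the quotient are the
    -- values at r of the successive tails.
    quotient : ∀ {d} → A → Vec A (suc d) → Vec A d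
    quotient r (c ∷ [])           = []
    quotient r (c ∷ cs@(_ ∷ _)) = eval cs r ∷ quotient r cs

    -- f(x) - f(r) = (x - r) h(x), with both sides moved so that no subtraction occurs.
    eval-quotient : ∀ {d} r (cs : Vec A (suc d)) x →
      eval cs x ⊕ r · eval (quotient r cs) x ≡ eval cs r ⊕ x · eval (quotient r cs) x
    eval-quotient r (c ∷ [])           x = swap c x r
      where
      swap : ∀ c x r → c ⊕ x · 1# ⊕ r · 1# ≡ c ⊕ r · 1# ⊕ x · 1#
      swap = solve-∀ almostCommutativeRing
    eval-quotient r (c ∷ cs@(_ ∷ _)) x = begin
      c ⊕ x · g ⊕ r · (g′ ⊕ x · h)      ≡⟨ expandˡ c x g r g′ h ⟩
      c ⊕ r · g′ ⊕ x · (g ⊕ r · h)      ≡⟨ cong (λ e → c ⊕ r · g′ ⊕ x · e) (eval-quotient r cs x) ⟩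
      c ⊕ r · g′ ⊕ x · (g′ ⊕ x · h)     ∎
      where
      open ≡.≡-Reasoning
      g = eval cs x
      g′ = eval cs r
      h = eval (quotient r cs) x
      expandˡ : ∀ c x g r g′ h → c ⊕ x · g ⊕ r · (g′ ⊕ x · h) ≡ c ⊕ r · g′ ⊕ x · (g ⊕ r · h)
      expandˡ = solve-∀ almostCommutativeRing

    ⊕-cancelˡ : ∀ a {x y} → a ⊕ x ≡ a ⊕ y → x ≡ y
    ⊕-cancelˡ a = RingProperties.+-cancelˡ R.ring a _ _

    private
      -- A solution x other than r satisfies (x - r) h(x) = 0, with h the quotient, so it is a root
      -- of h.
      fibre-step : ∀ {d} (cs : Vec A (suc d)) γ (r : A) → eval cs r ≡ γ → ∀ x →
        ⟦ eval cs x ≟ γ ⟧ ≤ ⟦ x ≟ r ⟧ + ⟦ eval (quotient r cs) x ≟ 0# ⟧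
      fibre-step cs γ r fr≡γ x with eval cs x ≟ γ | x ≟ r
      ... | no _     | yes _ = +-mono-≤ {0ℤ} {1ℤ} {0ℤ} (+≤+ ℕ.z≤n) (⟦⟧-nonneg (eval (quotient r cs) x ≟ 0#))
      ... | no _     | no _  = +-mono-≤ {0ℤ} {0ℤ} {0ℤ} ≤-refl (⟦⟧-nonneg (eval (quotient r cs) x ≟ 0#))
      ... | yes _    | yes _ = +-mono-≤ {1ℤ} {1ℤ} {0ℤ} ≤-refl (⟦⟧-nonneg (eval (quotient r cs) x ≟ 0#))
      ... | yes fx≡γ | no x≢r = ≤-reflexive (≡.sym (≡.trans (+-identityˡ _) (⟦⟧-yes (h ≟ 0#) h≡0)))
        where
        h = eval (quotient r cs) x
        r·h≡x·h : h · r ≡ h · x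
        r·h≡x·h = ≡.trans (R.*-comm h r) (≡.trans (⊕-cancelˡ γ (≡.trans (cong (_⊕ r · h) (≡.sym fx≡γ))
          (≡.trans (eval-quotient r cs x) (cong (_⊕ x · h) fr≡γ)))) (R.*-comm x h))
        h≡0 : h ≡ 0#
        h≡0 with h ≟ 0#
        ... | yes e = e
        ... | no h≢0 = contradiction (≡.sym (·-cancelˡ h≢0 r·h≡x·h)) x≢r

      fibre-bound′ : ∀ {d} (cs : Vec A (suc d)) γ →
        (∀ r → ∑ (λ x → ⟦ eval (quotient r cs) x ≟ 0# ⟧) ≤ + d) → ∑ (λ x → ⟦ eval cs x ≟ γ ⟧) ≤ + (suc d)
      fibre-bound′ {d} cs γ ih with search (λ r → eval cs r ≟ γ)
      ... | no ∄ = ≤-trans (≤-reflexive (∑-zero (λ x → ⟦⟧-no (eval cs x ≟ γ) (λ e → ∄ (x , e))))) (+≤+ ℕ.z≤n)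
      ... | yes (r , fr≡γ) = begin
        ∑ (λ x → ⟦ eval cs x ≟ γ ⟧)                                      ≤⟨ ∑-mono (fibre-step cs γ r fr≡γ) ⟩
        ∑ (λ x → ⟦ x ≟ r ⟧ + ⟦ eval (quotient r cs) x ≟ 0# ⟧)            ≡⟨ ∑-distrib-+ _ _ ⟩
        ∑ (λ x → ⟦ x ≟ r ⟧) + ∑ (λ x → ⟦ eval (quotient r cs) x ≟ 0# ⟧)
          ≤⟨ +-mono-≤ (≤-reflexive (∑-⟦≟⟧ r)) (ih r) ⟩
        + (suc d)                                                        ∎
        where open ≤-Reasoning

      root-bound : ∀ {d} (cs : Vec A d) → ∑ (λ x → ⟦ eval cs x ≟ 0# ⟧) ≤ + d
      root-bound []         = ≤-reflexive (∑-zero (λ x → ⟦⟧-no (1# ≟ 0#) (0≢1 ∘ ≡.sym)))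
      root-bound cs@(_ ∷ _) = fibre-bound′ cs 0# (λ r → root-bound (quotient r cs))

    -- Positive degree is essential, since the constant 1 takes the value 1 everywhere. The
    -- recursion therefore runs over roots only, where degree zero is settled by 1 ≠ 0, and an
    -- arbitrary value γ is treated in the last step.
    fibre-bound : ∀ {d} (cs : Vec A (suc d)) γ → ∑ (λ x → ⟦ eval cs x ≟ γ ⟧) ≤ + (suc d)
    fibre-bound cs γ = fibre-bound′ cs γ (λ r → root-bound (quotient r cs))

    eval-replicate : ∀ d x → eval (replicate d 0#) x ≡ x ^ d
    eval-replicate zero    x = ≡.refl
    eval-replicate (suc d) x = ≡.trans (R.+-identityˡ _) (cong (x ·_) (eval-replicate d x))

    ^-fibre-bound : ∀ d .{{_ : ℕ.NonZero d}} γ → ∑ (λ x → ⟦ x ^ d ≟ γ ⟧) ≤ + d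
    ^-fibre-bound (suc d) γ = ≤-trans
      (≤-reflexive (∑-cong (λ x → cong (λ e → ⟦ e ≟ γ ⟧) (≡.sym (eval-replicate (suc d) x)))))
      (fibre-bound (replicate (suc d) 0#) γ)

    -- A term of degree below d leaves the polynomial monic of degree d. This builds X^q - X and the
    -- trace polynomial.
    add-monomial : ∀ {d} (cs : Vec A d) a {e} → e ℕ.< d → ∃ λ (cs′ : Vec A d) → ∀ x
      → eval cs′ x ≡ a · x ^ e ⊕ eval cs x
    add-monomial (c ∷ cs) a {zero}  _ = (a · 1# ⊕ c) ∷ cs , λ x → R.+-assoc (a · 1#) c (x · eval cs x)
    add-monomial (c ∷ cs) a {suc e} (ℕ.s≤s e<d) with add-monomial cs a e<d
    ... | cs′ , eq = c ∷ cs′ , λ x → ≡.trans (cong (λ g → c ⊕ x · g) (eq x)) (shift c x a (x ^ e) (eval cs x))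
      where
      shift : ∀ c x a y g → c ⊕ x · (a · y ⊕ g) ≡ a · (x · y) ⊕ (c ⊕ x · g)
      shift = solve-∀ almostCommutativeRing

  -- Additivity of the Frobenius map.

  prime∤! : ∀ {p} → Prime p → ∀ k → k ℕ.< p → ¬ p ∣ k !
  prime∤! p-prime zero    k<p p∣1 = ¬prime[1] (≡.subst Prime (∣1⇒≡1 p∣1) p-prime)
  prime∤! p-prime (suc k) k<p p∣k! with euclidsLemma (suc k) (k !) p-prime p∣k!
  ... | inj₁ p∣1+k = ℕ.<⇒≱ k<p (∣⇒≤ p∣1+k)
  ... | inj₂ p∣k!′ = prime∤! p-prime k (ℕ.<-trans (ℕ.n<1+n k) k<p) p∣k!′

  -- p divides p! = C(p,k) k! (p-k)! but neither of the two factorials on the right.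
  prime∣C : ∀ {p} → Prime p → ∀ k → 0 ℕ.< k → k ℕ.< p → p ∣ p C k
  prime∣C {p@(suc p-1)} p-prime k 0<k k<p with euclidsLemma (p C k) (k ! ℕ.* (p ℕ.∸ k) !) p-prime p∣prod
    where
    instance _ = k ℕ.!* (p ℕ.∸ k) !≢0
    k≤p = ℕ.<⇒≤ k<p
    C*≡! : (p C k) ℕ.* (k ! ℕ.* (p ℕ.∸ k) !) ≡ p !
    C*≡! = ≡.trans (cong (ℕ._* (k ! ℕ.* (p ℕ.∸ k) !)) (nCk≡n!/k![n-k]! k≤p)) (m/n*n≡m (k![n∸k]!∣n! k≤p))
    p∣prod : p ∣ (p C k) ℕ.* (k ! ℕ.* (p ℕ.∸ k) !)
    p∣prod = ≡.subst (p ∣_) (≡.sym C*≡!) (m∣m*n (p-1 !))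
  ... | inj₁ p∣C = p∣C
  ... | inj₂ p∣!! with euclidsLemma (k !) ((p ℕ.∸ k) !) p-prime p∣!!
  ... | inj₁ p∣k! = contradiction p∣k! (prime∤! p-prime k k<p)
  ... | inj₂ p∣! = contradiction p∣! (prime∤! p-prime (p ℕ.∸ k) (ℕ.∸-monoʳ-< {p} 0<k (ℕ.<⇒≤ k<p)))
  prime∣C {zero} p-prime = contradiction p-prime ¬prime[0]

  module Characteristic {s : ℕ} (F : FiniteField s) {p j : ℕ} (p-prime : Prime p) (s≡p^j : s ≡ p ℕ.^ j) where
    open Field F

    private
      module X = Mult R.semiring
      module E = Exp R.commutativeSemiring
      module B = Binomial R.commutativeSemiring
      module S = MonoidSum R.+-commutativeMonoid
      to = Inverse.to enumerate

    -- Translation by 1 permutes the field, so the sum of all elements is unchanged when s copies of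
    -- 1 are added to it.
    s×1≡0 : s X.× 1# ≡ 0#
    s×1≡0 = ⊕-cancelˡ (S.sum to) $ begin
      S.sum to ⊕ s X.× 1#             ≡⟨ cong (S.sum to ⊕_) (S.sum-replicate s) ⟨
      S.sum to ⊕ S.sum {s} (λ _ → 1#) ≡⟨ S.∑-distrib-+ to (λ _ → 1#) ⟨
      S.sum (λ i → to i ⊕ 1#)
        ≡⟨ sum-reindex R.+-commutativeMonoid enumerate (λ x → x) (_⊕ 1#) (_⊕ ⊖ 1#)
                                           (λ x → cancel x (R.-‿inverseˡ 1#))
                                             (λ x → cancel x (R.-‿inverseʳ 1#)) ⟩
      S.sum to                        ≡⟨ R.+-identityʳ _ ⟨
      S.sum to ⊕ 0#                   ∎
      where
      open ≡.≡-Reasoning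
      cancel : ∀ x {b c} → b ⊕ c ≡ 0# → x ⊕ b ⊕ c ≡ x
      cancel x e = ≡.trans (R.+-assoc x _ _) (≡.trans (cong (x ⊕_) e) (R.+-identityʳ x))

    -- s · 1 is the j-th power of p · 1, and a field has no nilpotents.
    p×1≡0 : p X.× 1# ≡ 0#
    p×1≡0 = ^≡0⇒≡0 j (≡.trans (≡.sym (power j)) (≡.trans (cong (X._× 1#) (≡.sym s≡p^j)) s×1≡0))
      where
      power : ∀ i → (p ℕ.^ i) X.× 1# ≡ (p X.× 1#) ^ i
      power zero    = X.×-homo-1 1#
      power (suc i) = ≡.trans (X.×1-homo-* p (p ℕ.^ i)) (cong ((p X.× 1#) ·_) (power i))

    p∣m⇒m×x≡0 : ∀ {m} x → p ∣ m → m X.× x ≡ 0#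
    p∣m⇒m×x≡0 x (divides c ≡.refl) = begin
      (c ℕ.* p) X.× x       ≡⟨ X.×-assocˡ x c p ⟨
      c X.× (p X.× x)       ≡⟨ cong (λ e → c X.× (p X.× e)) (R.*-identityˡ x) ⟨
      c X.× (p X.× (1# · x)) ≡⟨ cong (c X.×_) (X.×-assoc-* p 1# x) ⟨
      c X.× (p X.× 1# · x)  ≡⟨ cong (λ e → c X.× (e · x)) p×1≡0 ⟩
      c X.× (0# · x)        ≡⟨ cong (c X.×_) (R.zeroˡ x) ⟩
      c X.× 0#              ≡⟨ S.sum-replicate c ⟨
      S.sum {c} (λ _ → 0#)  ≡⟨ S.sum-replicate-zero c ⟩
      0#                    ∎
      where open ≡.≡-Reasoning

    private
      ends : ∀ {m} (f : Fin (suc (suc m)) → A) → (∀ i → f (suc (inject₁ i)) ≡ 0#) → S.sum f ≡ f zero ⊕ f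
        (fromℕ (suc m))
      ends {m} f h = cong (f zero ⊕_) (≡.trans (S.sum-init-last (f ∘ suc))
        (≡.trans (cong (_⊕ f (fromℕ (suc m))) (≡.trans (S.sum-cong-≗ h) (S.sum-replicate-zero m)))
          (R.+-identityˡ _)))

      binomial-ends : ∀ m → p ≡ suc m → ∀ x y → (x ⊕ y) ^ suc m ≡ x ^ suc m ⊕ y ^ suc m
      binomial-ends m p≡ x y = begin
        (x ⊕ y) ^ suc m                 ≡⟨ ^-exp (x ⊕ y) (suc m) ⟩
        (x ⊕ y) E.^ suc m               ≡⟨ B.theorem (suc m) x y ⟩
        S.sum (B.binomialTerm x y (suc m)) ≡⟨ ends (B.binomialTerm x y (suc m)) middle ⟩
        B.binomialTerm x y (suc m) zero ⊕ B.binomialTerm x y (suc m) (fromℕ (suc m)) ≡⟨ cong₂ _⊕_ first last ⟩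
        y ^ suc m ⊕ x ^ suc m           ≡⟨ R.+-comm _ _ ⟩
        x ^ suc m ⊕ y ^ suc m           ∎
        where
        open ≡.≡-Reasoning
        middle : ∀ i → B.binomialTerm x y (suc m) (suc (inject₁ i)) ≡ 0#
        middle i = p∣m⇒m×x≡0 _ (≡.subst (λ P → p ∣ P C suc (toℕ (inject₁ i))) p≡
          (prime∣C p-prime (suc (toℕ (inject₁ i))) (ℕ.s≤s ℕ.z≤n)
            (≡.subst₂ ℕ._<_ (≡.sym (cong suc (Fin.toℕ-inject₁ i))) (≡.sym p≡) (ℕ.s≤s (Fin.toℕ<n i)))))
        first : B.binomialTerm x y (suc m) zero ≡ y ^ suc m
        first = ≡.trans (cong (X._× (1# · y E.^ suc m))
          (≡.trans (nCk≡nC[n∸k] {0} {suc m} ℕ.z≤n) (nCn≡1 (suc m))))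
          (≡.trans (X.×-homo-1 _) (≡.trans (R.*-identityˡ _) (≡.sym (^-exp y (suc m)))))
        last : B.binomialTerm x y (suc m) (fromℕ (suc m)) ≡ x ^ suc m
        last rewrite Fin.toℕ-fromℕ m | nCn≡1 (suc m) | ℕ.n∸n≡0 m =
          ≡.trans (X.×-homo-1 _) (≡.trans (R.*-identityʳ _) (≡.sym (^-exp x (suc m))))

    ^p-distrib-⊕ : ∀ x y → (x ⊕ y) ^ p ≡ x ^ p ⊕ y ^ p
    ^p-distrib-⊕ x y = go p ≡.refl
      where
      go : ∀ m → p ≡ m → (x ⊕ y) ^ m ≡ x ^ m ⊕ y ^ m
      go zero    p≡0 = contradiction (≡.subst Prime p≡0 p-prime) ¬prime[0]
      go (suc m) p≡  = binomial-ends m p≡ x y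

    ^p^-distrib-⊕ : ∀ i x y → (x ⊕ y) ^ (p ℕ.^ i) ≡ x ^ (p ℕ.^ i) ⊕ y ^ (p ℕ.^ i)
    ^p^-distrib-⊕ zero    x y = ≡.trans (x^1 (x ⊕ y)) (cong₂ _⊕_ (≡.sym (x^1 x)) (≡.sym (x^1 y)))
    ^p^-distrib-⊕ (suc i) x y = begin
      (x ⊕ y) ^ (p ℕ.* p ℕ.^ i)                 ≡⟨ ^-assoc (x ⊕ y) p _ ⟨
      ((x ⊕ y) ^ p) ^ (p ℕ.^ i)                 ≡⟨ cong (_^ (p ℕ.^ i)) (^p-distrib-⊕ x y) ⟩
      (x ^ p ⊕ y ^ p) ^ (p ℕ.^ i)               ≡⟨ ^p^-distrib-⊕ i (x ^ p) (y ^ p) ⟩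
      (x ^ p) ^ (p ℕ.^ i) ⊕ (y ^ p) ^ (p ℕ.^ i) ≡⟨ cong₂ _⊕_ (^-assoc x p _) (^-assoc y p _) ⟩
      x ^ (p ℕ.* p ℕ.^ i) ⊕ y ^ (p ℕ.* p ℕ.^ i) ∎
      where open ≡.≡-Reasoning

  -- The subfield F_q and the fibres of the trace.

  module Trace {p k q n′ : ℕ} (p-prime : Prime p) (1≤k : 1 ℕ.≤ k) (q≡p^k : q ≡ p ℕ.^ k)
               (F : FiniteField (q ℕ.^ suc n′)) where

    open Field F
    private
      module ⊕ = CommutativeSemigroupProperties (CommutativeMonoid.commutativeSemigroup R.+-commutativeMonoid)
      n = suc n′
      q^i≡p^ki : ∀ i → q ℕ.^ i ≡ p ℕ.^ (k ℕ.* i)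
      q^i≡p^ki i = ≡.trans (cong (ℕ._^ i) q≡p^k) (ℕ.^-*-assoc p k i)
      open Characteristic F {j = k ℕ.* n} p-prime (q^i≡p^ki n)

    1<q : 1 ℕ.< q
    1<q = ≡.subst (1 ℕ.<_) (≡.sym q≡p^k)
      (ℕ.≤-trans (ℕ.nonTrivial⇒n>1 p {{prime⇒nonTrivial p-prime}})
        (ℕ.≤-trans (ℕ.≤-reflexive (≡.sym (ℕ.*-identityʳ p)))
          (ℕ.^-monoʳ-≤ p {{ℕ.>-nonZero (ℕ.<-trans (ℕ.n<1+n 0)
            (ℕ.nonTrivial⇒n>1 p {{prime⇒nonTrivial p-prime}}))}} 1≤k)))

    t : ℕ
    t = q ℕ.^ n′

    instance
      q-nonZero : ℕ.NonZero q
      q-nonZero = ℕ.>-nonZero (ℕ.<-trans (ℕ.n<1+n 0) 1<q)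
      t-nonZero : ℕ.NonZero t
      t-nonZero = ℕ.m^n≢0 q n′

    ^qⁱ-distrib-⊕ : ∀ i x y → (x ⊕ y) ^ (q ℕ.^ i) ≡ x ^ (q ℕ.^ i) ⊕ y ^ (q ℕ.^ i)
    ^qⁱ-distrib-⊕ i = ≡.subst (λ e → ∀ x y → (x ⊕ y) ^ e ≡ x ^ e ⊕ y ^ e) (≡.sym (q^i≡p^ki i))
      (^p^-distrib-⊕ (k ℕ.* i))

    ^q-distrib-⊕ : ∀ x y → (x ⊕ y) ^ q ≡ x ^ q ⊕ y ^ q
    ^q-distrib-⊕ = ≡.subst (λ e → ∀ x y → (x ⊕ y) ^ e ≡ x ^ e ⊕ y ^ e) (≡.sym q≡p^k) (^p^-distrib-⊕ k)

    Fq : A → Set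
    Fq = InSubfield F q

    Fq? : ∀ x → Dec (Fq x)
    Fq? x = x ^ q ≟ x

    Fq-⊕ : ∀ {x y} → Fq x → Fq y → Fq (x ⊕ y)
    Fq-⊕ {x} {y} x∈ y∈ = ≡.trans (^q-distrib-⊕ x y) (cong₂ _⊕_ x∈ y∈)

    Fq-· : ∀ {x y} → Fq x → Fq y → Fq (x · y)
    Fq-· {x} {y} x∈ y∈ = ≡.trans (^-distrib-· x y q) (cong₂ _·_ x∈ y∈)

    Fq-0 : Fq 0#
    Fq-0 = 0^ q

    Fq-1 : Fq 1#
    Fq-1 = 1^ q

    Fq-⊖ : ∀ {x} → Fq x → Fq (⊖ x)
    Fq-⊖ {x} x∈ = ⊕-cancelˡ x $ begin
      x ⊕ (⊖ x) ^ q      ≡⟨ cong (_⊕ (⊖ x) ^ q) x∈ ⟨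
      x ^ q ⊕ (⊖ x) ^ q  ≡⟨ ^q-distrib-⊕ x (⊖ x) ⟨
      (x ⊕ ⊖ x) ^ q      ≡⟨ cong (_^ q) (R.-‿inverseʳ x) ⟩
      0# ^ q             ≡⟨ Fq-0 ⟩
      0#                 ≡⟨ R.-‿inverseʳ x ⟨
      x ⊕ ⊖ x            ∎
      where open ≡.≡-Reasoning

    Fq-⁻¹ : ∀ {x} → x ≢ 0# → Fq x → Fq (x ⁻¹)
    Fq-⁻¹ {x} x≢0 x∈ = ·-cancelˡ x≢0 $ begin
      x · (x ⁻¹) ^ q      ≡⟨ cong (_· (x ⁻¹) ^ q) x∈ ⟨
      x ^ q · (x ⁻¹) ^ q  ≡⟨ ^-distrib-· x (x ⁻¹) q ⟨
      (x · x ⁻¹) ^ q      ≡⟨ cong (_^ q) (·-inverseʳ x≢0) ⟩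
      1# ^ q              ≡⟨ Fq-1 ⟩
      1#                  ≡⟨ ·-inverseʳ x≢0 ⟨
      x · x ⁻¹            ∎
      where open ≡.≡-Reasoning

    Fq-^qⁱ : ∀ i {x} → Fq x → x ^ (q ℕ.^ i) ≡ x
    Fq-^qⁱ zero    {x} x∈ = x^1 x
    Fq-^qⁱ (suc i) {x} x∈ = ≡.trans (≡.sym (^-assoc x q (q ℕ.^ i)))
      (≡.trans (cong (_^ (q ℕ.^ i)) x∈) (Fq-^qⁱ i x∈))

    tr : A → A
    tr = Tr F q n

    Tr-⊕ : ∀ i x y → Tr F q i (x ⊕ y) ≡ Tr F q i x ⊕ Tr F q i y
    Tr-⊕ zero    x y = ≡.sym (R.+-identityˡ 0#)
    Tr-⊕ (suc i) x y = ≡.trans (cong₂ _⊕_ (Tr-⊕ i x y) (^qⁱ-distrib-⊕ i x y)) (⊕.interchange _ _ _ _)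

    Tr-· : ∀ i {c} x → Fq c → Tr F q i (c · x) ≡ c · Tr F q i x
    Tr-· zero    {c} x c∈ = ≡.sym (R.zeroʳ c)
    Tr-· (suc i) {c} x c∈ = ≡.trans
      (cong₂ _⊕_ (Tr-· i x c∈) (≡.trans (^-distrib-· c x (q ℕ.^ i)) (cong (_· x ^ (q ℕ.^ i)) (Fq-^qⁱ i c∈))))
      (≡.sym (R.distribˡ c _ _))

    -- Raising to the q-th power shifts the summands by one place. The two end terms are moved
    -- across so that no subtraction occurs.
    Tr-^q : ∀ i x → (Tr F q i x) ^ q ⊕ x ≡ Tr F q i x ⊕ x ^ (q ℕ.^ i)
    Tr-^q zero    x = cong₂ _⊕_ Fq-0 (≡.sym (x^1 x))
    Tr-^q (suc i) x = begin
      (Tr F q i x ⊕ y) ^ q ⊕ x           ≡⟨ cong (_⊕ x) (^q-distrib-⊕ _ y) ⟩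
      (Tr F q i x) ^ q ⊕ y ^ q ⊕ x       ≡⟨ ⊕.xy∙z≈xz∙y _ _ _ ⟩
      (Tr F q i x) ^ q ⊕ x ⊕ y ^ q
        ≡⟨ cong₂ _⊕_ (Tr-^q i x) (≡.trans (^-comm x (q ℕ.^ i) q) (^-assoc x q (q ℕ.^ i))) ⟩
      Tr F q i x ⊕ y ⊕ x ^ (q ℕ.^ suc i) ∎
      where
      open ≡.≡-Reasoning
      y = x ^ (q ℕ.^ i)

    -- At i = n the shift closes up: the new end term x^(q^n) equals x.
    tr∈Fq : ∀ x → Fq (tr x)
    tr∈Fq x = ⊕-cancelˡ x (≡.trans (R.+-comm x _)
      (≡.trans (Tr-^q n x) (≡.trans (cong (tr x ⊕_) (x^s≡x x)) (R.+-comm _ x))))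

    tr-0 : tr 0# ≡ 0#
    tr-0 = ≡.trans (cong tr (≡.sym (R.zeroˡ 0#))) (≡.trans (Tr-· n 0# Fq-0) (R.zeroˡ _))

    -- The subfield consists of the roots of X^q - X, which is monic of degree q because 1 < q.
    Fq-bound : ∑ (λ x → ⟦ Fq? x ⟧) ≤ + q
    Fq-bound = go q ≡.refl
      where
      go : ∀ d → q ≡ d → ∑ (λ x → ⟦ Fq? x ⟧) ≤ + d
      go zero    q≡0 = contradiction (≡.subst (1 ℕ.<_) q≡0 1<q) (λ ())
      go (suc d) q≡  with add-monomial (replicate (suc d) 0#) (⊖ 1#) (≡.subst (1 ℕ.<_) q≡ 1<q)
      ... | cs , eq = ≤-trans (≤-reflexive (∑-cong (λ x → ⟦⟧-cong (Fq? x) (eval cs x ≟ 0#)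
          (λ x∈ → ≡.trans (poly x) (≡.trans (cong (⊖ x ⊕_) x∈) (R.-‿inverseˡ x)))
          (λ e → ⊕-cancelˡ (⊖ x) (≡.trans (≡.sym (poly x)) (≡.trans e (≡.sym (R.-‿inverseˡ x))))))))
            (fibre-bound cs 0#)
        where
        poly : ∀ x → eval cs x ≡ ⊖ x ⊕ x ^ q
        poly x = ≡.trans (eq x) (cong₂ _⊕_
          (≡.trans (cong (⊖ 1# ·_) (x^1 x)) (RingProperties.-1*x≈-x R.ring x))
          (≡.trans (eval-replicate (suc d) x) (cong (x ^_) (≡.sym q≡))))

    -- The summand X^t, t = q^(n-1), is the leading term of the trace and is present from the start.
    -- At i = n - 1 the polynomial is the full trace, monic of degree t.
    Tr-polynomial : ∀ i → i ℕ.≤ n′ → ∃ λ (cs : Vec A t) → ∀ x → eval cs x ≡ Tr F q i x ⊕ x ^ t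
    Tr-polynomial zero    _   = replicate t 0# , λ x → ≡.trans (eval-replicate t x) (≡.sym (R.+-identityˡ _))
    Tr-polynomial (suc i) i<n′ with Tr-polynomial i (ℕ.<⇒≤ i<n′)
    ... | cs , eq with add-monomial cs 1# (ℕ.^-monoʳ-< q 1<q i<n′)
    ... | cs′ , eq′ = cs′ , λ x → ≡.trans (eq′ x)
      (≡.trans (cong₂ _⊕_ (R.*-identityˡ _) (eq x)) (⊕.x∙yz≈yx∙z _ _ _))

    tr-fibre-bound : ∀ γ → ∑ (λ x → ⟦ tr x ≟ γ ⟧) ≤ + t
    tr-fibre-bound γ with Tr-polynomial n′ ℕ.≤-refl
    ... | cs , eq = go t ≡.refl cs eq
      where
      go : ∀ d → t ≡ d → (cs : Vec A d) → (∀ x → eval cs x ≡ tr x) → ∑ (λ x → ⟦ tr x ≟ γ ⟧) ≤ + d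
      go zero    t≡0 cs eq = contradiction t≡0 (ℕ.≢-nonZero⁻¹ t)
      go (suc d) _   cs eq = ≤-trans (≤-reflexive (∑-cong (λ x → cong (λ e → ⟦ e ≟ γ ⟧) (≡.sym (eq x)))))
        (fibre-bound cs γ)

    private
      fibre-size : A → ℤ
      fibre-size γ = ∑ (λ x → ⟦ tr x ≟ γ ⟧)

      ∑-fibre-size : ∑ fibre-size ≡ + t * + q
      ∑-fibre-size = begin
        ∑ fibre-size                          ≡⟨ ∑-comm _ ⟩
        ∑ (λ x → ∑ (λ γ → ⟦ tr x ≟ γ ⟧))
          ≡⟨ ∑-cong (λ x → ≡.trans (∑-cong (λ γ → ⟦⟧-cong (tr x ≟ γ) (γ ≟ tr x) ≡.sym ≡.sym))
          (∑-⟦≟⟧ (tr x))) ⟩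
        ∑ (λ _ → 1ℤ)                          ≡⟨ ∑-one ⟩
        + (q ℕ.* t)                           ≡⟨ pos-* q t ⟩
        + q * + t                             ≡⟨ *-comm (+ q) (+ t) ⟩
        + t * + q                             ∎
        where open ≡.≡-Reasoning

      fibre-size≤ : ∀ γ → fibre-size γ ≤ + t * ⟦ Fq? γ ⟧
      fibre-size≤ γ with Fq? γ
      ... | yes _ = ≤-trans (tr-fibre-bound γ) (≤-reflexive (≡.sym (*-identityʳ (+ t))))
      ... | no γ∉ = ≤-reflexive (≡.trans (∑-zero (λ x → ⟦⟧-no (tr x ≟ γ) (λ e → γ∉ (≡.subst Fq e (tr∈Fq x)))))
        (≡.sym (*-zeroʳ (+ t))))

    -- The q t elements of the field lie in trace fibres of size at most t, nonempty only over F_q.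
    -- So F_q has at least q elements.
    card-Fq : ∑ (λ x → ⟦ Fq? x ⟧) ≡ + q
    card-Fq = ≤-antisym Fq-bound (*-cancelˡ-≤-pos (+ q) _ (+ t) {{t-positive}} (begin
      + t * + q                     ≡⟨ ∑-fibre-size ⟨
      ∑ fibre-size                  ≤⟨ ∑-mono fibre-size≤ ⟩
      ∑ (λ γ → + t * ⟦ Fq? γ ⟧)     ≡⟨ *-distribˡ-∑ (+ t) _ ⟨
      + t * ∑ (λ γ → ⟦ Fq? γ ⟧)     ∎))
      where
      open ≤-Reasoning
      t-positive = positive (+<+ (ℕ.>-nonZero⁻¹ t))

    -- The fibre bounds add up to exactly q t, so every one is attained. Surjectivity of the trace
    -- needs no separate argument.
    tr-fibre : ∀ {γ} → Fq γ → ∑ (λ x → ⟦ tr x ≟ γ ⟧) ≡ + t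
    tr-fibre {γ} γ∈ = ≡.trans (∑-tight fibre-size≤ total γ)
      (≡.trans (cong (+ t *_) (⟦⟧-yes (Fq? γ) γ∈)) (*-identityʳ (+ t)))
      where
      total : ∑ (λ γ → + t * ⟦ Fq? γ ⟧) ≤ ∑ fibre-size
      total = ≤-reflexive (≡.trans (≡.sym (*-distribˡ-∑ (+ t) _))
        (≡.trans (cong (+ t *_) card-Fq) (≡.sym ∑-fibre-size)))

    -- Ratios of two elements of trace β.

    module AffineHyperplane {β : A} (β∈Fq : Fq β) (β≢0 : β ≢ 0#) where

      Y : A → ℤ
      Y y = ⟦ tr y ≟ β ⟧

      Y-0 : Y 0# ≡ 0ℤ
      Y-0 = ⟦⟧-no (tr 0# ≟ β) (λ e → β≢0 (≡.trans (≡.sym e) tr-0))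

      -- The pairs are (w z, z), parametrised by the denominator so that no inverse occurs.
      R-count : A → ℤ
      R-count w = ∑ (λ z → Y (w · z) * Y z)

      private
        -- The equation is linear in b with leading coefficient x - β, which is nonzero.
        solution : ∀ {x y} → x ≢ β → Fq x → Fq y →
                   ∃ λ b₀ → Fq b₀ × (∀ b → (y ⊕ b · x ≡ β ⊕ b · β → b ≡ b₀) ×
                     (b ≡ b₀ → y ⊕ b · x ≡ β ⊕ b · β))
        solution {x} {y} x≢β x∈ y∈ = b₀ , Fq-· (Fq-⊕ (Fq-⊖ y∈) β∈Fq) (Fq-⁻¹ e≢0 (Fq-⊕ x∈ (Fq-⊖ β∈Fq))) , λ b
          → forward b , λ { ≡.refl → backward }
          where
          open ≡.≡-Reasoning
          e = x ⊕ ⊖ β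
          b₀ = (⊖ y ⊕ β) · e ⁻¹
          x≡e⊕β : x ≡ e ⊕ β
          x≡e⊕β = ≡.sym (≡.trans (R.+-assoc x _ _) (≡.trans (cong (x ⊕_) (R.-‿inverseˡ β)) (R.+-identityʳ x)))
          e≢0 : e ≢ 0#
          e≢0 e≡0 = x≢β (≡.trans x≡e⊕β (≡.trans (cong (_⊕ β) e≡0) (R.+-identityˡ β)))
          split : ∀ b → y ⊕ b · x ≡ b · β ⊕ (y ⊕ b · e)
          split b = ≡.trans (cong (λ z → y ⊕ b · z) x≡e⊕β)
            (≡.trans (cong (y ⊕_) (R.distribˡ b e β)) (⊕.x∙yz≈z∙xy y (b · e) (b · β)))
          y⊖y⊕β : y ⊕ (⊖ y ⊕ β) ≡ β
          y⊖y⊕β = ≡.trans (≡.sym (R.+-assoc y _ β)) (≡.trans (cong (_⊕ β) (R.-‿inverseʳ y)) (R.+-identityˡ β))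
          forward : ∀ b → y ⊕ b · x ≡ β ⊕ b · β → b ≡ b₀
          forward b eq = begin
            b               ≡⟨ R.*-identityʳ b ⟨
            b · 1#          ≡⟨ cong (b ·_) (·-inverseʳ e≢0) ⟨
            b · (e · e ⁻¹)  ≡⟨ R.*-assoc b e _ ⟨
            b · e · e ⁻¹    ≡⟨ cong (_· e ⁻¹) be ⟩
            b₀              ∎
            where
            be : b · e ≡ ⊖ y ⊕ β
            be = ⊕-cancelˡ y (≡.trans (⊕-cancelˡ (b · β)
              (≡.trans (≡.sym (split b)) (≡.trans eq (R.+-comm β _)))) (≡.sym y⊖y⊕β))
          backward : y ⊕ b₀ · x ≡ β ⊕ b₀ · β
          backward = begin
            y ⊕ b₀ · x              ≡⟨ split b₀ ⟩
            b₀ · β ⊕ (y ⊕ b₀ · e)   ≡⟨ cong (λ z → b₀ · β ⊕ (y ⊕ z))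
              (≡.trans (R.*-assoc _ _ e) (≡.trans (cong ((⊖ y ⊕ β) ·_) (·-inverseˡ e≢0)) (R.*-identityʳ _))) ⟩
            b₀ · β ⊕ (y ⊕ (⊖ y ⊕ β)) ≡⟨ cong (b₀ · β ⊕_) y⊖y⊕β ⟩
            b₀ · β ⊕ β              ≡⟨ R.+-comm _ β ⟩
            β ⊕ b₀ · β              ∎

        -- For b in F_q the condition reads tr (w z) + b tr z = β + b β. These are the members of a
        -- pencil of affine hyperplanes through the common solutions of tr (w z) = β and tr z = β;
        -- the member tr z = β itself is missing.
        line : A → A → A → ℤ
        line w b z = ⟦ tr (z · (w ⊕ b)) ≟ β ⊕ b · β ⟧

        -- Since w lies outside F_q, w + b is nonzero for every b in F_q. Scaling by it turns the
        -- hyperplane into a trace fibre.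
        line-count : ∀ w → ¬ Fq w → ∀ b → ⟦ Fq? b ⟧ * ∑ (line w b) ≡ ⟦ Fq? b ⟧ * + t
        line-count w w∉ b = ⟦⟧*-cong (Fq? b) (λ b∈ →
          ≡.trans (∑-scale (w⊕b≢0 b∈) (λ z → ⟦ tr z ≟ β ⊕ b · β ⟧)) (tr-fibre (Fq-⊕ β∈Fq (Fq-· b∈ β∈Fq))))
          where
          w⊕b≢0 : Fq b → w ⊕ b ≢ 0#
          w⊕b≢0 b∈ e = w∉ (≡.subst Fq (≡.sym (RingProperties.+-inverseˡ-unique R.ring w b e)) (Fq-⊖ b∈))

        -- A point with both traces equal to β lies on all q members. A point with tr z = β only
        -- lies on none, and a point with tr z ≠ β lies on exactly one.
        pencil : ∀ w z → ∑ (λ b → ⟦ Fq? b ⟧ * line w b z) ≡ + q * (Y (w · z) * Y z) + (1ℤ - Y z)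
        pencil w z = ≡.trans (∑-cong (λ b → ⟦⟧*-cong (Fq? b)
          (λ b∈ → cong (λ e → ⟦ e ≟ β ⊕ b · β ⟧) (tr-line b∈)))) (by-case (tr z ≟ β) (tr (w · z) ≟ β))
          where
          x = tr z
          y = tr (w · z)
          tr-line : ∀ {b} → Fq b → tr (z · (w ⊕ b)) ≡ y ⊕ b · x
          tr-line {b} b∈ = ≡.trans (cong tr
            (≡.trans (R.distribˡ z w b) (cong₂ _⊕_ (R.*-comm z w) (R.*-comm z b))))
            (≡.trans (Tr-⊕ n (w · z) (b · z)) (cong (y ⊕_) (Tr-· n z b∈)))
          by-case : (d : Dec (x ≡ β)) (e : Dec (y ≡ β)) → ∑
            (λ b → ⟦ Fq? b ⟧ * ⟦ y ⊕ b · x ≟ β ⊕ b · β ⟧) ≡ + q * (⟦ e ⟧ * ⟦ d ⟧) + (1ℤ - ⟦ d ⟧)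
          by-case (yes x≡β) (yes y≡β) = begin
            ∑ (λ b → ⟦ Fq? b ⟧ * ⟦ y ⊕ b · x ≟ β ⊕ b · β ⟧)
              ≡⟨ ∑-cong (λ b → ≡.trans (cong (⟦ Fq? b ⟧ *_)
                (⟦⟧-yes (y ⊕ b · x ≟ β ⊕ b · β) (cong₂ (λ u v → u ⊕ b · v) y≡β x≡β))) (*-identityʳ _)) ⟩
            ∑ (λ b → ⟦ Fq? b ⟧) ≡⟨ card-Fq ⟩
            + q                 ≡⟨ simplify (+ q) ⟩
            + q * 1ℤ + 0ℤ       ∎
            where
            open ≡.≡-Reasoning
            simplify : ∀ i → i ≡ i * 1ℤ + 0ℤ
            simplify = ℤSolver.solve-∀
          by-case (yes x≡β) (no y≢β) = ≡.trans (∑-zero (λ b → ≡.trans (cong (⟦ Fq? b ⟧ *_)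
              (⟦⟧-no (y ⊕ b · x ≟ β ⊕ b · β)
                (λ e → y≢β (⊕-cancelˡ (b · β) (≡.trans (R.+-comm _ y)
                (≡.trans (cong (λ u → y ⊕ b · u) (≡.sym x≡β)) (≡.trans e (R.+-comm β _))))))))
              (*-zeroʳ ⟦ Fq? b ⟧))) (simplify (+ q))
            where
            simplify : ∀ i → 0ℤ ≡ i * 0ℤ + 0ℤ
            simplify = ℤSolver.solve-∀
          by-case (no x≢β) e with solution x≢β (tr∈Fq z) (tr∈Fq (w · z))
          ... | b₀ , b₀∈ , iff = begin
            ∑ (λ b → ⟦ Fq? b ⟧ * ⟦ y ⊕ b · x ≟ β ⊕ b · β ⟧)
              ≡⟨ ∑-cong (λ b → ≡.trans (*-comm ⟦ Fq? b ⟧ _)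
                (cong (_* ⟦ Fq? b ⟧) (⟦⟧-cong (y ⊕ b · x ≟ β ⊕ b · β) (b ≟ b₀) (proj₁ (iff b))
                (proj₂ (iff b))))) ⟩
            ∑ (λ b → ⟦ b ≟ b₀ ⟧ * ⟦ Fq? b ⟧)  ≡⟨ ∑-δ b₀ _ ⟩
            ⟦ Fq? b₀ ⟧                        ≡⟨ ⟦⟧-yes (Fq? b₀) b₀∈ ⟩
            1ℤ                                ≡⟨ simplify (+ q) ⟦ e ⟧ ⟩
            + q * (⟦ e ⟧ * 0ℤ) + 1ℤ           ∎
            where
            open ≡.≡-Reasoning
            simplify : ∀ i j → 1ℤ ≡ i * (j * 0ℤ) + 1ℤ
            simplify = ℤSolver.solve-∀

      -- Count the incidences of points with the pencil twice: q hyperplanes of t points each on one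
      -- side, the sum of `pencil` over all z on the other.
      R-outside : ∀ w → ¬ Fq w → + q * R-count w ≡ + t
      R-outside w w∉ = RingProperties.+-cancelʳ +-*-ring (+ q * + t - + t) (+ q * R-count w) (+ t)
        (≡.trans (≡.sym rhs) (≡.trans lhs (simplify (+ q) (+ t))))
        where
        open ≡.≡-Reasoning
        simplify : ∀ i j → i * j ≡ j + (i * j - j)
        simplify = ℤSolver.solve-∀
        total : ℤ
        total = ∑ (λ b → ⟦ Fq? b ⟧ * ∑ (line w b))
        lhs : total ≡ + q * + t
        lhs = ≡.trans (∑-cong (line-count w w∉))
          (≡.trans (≡.sym (*-distribʳ-∑ (+ t) _)) (cong (_* + t) card-Fq))
        rhs : total ≡ + q * R-count w + (+ q * + t - + t)
        rhs = begin
          ∑ (λ b → ⟦ Fq? b ⟧ * ∑ (line w b))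
            ≡⟨ ∑-cong (λ b → *-distribˡ-∑ ⟦ Fq? b ⟧ (line w b)) ⟩
          ∑ (λ b → ∑ (λ z → ⟦ Fq? b ⟧ * line w b z))            ≡⟨ ∑-comm _ ⟩
          ∑ (λ z → ∑ (λ b → ⟦ Fq? b ⟧ * line w b z))            ≡⟨ ∑-cong (pencil w) ⟩
          ∑ (λ z → + q * (Y (w · z) * Y z) + (1ℤ - Y z))        ≡⟨ ∑-distrib-+ _ _ ⟩
          ∑ (λ z → + q * (Y (w · z) * Y z)) + ∑ (λ z → 1ℤ - Y z)
            ≡⟨ cong₂ _+_ (≡.sym (*-distribˡ-∑ (+ q) _))
              (≡.trans (∑-distrib-- _ Y) (cong₂ _-_ (≡.trans ∑-one (pos-* q t)) (tr-fibre β∈Fq))) ⟩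
          + q * R-count w + (+ q * + t - + t)                   ∎

      -- Multiplying by q keeps the value t/q for w outside F_q among the integers.
      R-formula : ∀ w → + q * R-count w ≡ + q * + t * ⟦ w ≟ 1# ⟧ + + t * (1ℤ - ⟦ Fq? w ⟧)
      R-formula w with Fq? w | w ≟ 1#
      ... | no w∉ | yes ≡.refl = contradiction Fq-1 w∉
      ... | no w∉ | no _ = ≡.trans (R-outside w w∉) (simplify (+ q) (+ t))
        where
        simplify : ∀ i j → j ≡ i * j * 0ℤ + j * 1ℤ
        simplify = ℤSolver.solve-∀
      ... | yes _ | yes ≡.refl = ≡.trans (cong (+ q *_) (≡.trans (∑-cong same) (tr-fibre β∈Fq)))
        (simplify (+ q) (+ t))
        where
        simplify : ∀ i j → i * j ≡ i * j * 1ℤ + j * 0ℤ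
        simplify = ℤSolver.solve-∀
        same : ∀ z → Y (1# · z) * Y z ≡ Y z
        same z rewrite R.*-identityˡ z with tr z ≟ β
        ... | yes _ = ≡.refl
        ... | no _  = ≡.refl
      -- Linearity over F_q gives tr (w z) = w β whenever tr z = β, and w β ≠ β because β is
      -- nonzero.
      ... | yes w∈ | no w≢1 = ≡.trans (cong (+ q *_) (∑-zero disjoint)) (simplify (+ q) (+ t))
        where
        simplify : ∀ i j → i * 0ℤ ≡ i * j * 0ℤ + j * 0ℤ
        simplify = ℤSolver.solve-∀
        disjoint : ∀ z → Y (w · z) * Y z ≡ 0ℤ
        disjoint z with tr z ≟ β
        ... | no _ = *-zeroʳ (Y (w · z))
        ... | yes tr≡β = ≡.trans (*-identityʳ _) (⟦⟧-no (tr (w · z) ≟ β) (λ e → w≢1 (·-cancelˡ β≢0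
              (≡.trans (R.*-comm β w) (≡.trans (cong (w ·_) (≡.sym tr≡β))
                (≡.trans (≡.sym (Tr-· n z w∈)) (≡.trans e (≡.sym (R.*-identityʳ β)))))))))

  -- Positive definite functions on the multiplicative group.

  *-cancelˡ-nonneg : ∀ {i j} → 0ℤ < i → 0ℤ ≤ i * j → 0ℤ ≤ j
  *-cancelˡ-nonneg {i} {j} 0<i 0≤ij =
    *-cancelˡ-≤-pos 0ℤ j i {{positive 0<i}} (≤-trans (≤-reflexive (*-zeroʳ i)) 0≤ij)

  module PositiveDefiniteness {s : ℕ} (F : FiniteField s) where
    open Field F
    private
      module · = CommutativeSemigroupProperties (CommutativeMonoid.commutativeSemigroup R.*-commutativeMonoid)

    -- The trivial character, extended by 0. Functions on the group are encoded as functions on the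
    -- field that vanish at `0#`.
    u : A → ℤ
    u x = 1ℤ - ⟦ x ≟ 0# ⟧

    u-0 : u 0# ≡ 0ℤ
    u-0 = cong (λ e → 1ℤ - e) (⟦⟧-yes (0# ≟ 0#) ≡.refl)

    u-nonzero : ∀ {x} → x ≢ 0# → u x ≡ 1ℤ
    u-nonzero {x} x≢0 = cong (λ e → 1ℤ - e) (⟦⟧-no (x ≟ 0#) x≢0)

    ∑-u : ∑ u ≡ + N
    ∑-u = begin
      ∑ u                                  ≡⟨ ∑-distrib-- (λ _ → 1ℤ) (λ x → ⟦ x ≟ 0# ⟧) ⟩
      ∑ (λ _ → 1ℤ) - ∑ (λ x → ⟦ x ≟ 0# ⟧)  ≡⟨ cong₂ _-_ (≡.trans ∑-one (cong +_ s≡1+N)) (∑-⟦≟⟧ 0#) ⟩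
      + suc N - 1ℤ                         ≡⟨⟩
      + N                                  ∎
      where open ≡.≡-Reasoning

    u-nonneg : ∀ x → 0ℤ ≤ u x
    u-nonneg x with x ≟ 0#
    ... | yes _ = ≤-refl
    ... | no _  = +≤+ ℕ.z≤n

    0<N : 0 ℕ.< N
    0<N = ℕ.n≢0⇒n>0 (λ N≡0 → contradiction (≡.trans (0≡u N≡0 1#) (u-nonzero (0≢1 ∘ ≡.sym))) (λ ()))
      where
      0≡u : N ≡ 0 → ∀ x → 0ℤ ≡ u x
      0≡u N≡0 = ∑-tight u-nonneg (≤-reflexive
        (≡.trans ∑-u (≡.trans (cong +_ N≡0) (≡.sym (∑-zero (λ _ → ≡.refl))))))

    0<+N : 0ℤ < + N
    0<+N = +<+ 0<N

    -- An identity that holds only for nonzero x may still be used under a sum whose weight `v`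
    -- vanishes at `0#`.
    *-vanish-cong : ∀ {v : A → ℤ} → v 0# ≡ 0ℤ → ∀ x {a b : ℤ} → (x ≢ 0# → a ≡ b) → a * v x ≡ b * v x
    *-vanish-cong {v} v0 x {a} {b} h with x ≟ 0#
    ... | no x≢0     = cong (_* v x) (h x≢0)
    ... | yes ≡.refl = ≡.trans (≡.trans (cong (a *_) v0) (*-zeroʳ a))
      (≡.sym (≡.trans (cong (b *_) v0) (*-zeroʳ b)))

    -- Autocorrelation: with x = z t and y = t the ratio x / y is z, so summing f against it gives
    -- the form of f without inverses.
    corr : (A → ℤ) → A → ℤ
    corr v z = ∑ (λ t → v (z · t) * v t)

    -- Positive definiteness of f on the group of nonzero elements: ∑ f(x y⁻¹) v(x) v(y) ≥ 0 for all v.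
    PositiveDefinite : (A → ℤ) → Set
    PositiveDefinite f = ∀ v → v 0# ≡ 0ℤ → 0ℤ ≤ ∑ (λ z → f z * corr v z)

    corr-0 : ∀ {v} → v 0# ≡ 0ℤ → corr v 0# ≡ 0ℤ
    corr-0 {v} v0 = ∑-zero (λ t → cong (_* v t) (≡.trans (cong v (R.zeroˡ t)) v0))

    ∑-corr : ∀ {v} → v 0# ≡ 0ℤ → ∑ (corr v) ≡ ∑ v * ∑ v
    ∑-corr {v} v0 = begin
      ∑ (λ z → ∑ (λ t → v (z · t) * v t))  ≡⟨ ∑-comm _ ⟩
      ∑ (λ t → ∑ (λ z → v (z · t) * v t))  ≡⟨ ∑-cong (λ t → ≡.sym (*-distribʳ-∑ (v t) (λ z → v (z · t)))) ⟩
      ∑ (λ t → ∑ (λ z → v (z · t)) * v t)  ≡⟨ ∑-cong (λ t → *-vanish-cong v0 t (λ t≢0 → ∑-scale t≢0 v)) ⟩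
      ∑ (λ t → ∑ v * v t)                  ≡⟨ *-distribˡ-∑ (∑ v) v ⟨
      ∑ v * ∑ v                            ∎
      where open ≡.≡-Reasoning

    u-positiveDefinite : PositiveDefinite u
    u-positiveDefinite v v0 = ≤-trans (square-nonneg (∑ v)) (≤-reflexive (≡.sym (begin
      ∑ (λ z → u z * corr v z)   ≡⟨ ∑-cong
        (λ z → *-vanish-cong {corr v} (corr-0 {v} v0) z (λ z≢0 → u-nonzero z≢0)) ⟩
      ∑ (λ z → 1ℤ * corr v z)    ≡⟨ ∑-cong (λ z → *-identityˡ (corr v z)) ⟩
      ∑ (corr v)                 ≡⟨ ∑-corr v0 ⟩
      ∑ v * ∑ v                  ∎)))
      where open ≡.≡-Reasoning

    -- If c is its own autocorrelation up to the factor N, then N f c is a sum of twists of f,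
    -- as in the Schur product theorem.
    *-positiveDefinite : ∀ {f c} → (∀ ξ → corr c ξ ≡ + N * c ξ) → PositiveDefinite f → PositiveDefinite
      (λ x → f x * c x)
    *-positiveDefinite {f} {c} c-corr f-pd v v0 =
      *-cancelˡ-nonneg 0<+N (≤-trans (∑-nonneg (λ z → f-pd (w z) (w-0 z))) (≤-reflexive (≡.sym twisted)))
      where
      open ≡.≡-Reasoning
      w : A → A → ℤ
      w z x = c (z · x) * v x
      w-0 : ∀ z → w z 0# ≡ 0ℤ
      w-0 z = ≡.trans (cong (c (z · 0#) *_) v0) (*-zeroʳ (c (z · 0#)))
      -- The hypothesis on `c` is read with z replaced by z t, which is allowed for t ≠ 0. The two
      -- factors `c` can then be absorbed into the two factors `v`.
      expand : ∀ ξ → + N * c ξ * corr v ξ ≡ ∑ (λ z → corr (w z) ξ)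
      expand ξ = begin
        + N * c ξ * corr v ξ                                    ≡⟨ *-distribˡ-∑ (+ N * c ξ) _ ⟩
        ∑ (λ t → + N * c ξ * (v (ξ · t) * v t))
          ≡⟨ ∑-cong (λ t → ≡.sym (*-assoc (+ N * c ξ) (v (ξ · t)) (v t))) ⟩
        ∑ (λ t → + N * c ξ * v (ξ · t) * v t)
          ≡⟨ ∑-cong (λ t → *-vanish-cong v0 t (λ t≢0 → cong (_* v (ξ · t))
                                                                     (≡.trans (≡.sym (c-corr ξ)) (≡.sym
                                                                       (∑-scale t≢0 (λ z → c (ξ · z) * c
                                                                       z)))))) ⟩
        ∑ (λ t → ∑ (λ z → c (ξ · (z · t)) * c (z · t)) * v (ξ · t) * v t)
          ≡⟨ ∑-cong (λ t → ≡.trans (*-assoc (∑ (λ z → c (ξ · (z · t)) * c (z · t))) (v (ξ · t)) (v t))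
               (*-distribʳ-∑ (v (ξ · t) * v t) (λ z → c (ξ · (z · t)) * c (z · t)))) ⟩
        ∑ (λ t → ∑ (λ z → c (ξ · (z · t)) * c (z · t) * (v (ξ · t) * v t)))
          ≡⟨ ∑-comm _ ⟩
        ∑ (λ z → ∑ (λ t → c (ξ · (z · t)) * c (z · t) * (v (ξ · t) * v t)))
          ≡⟨ ∑-cong (λ z → ∑-cong (λ t → ≡.trans
            (cong (λ e → c e * c (z · t) * (v (ξ · t) * v t)) (·.x∙yz≈y∙xz ξ z t))
               (regroup (c (z · (ξ · t))) (c (z · t)) (v (ξ · t)) (v t)))) ⟩
        ∑ (λ z → corr (w z) ξ) ∎
        where
        regroup : ∀ a b d e → a * b * (d * e) ≡ a * d * (b * e)
        regroup = ℤSolver.solve-∀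
      twisted : + N * ∑ (λ ξ → f ξ * c ξ * corr v ξ) ≡ ∑ (λ z → ∑ (λ ξ → f ξ * corr (w z) ξ))
      twisted = begin
        + N * ∑ (λ ξ → f ξ * c ξ * corr v ξ)          ≡⟨ *-distribˡ-∑ (+ N) _ ⟩
        ∑ (λ ξ → + N * (f ξ * c ξ * corr v ξ))        ≡⟨ ∑-cong (λ ξ → regroup (+ N) (f ξ) (c ξ) (corr v ξ)) ⟩
        ∑ (λ ξ → f ξ * (+ N * c ξ * corr v ξ))
          ≡⟨ ∑-cong (λ ξ → ≡.trans (cong (f ξ *_) (expand ξ)) (*-distribˡ-∑ (f ξ) _)) ⟩
        ∑ (λ ξ → ∑ (λ z → f ξ * corr (w z) ξ))        ≡⟨ ∑-comm _ ⟩
        ∑ (λ z → ∑ (λ ξ → f ξ * corr (w z) ξ))        ∎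
        where
        regroup : ∀ a b d e → a * (b * d * e) ≡ b * (a * d * e)
        regroup = ℤSolver.solve-∀

    push : ℕ → (A → ℤ) → A → ℤ
    push e f z = ∑ (λ ξ → ⟦ z ≟ ξ ^ e ⟧ * f ξ)

    -- For every t, x ↦ v (t x^e) is a test vector for `f`. The sum over t of the forms of `f` at
    -- these vectors is N times the form of the push-forward at `v`: each of the N nonzero x
    -- contributes the same autocorrelation, after scaling t by x^e.
    push-positiveDefinite : ∀ e .{{_ : ℕ.NonZero e}} {f} → PositiveDefinite f → PositiveDefinite (push e f)
    push-positiveDefinite e {f} f-pd v v0 = ≤-trans
      (*-cancelˡ-nonneg 0<+N (≤-trans (∑-nonneg (λ t → f-pd (w t) (w-0 t))) (≤-reflexive (≡.sym twisted))))
      (≤-reflexive (≡.sym (∑-fibre (_^ e) f (corr v))))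
      where
      open ≡.≡-Reasoning
      w : A → A → ℤ
      w t x = v (t · x ^ e)
      v·0^ : ∀ t → v (t · 0# ^ e) ≡ 0ℤ
      v·0^ t = ≡.trans (cong v (≡.trans (cong (t ·_) (0^ e)) (R.zeroʳ t))) v0
      w-0 : ∀ t → w t 0# ≡ 0ℤ
      w-0 = v·0^
      moved : ∀ ξ x → u x * corr v (ξ ^ e) ≡ ∑ (λ t → w t (ξ · x) * w t x)
      moved ξ x with x ≟ 0#
      ... | yes ≡.refl = ≡.sym (∑-zero
        (λ t → ≡.trans (cong (w t (ξ · 0#) *_) (w-0 t)) (*-zeroʳ (w t (ξ · 0#)))))
      ... | no x≢0 = begin
        1ℤ * corr v (ξ ^ e) ≡⟨ *-identityˡ _ ⟩
        ∑ (λ t → v (ξ ^ e · t) * v t) ≡⟨ ∑-scale (^-nonzero e x≢0) (λ t → v (ξ ^ e · t) * v t) ⟨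
        ∑ (λ t → v (ξ ^ e · (t · x ^ e)) * v (t · x ^ e))
          ≡⟨ ∑-cong (λ t → cong (λ y → v y * v (t · x ^ e))
            (≡.trans (·.x∙yz≈y∙xz (ξ ^ e) t (x ^ e)) (cong (t ·_) (≡.sym (^-distrib-· ξ x e))))) ⟩
        ∑ (λ t → w t (ξ · x) * w t x) ∎
      expand : ∀ ξ → + N * corr v (ξ ^ e) ≡ ∑ (λ t → corr (w t) ξ)
      expand ξ = begin
        + N * corr v (ξ ^ e)                     ≡⟨ cong (_* corr v (ξ ^ e)) (≡.sym ∑-u) ⟩
        ∑ u * corr v (ξ ^ e)                     ≡⟨ *-distribʳ-∑ (corr v (ξ ^ e)) u ⟩
        ∑ (λ x → u x * corr v (ξ ^ e))           ≡⟨ ∑-cong (moved ξ) ⟩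
        ∑ (λ x → ∑ (λ t → w t (ξ · x) * w t x))  ≡⟨ ∑-comm _ ⟩
        ∑ (λ t → corr (w t) ξ)                   ∎
      twisted : + N * ∑ (λ ξ → f ξ * corr v (ξ ^ e)) ≡ ∑ (λ t → ∑ (λ ξ → f ξ * corr (w t) ξ))
      twisted = begin
        + N * ∑ (λ ξ → f ξ * corr v (ξ ^ e))     ≡⟨ *-distribˡ-∑ (+ N) _ ⟩
        ∑ (λ ξ → + N * (f ξ * corr v (ξ ^ e)))
          ≡⟨ ∑-cong (λ ξ → ≡.trans (regroup (+ N) (f ξ) _)
          (≡.trans (cong (f ξ *_) (expand ξ)) (*-distribˡ-∑ (f ξ) _))) ⟩
        ∑ (λ ξ → ∑ (λ t → f ξ * corr (w t) ξ))   ≡⟨ ∑-comm _ ⟩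
        ∑ (λ t → ∑ (λ ξ → f ξ * corr (w t) ξ))   ∎
        where
        regroup : ∀ a b d → a * (b * d) ≡ b * (a * d)
        regroup = ℤSolver.solve-∀

  -- Integers congruent to 1 modulo one prime and to 0 modulo others.

  distinct-primes-coprime : ∀ {p r} → Prime p → Prime r → p ≢ r → Coprime p r
  distinct-primes-coprime p-prime r-prime p≢r (d∣p , d∣r) with prime⇒irreducible p-prime d∣p
  ... | inj₁ d≡1 = d≡1
  ... | inj₂ ≡.refl with prime⇒irreducible r-prime d∣r
  ...   | inj₁ d≡1 = d≡1
  ...   | inj₂ p≡r = contradiction p≡r p≢r

  coprime⇒multiple≡1 : ∀ {r p} → Coprime r p → p ≢ 1 → ∃₂ λ d v → r ∣ d × d ≡ 1 ℕ.+ v ℕ.* p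
  coprime⇒multiple≡1 {r} {p} cop p≢1 with coprime-Bézout cop
  ... | Bézout.+- x y eq = x ℕ.* r , y , n∣m*n x , ≡.sym eq
  ... | Bézout.-+ x y eq = go (x ℕ.* r) ≡.refl eq
    where
    go : ∀ X → x ℕ.* r ≡ X → 1 ℕ.+ X ≡ y ℕ.* p → ∃₂ λ d v → r ∣ d × d ≡ 1 ℕ.+ v ℕ.* p
    go zero    _  1≡yp = contradiction (ℕ.m*n≡1⇒n≡1 y p (≡.sym 1≡yp)) p≢1
    -- Here Bézout gives a multiple of r congruent to -1 modulo p, so its square is taken.
    go (suc X) eq 2+X≡yp = suc X ℕ.* suc X , X ℕ.* y , ∣m⇒∣m*n (suc X) (≡.subst (r ∣_) eq (n∣m*n x)) , (begin
      suc X ℕ.* suc X            ≡⟨ difference X ⟩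
      1 ℕ.+ X ℕ.* suc (suc X)    ≡⟨ cong (λ e → 1 ℕ.+ X ℕ.* e) 2+X≡yp ⟩
      1 ℕ.+ X ℕ.* (y ℕ.* p)      ≡⟨ cong (1 ℕ.+_) (ℕ.*-assoc X y p) ⟨
      1 ℕ.+ X ℕ.* y ℕ.* p        ∎)
      where
      open ≡.≡-Reasoning
      difference : ∀ X → (1 ℕ.+ X) ℕ.* (1 ℕ.+ X) ≡ 1 ℕ.+ X ℕ.* (2 ℕ.+ X)
      difference = ℕSolver.solve-∀

  -- A product of numbers congruent to 1 modulo p, one divisible by each prime of `S`, is again
  -- congruent to 1. It serves as an exponent that hides `S` and leaves p visible.
  common-multiple≡1 : ∀ {p} → Prime p → ∀ {S} → All Prime S → All (p ≢_) S →
                      ∃₂ λ D v → All (_∣ D) S × D ≡ 1 ℕ.+ v ℕ.* p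
  common-multiple≡1 p-prime [] [] = 1 , 0 , [] , ≡.refl
  common-multiple≡1 {p} p-prime (r-prime ∷ primes) (p≢r ∷ p≢)
    with common-multiple≡1 p-prime primes p≢
       | coprime⇒multiple≡1 (distinct-primes-coprime r-prime p-prime (p≢r ∘ ≡.sym))
         (λ p≡1 → ¬prime[1] (≡.subst Prime p≡1 p-prime))
  ... | D , v , S∣D , ≡.refl | d , w , r∣d , ≡.refl =
    d ℕ.* D , v ℕ.+ w ℕ.* D , ∣m⇒∣m*n D r∣d ∷ All.map (∣n⇒∣m*n d) S∣D , expand v w p
    where
    expand : ∀ v w p → (1 ℕ.+ w ℕ.* p) ℕ.* (1 ℕ.+ v ℕ.* p) ≡ 1 ℕ.+ (v ℕ.+ w ℕ.* (1 ℕ.+ v ℕ.* p)) ℕ.* p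
    expand = ℕSolver.solve-∀

  -- Power residues and the sums of characters of prime order.

  module PowerResidues {s : ℕ} (F : FiniteField s) where
    open Field F
    open PositiveDefiniteness F

    cofactor : ℕ → ℕ
    cofactor zero        = 0
    cofactor p@(suc _) = N / p

    *-cofactor : ∀ {p} → p ∣ N → p ℕ.* cofactor p ≡ N
    *-cofactor {zero}  0∣N = ≡.sym (0∣⇒≡0 0∣N)
    *-cofactor {suc p} p∣N = m*[n/m]≡n p∣N

    -- Euler's criterion taken as the definition of a nonzero p-th power. For p ∣ N, `^p^e≡1` and
    -- `power-residue` are the two directions of its correctness.
    κ : ℕ → A → ℤ
    κ p x = ⟦ x ^ cofactor p ≟ 1# ⟧

    -- c p is the sum of the multiplicative characters of order p when p is prime.
    c : ℕ → A → ℤ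
    c p x = + p * κ p x - u x

    u-·ʳ : ∀ x {w} → w ≢ 0# → u (x · w) ≡ u x
    u-·ʳ x {w} w≢0 = cong (λ b → 1ℤ - b) (⟦⟧-cong (x · w ≟ 0#) (x ≟ 0#) ⇒ (λ { ≡.refl → R.zeroˡ w }))
      where
      ⇒ : x · w ≡ 0# → x ≡ 0#
      ⇒ xw≡0 with x ≟ 0#
      ... | yes x≡0 = x≡0
      ... | no x≢0  = contradiction xw≡0 (·-nonzero x≢0 w≢0)

    module _ {p : ℕ} (p∣N : p ∣ N) where

      private
        e = cofactor p

        p-nonZero : ℕ.NonZero p
        p-nonZero = ℕ.≢-nonZero (λ p≡0 → ℕ.<⇒≢ 0<N (≡.trans (≡.sym (cong (ℕ._* e) p≡0)) (*-cofactor p∣N)))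

        e-nonZero : ℕ.NonZero e
        e-nonZero = ℕ.≢-nonZero (λ e≡0 → ℕ.<⇒≢ 0<N
          (≡.trans (≡.sym (≡.trans (cong (p ℕ.*_) e≡0) (ℕ.*-zeroʳ p))) (*-cofactor p∣N)))

      ^p^e≡1 : ∀ {x} → x ≢ 0# → (x ^ p) ^ e ≡ 1#
      ^p^e≡1 {x} x≢0 = ≡.trans (^-assoc x p e) (≡.trans (cong (x ^_) (*-cofactor p∣N)) (fermat x≢0))

      κ-0 : κ p 0# ≡ 0ℤ
      κ-0 = ⟦⟧-no (0# ^ e ≟ 1#) (λ eq → 0≢1 (≡.trans (≡.sym (0^ e {{e-nonZero}})) eq))

      c-0 : c p 0# ≡ 0ℤ
      c-0 = ≡.trans (cong₂ (λ a b → + p * a - b) κ-0 u-0) (≡.trans (+-identityʳ (+ p * 0ℤ)) (*-zeroʳ (+ p)))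

      κ-·ʳ : ∀ x {w} → w ^ e ≡ 1# → κ p (x · w) ≡ κ p x
      κ-·ʳ x {w} w^e≡1 = cong (λ y → ⟦ y ≟ 1# ⟧)
        (≡.trans (^-distrib-· x w e) (≡.trans (cong (x ^ e ·_) w^e≡1) (R.*-identityʳ (x ^ e))))

      c-·ʳ : ∀ x {w} → w ≢ 0# → w ^ e ≡ 1# → c p (x · w) ≡ c p x
      c-·ʳ x w≢0 w^e≡1 = cong₂ (λ a b → + p * a - b) (κ-·ʳ x w^e≡1) (u-·ʳ x w≢0)

      c-inverse : ∀ {x y} → x · y ≡ 1# → c p x ≡ c p y
      c-inverse {x} {y} xy≡1 = cong₂ (λ a b → + p * a - b)
        (⟦⟧-cong (x ^ e ≟ 1#) (y ^ e ≟ 1#) (transfer xy≡1) (transfer (≡.trans (R.*-comm y x) xy≡1)))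
        (≡.trans (u-nonzero (·≡1⇒nonzero xy≡1))
          (≡.sym (u-nonzero (·≡1⇒nonzero (≡.trans (R.*-comm y x) xy≡1)))))
        where
        transfer : ∀ {x y} → x · y ≡ 1# → x ^ e ≡ 1# → y ^ e ≡ 1#
        transfer {x} {y} xy≡1 x^e≡1 = begin
          y ^ e          ≡⟨ R.*-identityˡ (y ^ e) ⟨
          1# · y ^ e     ≡⟨ cong (_· y ^ e) x^e≡1 ⟨
          x ^ e · y ^ e  ≡⟨ ^-distrib-· x y e ⟨
          (x · y) ^ e    ≡⟨ cong (_^ e) xy≡1 ⟩
          1# ^ e         ≡⟨ 1^ e ⟩
          1#             ∎
          where open ≡.≡-Reasoning

      private
        -- `push p u y` is the number of nonzero p-th roots of y: at most the degree p, and none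
        -- unless Euler's criterion holds.
        push≤ : ∀ y → push p u y ≤ + p * κ p y
        push≤ y with y ^ e ≟ 1#
        ... | yes _ = begin
          ∑ (λ x → ⟦ y ≟ x ^ p ⟧ * u x)   ≤⟨ ∑-mono drop-u ⟩
          ∑ (λ x → ⟦ x ^ p ≟ y ⟧)         ≤⟨ ^-fibre-bound p {{p-nonZero}} y ⟩
          + p                             ≡⟨ *-identityʳ (+ p) ⟨
          + p * 1ℤ                        ∎
          where
          open ≤-Reasoning
          drop-u : ∀ x → ⟦ y ≟ x ^ p ⟧ * u x ≤ ⟦ x ^ p ≟ y ⟧
          drop-u x with x ≟ 0#
          ... | yes _ = ≤-trans (≤-reflexive (*-zeroʳ ⟦ y ≟ x ^ p ⟧)) (⟦⟧-nonneg (x ^ p ≟ y))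
          ... | no _  = ≤-reflexive (≡.trans (*-identityʳ ⟦ y ≟ x ^ p ⟧)
            (⟦⟧-cong (y ≟ x ^ p) (x ^ p ≟ y) ≡.sym ≡.sym))
        ... | no y^e≢1 = ≤-reflexive (≡.trans (∑-zero empty) (≡.sym (*-zeroʳ (+ p))))
          where
          empty : ∀ x → ⟦ y ≟ x ^ p ⟧ * u x ≡ 0ℤ
          empty x with x ≟ 0#
          ... | yes _  = *-zeroʳ ⟦ y ≟ x ^ p ⟧
          ... | no x≢0 = cong (_* 1ℤ) (⟦⟧-no (y ≟ x ^ p) (λ { ≡.refl → y^e≢1 (^p^e≡1 x≢0) }))

        ∑-push : ∑ (push p u) ≡ + N
        ∑-push = begin
          ∑ (push p u)                  ≡⟨ ∑-cong (λ z → *-identityʳ (push p u z)) ⟨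
          ∑ (λ z → push p u z * 1ℤ)     ≡⟨ ∑-fibre (_^ p) u (λ _ → 1ℤ) ⟩
          ∑ (λ x → u x * 1ℤ)            ≡⟨ ∑-cong (λ x → *-identityʳ (u x)) ⟩
          ∑ u                           ≡⟨ ∑-u ⟩
          + N                           ∎
          where open ≡.≡-Reasoning

        ∑κ≤ : ∑ (λ y → + p * κ p y) ≤ + N
        ∑κ≤ = begin
          ∑ (λ y → + p * κ p y)   ≡⟨ *-distribˡ-∑ (+ p) (κ p) ⟨
          + p * ∑ (κ p)           ≤⟨ *-monoˡ-≤-nonNeg (+ p) (^-fibre-bound e {{e-nonZero}} 1#) ⟩
          + p * + e               ≡⟨ pos-* p e ⟨
          + (p ℕ.* e)             ≡⟨ cong +_ (*-cofactor p∣N) ⟩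
          + N                     ∎
          where open ≤-Reasoning

      -- The root numbers add up to N, while their bounds add up to at most p (N/p) = N, because
      -- x^(N/p) = 1 has at most N/p solutions. So every residue has exactly p roots.
      push-u : ∀ y → push p u y ≡ + p * κ p y
      push-u = ∑-tight push≤ (≤-trans ∑κ≤ (≤-reflexive (≡.sym ∑-push)))

      ∑-κ : + p * ∑ (κ p) ≡ + N
      ∑-κ = ≡.trans (*-distribˡ-∑ (+ p) (κ p)) (≡.trans (∑-cong (≡.sym ∘ push-u)) ∑-push)

      ∑-c : ∑ (c p) ≡ 0ℤ
      ∑-c = begin
        ∑ (c p)                              ≡⟨ ∑-distrib-- (λ x → + p * κ p x) u ⟩
        ∑ (λ x → + p * κ p x) - ∑ u
          ≡⟨ cong₂ _-_ (≡.trans (≡.sym (*-distribˡ-∑ (+ p) (κ p))) ∑-κ) ∑-u ⟩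
        + N - + N                            ≡⟨ +-inverseʳ (+ N) ⟩
        0ℤ                                   ∎
        where open ≡.≡-Reasoning

      -- If y had no p-th root, its root number would be 0, whereas `push-u` makes it p.
      power-residue : ∀ {y} → y ^ e ≡ 1# → ∃ λ ζ → ζ ≢ 0# × y ≡ ζ ^ p
      power-residue {y} y^e≡1 with search (λ ζ → y ≟ ζ ^ p)
      ... | yes (ζ , y≡ζ^p) = ζ , ζ≢0 , y≡ζ^p
        where
        ζ≢0 : ζ ≢ 0#
        ζ≢0 ≡.refl = 0≢1 (≡.trans (≡.sym (0^ e {{e-nonZero}}))
          (≡.trans (cong (_^ e) (≡.sym (≡.trans y≡ζ^p (0^ p {{p-nonZero}})))) y^e≡1))
      ... | no ∄ = contradiction (≡.trans
        (≡.trans (≡.trans (≡.sym (*-identityʳ (+ p))) (cong (+ p *_) (≡.sym (⟦⟧-yes (y ^ e ≟ 1#) y^e≡1))))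
        (≡.sym (push-u y)))
                     (∑-zero (λ ζ → cong (_* u ζ) (⟦⟧-no (y ≟ ζ ^ p) (λ eq → ∄ (ζ , eq))))))
                       (λ p≡0 → ℕ.≢-nonZero⁻¹ p {{p-nonZero}} (+-injective p≡0))

      -- Orthogonality: a sum of distinct characters, closed under conjugation, is its own
      -- autocorrelation up to the factor N. This is the form in which `*-positiveDefinite` consumes
      -- it.
      c-corr : ∀ ξ → corr (c p) ξ ≡ + N * c p ξ
      c-corr ξ with ξ ≟ 0#
      ... | yes ≡.refl = ≡.trans (corr-0 {c p} c-0)
        (≡.sym (≡.trans (cong (+ N *_) (≡.trans (cong (λ b → + p * κ p 0# - b) (≡.sym u-0)) c-0))
        (*-zeroʳ (+ N))))
      ... | no ξ≢0 = begin
        ∑ (λ z → c p (ξ · z) * c p z)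
          ≡⟨ ∑-cong pointwise ⟩
        ∑ (λ z → + p * κ p ξ * (+ p * κ p z) - + p * κ p (z · ξ) - c p z)
          ≡⟨ ≡.trans (∑-distrib-- _ _) (cong₂ _-_ (∑-distrib-- _ _) ∑-c) ⟩
        ∑ (λ z → + p * κ p ξ * (+ p * κ p z)) - ∑ (λ z → + p * κ p (z · ξ)) - 0ℤ
          ≡⟨ cong₂ (λ a b → a - b - 0ℤ)
               (≡.trans (≡.sym (*-distribˡ-∑ (+ p * κ p ξ) (λ z → + p * κ p z)))
                 (cong (+ p * κ p ξ *_) total))
               (≡.trans (∑-scale ξ≢0 (λ z → + p * κ p z)) total) ⟩
        + p * κ p ξ * + N - + N - 0ℤ
          ≡⟨ collect (+ p * κ p ξ) (+ N) ⟩
        + N * (+ p * κ p ξ - (1ℤ - 0ℤ)) ∎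
        where
        open ≡.≡-Reasoning
        total : ∑ (λ z → + p * κ p z) ≡ + N
        total = ≡.trans (≡.sym (*-distribˡ-∑ (+ p) (κ p))) ∑-κ
        collect : ∀ a b → a * b - b - 0ℤ ≡ b * (a - (1ℤ - 0ℤ))
        collect = ℤSolver.solve-∀
        -- Off zero this expands (p κ(ξ z) - 1)(p κ(z) - 1). In the leading term κ(ξ z) may be
        -- replaced by κ(ξ), because the other factor κ(z) vanishes unless z is a residue.
        pointwise : ∀ z → c p (ξ · z) * c p z ≡ + p * κ p ξ * (+ p * κ p z) - + p * κ p (z · ξ) - c p z
        pointwise z with z ≟ 0#
        ... | yes ≡.refl = ≡.trans (cong₂ _*_ (≡.trans (cong (c p) (R.zeroʳ ξ)) c-0)
          (cong (λ a → + p * a - (1ℤ - 1ℤ)) κ-0))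
              (≡.trans (zero-case (+ p) (κ p ξ))
                (≡.sym (cong₂ (λ a b → + p * κ p ξ * (+ p * a) - + p * b - (+ p * a - (1ℤ - 1ℤ)))
                κ-0 (≡.trans (cong (κ p) (R.zeroˡ ξ)) κ-0))))
          where
          zero-case : ∀ a k → 0ℤ * (a * 0ℤ - (1ℤ - 1ℤ)) ≡ a * k * (a * 0ℤ) - a * 0ℤ - (a * 0ℤ - (1ℤ - 1ℤ))
          zero-case = ℤSolver.solve-∀
        ... | no z≢0 rewrite R.*-comm z ξ | u-nonzero (·-nonzero ξ≢0 z≢0) with z ^ e ≟ 1#
        ...   | yes z^e≡1 rewrite κ-·ʳ ξ z^e≡1 = residue (+ p) (κ p ξ)
          where
          residue : ∀ a k → (a * k - 1ℤ) * (a * 1ℤ - (1ℤ - 0ℤ)) ≡ a * k * (a * 1ℤ) - a * k -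
            (a * 1ℤ - (1ℤ - 0ℤ))
          residue = ℤSolver.solve-∀
        ...   | no _ = nonresidue (+ p) (κ p ξ) (κ p (ξ · z))
          where
          nonresidue : ∀ a k k′ → (a * k′ - 1ℤ) * (a * 0ℤ - (1ℤ - 0ℤ)) ≡ a * k * (a * 0ℤ) - a * k′ -
            (a * 0ℤ - (1ℤ - 0ℤ))
          nonresidue = ℤSolver.solve-∀

  -- Products of residue functions over sets of primes.

  Φ : List ℕ → ℕ
  Φ S = product (map ℕ.pred S)

  i≤+∣i∣ : ∀ i → i ≤ + ∣ i ∣
  i≤+∣i∣ (+ _)    = ≤-refl
  i≤+∣i∣ -[1+ _ ] = -≤+

  module ResidueProducts {s : ℕ} (F : FiniteField s) where
    open Field F
    open PositiveDefiniteness F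
    open PowerResidues F

    -- The empty product is the trivial character `u` instead of the constant 1, so every `cs S`
    -- vanishes at `0#`.
    cs : List ℕ → A → ℤ
    cs []      x = u x
    cs (p ∷ S) x = cs S x * c p x

    cs-0 : ∀ S → cs S 0# ≡ 0ℤ
    cs-0 []      = u-0
    cs-0 (p ∷ S) = cong (_* c p 0#) (cs-0 S)

    cs-positiveDefinite : ∀ {S} → All (_∣ N) S → PositiveDefinite (cs S)
    cs-positiveDefinite []           = u-positiveDefinite
    cs-positiveDefinite {p ∷ S} (p∣N ∷ S∣N) =
      *-positiveDefinite {cs S} {c p} (c-corr p∣N) (cs-positiveDefinite S∣N)

    cs-inverse : ∀ {S} → All (_∣ N) S → ∀ {x y} → x · y ≡ 1# → cs S x ≡ cs S y
    cs-inverse []          {x} {y} xy≡1 =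
      ≡.trans (u-nonzero (·≡1⇒nonzero xy≡1)) (≡.sym (u-nonzero (·≡1⇒nonzero (≡.trans (R.*-comm y x) xy≡1))))
    cs-inverse (p∣N ∷ S∣N) xy≡1 = cong₂ _*_ (cs-inverse S∣N xy≡1) (c-inverse p∣N xy≡1)

    -- Every r in `S` divides `D`, so a^D is an r-th power and no factor `c r` notices it.
    cs-·^ : ∀ {S D} → All (_∣ N) S → All (_∣ D) S → ∀ {a} → a ≢ 0# → ∀ x → cs S (x · a ^ D) ≡ cs S x
    cs-·^ {[]} {D} [] [] a≢0 x = u-·ʳ x (^-nonzero D a≢0)
    cs-·^ {p ∷ S} {D} (p∣N ∷ S∣N) (divides d ≡.refl ∷ S∣D) {a} a≢0 x =
      cong₂ _*_ (cs-·^ S∣N S∣D a≢0 x) (c-·ʳ p∣N x (^-nonzero D a≢0)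
        (≡.trans (cong (_^ cofactor p) (≡.sym (^-assoc a d p))) (^p^e≡1 p∣N (^-nonzero d a≢0))))

    -- Substituting ξ a^D for ξ, with D a multiple of S congruent to 1 mod p, changes c p like ξ ↦ ξ a
    -- and leaves cs S unchanged; then average over a.
    ∑-cs : ∀ {p S} → Prime p → All Prime S → All (p ≢_) S → p ∣ N → All (_∣ N) S → ∑ (cs (p ∷ S)) ≡ 0ℤ
    ∑-cs {p} {S} p-prime primes p≢ p∣N S∣N with common-multiple≡1 p-prime primes p≢
    ... | D , v , S∣D , D≡ = *-cancelˡ-≡ (+ N) (∑ (cs (p ∷ S))) 0ℤ {{ℕ.>-nonZero 0<N}}
      (≡.trans averaged (≡.sym (*-zeroʳ (+ N))))
      where
      open ≡.≡-Reasoning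
      c-·^ : ∀ x {a} → a ≢ 0# → c p (x · a ^ D) ≡ c p (a · x)
      c-·^ x {a} a≢0 = begin
        c p (x · a ^ D)                 ≡⟨ cong (λ k → c p (x · a ^ k)) D≡ ⟩
        c p (x · (a · a ^ (v ℕ.* p)))   ≡⟨ cong (c p) (R.*-assoc x a _) ⟨
        c p (x · a · a ^ (v ℕ.* p))     ≡⟨ c-·ʳ p∣N (x · a) (^-nonzero (v ℕ.* p) a≢0)
                                             (≡.trans (cong (_^ cofactor p) (≡.sym (^-assoc a v p)))
                                               (^p^e≡1 p∣N (^-nonzero v a≢0))) ⟩
        c p (x · a)                     ≡⟨ cong (c p) (R.*-comm x a) ⟩
        c p (a · x)                     ∎
      substituted : ∀ a → u a * ∑ (cs (p ∷ S)) ≡ ∑ (λ ξ → c p (a · ξ) * cs S ξ)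
      substituted a with a ≟ 0#
      ... | yes ≡.refl = ≡.sym (∑-zero (λ ξ → cong (_* cs S ξ) (≡.trans (cong (c p) (R.zeroˡ ξ)) (c-0 p∣N))))
      ... | no a≢0 = begin
        1ℤ * ∑ (cs (p ∷ S))                        ≡⟨ *-identityˡ _ ⟩
        ∑ (cs (p ∷ S))                             ≡⟨ ∑-scale (^-nonzero D a≢0) (cs (p ∷ S)) ⟨
        ∑ (λ ξ → cs S (ξ · a ^ D) * c p (ξ · a ^ D))
          ≡⟨ ∑-cong (λ ξ → ≡.trans (cong₂ _*_ (cs-·^ S∣N S∣D a≢0 ξ) (c-·^ ξ a≢0))
          (*-comm (cs S ξ) (c p (a · ξ)))) ⟩
        ∑ (λ ξ → c p (a · ξ) * cs S ξ)             ∎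
      averaged : + N * ∑ (cs (p ∷ S)) ≡ 0ℤ
      averaged = begin
        + N * ∑ (cs (p ∷ S))                         ≡⟨ cong (_* ∑ (cs (p ∷ S))) ∑-u ⟨
        ∑ u * ∑ (cs (p ∷ S))                         ≡⟨ *-distribʳ-∑ (∑ (cs (p ∷ S))) u ⟩
        ∑ (λ a → u a * ∑ (cs (p ∷ S)))               ≡⟨ ∑-cong substituted ⟩
        ∑ (λ a → ∑ (λ ξ → c p (a · ξ) * cs S ξ))     ≡⟨ ∑-comm _ ⟩
        ∑ (λ ξ → ∑ (λ a → c p (a · ξ) * cs S ξ))
          ≡⟨ ∑-cong (λ ξ → ≡.sym (*-distribʳ-∑ (cs S ξ) (λ a → c p (a · ξ)))) ⟩
        ∑ (λ ξ → ∑ (λ a → c p (a · ξ)) * cs S ξ)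
          ≡⟨ ∑-cong (λ ξ → *-vanish-cong {cs S} (cs-0 S) ξ (λ ξ≢0 → ≡.trans (∑-scale ξ≢0 (c p)) (∑-c p∣N))) ⟩
        ∑ (λ ξ → 0ℤ * cs S ξ)                        ≡⟨ ∑-zero (λ _ → ≡.refl) ⟩
        0ℤ                                           ∎

    -- The values are p - 1 on residues, -1 on non-residues and 0 at `0#`.
    ∣c∣≤ : ∀ {p} → Prime p → p ∣ N → ∀ x → ∣ c p x ∣ ℕ.≤ ℕ.pred p
    ∣c∣≤ {suc (suc p)} _ p∣N x with x ≟ 0#
    ... | yes ≡.refl = ≡.subst (ℕ._≤ suc p) (≡.sym (cong ∣_∣ (cong (λ a → + suc (suc p) * a - 0ℤ) (κ-0 p∣N))))
                         (ℕ.≤-trans (ℕ.≤-reflexive (cong ∣_∣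
                           (≡.trans (+-identityʳ (+ suc (suc p) * 0ℤ)) (*-zeroʳ (+ suc (suc p)))))) ℕ.z≤n)
    ... | no _ with x ^ cofactor (suc (suc p)) ≟ 1#
    ...   | yes _ = ℕ.≤-reflexive (cong ∣_∣ (cong (_- 1ℤ) (*-identityʳ (+ suc (suc p)))))
    ...   | no _  = ℕ.≤-trans (ℕ.≤-reflexive (cong ∣_∣ (cong (_- 1ℤ) (*-zeroʳ (+ suc (suc p))))))
      (ℕ.s≤s ℕ.z≤n)

    ∣cs∣≤ : ∀ {S} → All Prime S → All (_∣ N) S → ∀ x → ∣ cs S x ∣ ℕ.≤ Φ S
    ∣cs∣≤ [] [] x with x ≟ 0#
    ... | yes _ = ℕ.z≤n
    ... | no _  = ℕ.≤-refl
    ∣cs∣≤ {p ∷ S} (p-prime ∷ primes) (p∣N ∷ S∣N) x = begin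
      ∣ cs S x * c p x ∣          ≡⟨ abs-* (cs S x) (c p x) ⟩
      ∣ cs S x ∣ ℕ.* ∣ c p x ∣    ≤⟨ ℕ.*-mono-≤ (∣cs∣≤ primes S∣N x) (∣c∣≤ p-prime p∣N x) ⟩
      Φ S ℕ.* ℕ.pred p            ≡⟨ ℕ.*-comm (Φ S) (ℕ.pred p) ⟩
      ℕ.pred p ℕ.* Φ S            ∎
      where open ℕ.≤-Reasoning

    -- What the trace-sum estimate asks of f. For a sum of characters f(1) is their number, so b
    -- bounds how many there are.
    record Admissible (b : ℕ) (f : A → ℤ) : Set where
      field
        positiveDefinite : PositiveDefinite f
        vanishes         : f 0# ≡ 0ℤ
        inversion        : ∀ {x y} → x · y ≡ 1# → f x ≡ f y
        sum-zero         : ∑ f ≡ 0ℤ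
        at-1             : f 1# ≤ + b

    c-admissible : ∀ {p} → Prime p → p ∣ N → Admissible (ℕ.pred p) (c p)
    c-admissible {p} p-prime p∣N = record
      { positiveDefinite = λ v v0 → ≡.subst (0ℤ ≤_) (∑-cong (λ z → cong (_* corr v z) (u*c z)))
        (cs-positiveDefinite (p∣N ∷ []) v v0)
      ; vanishes  = c-0 p∣N
      ; inversion = c-inverse p∣N
      ; sum-zero  = ∑-c p∣N
      ; at-1      = ≤-trans (i≤+∣i∣ (c p 1#)) (+≤+ (∣c∣≤ p-prime p∣N 1#))
      }
      where
      u*c : ∀ z → u z * c p z ≡ c p z
      u*c z = ≡.trans (*-vanish-cong {c p} (c-0 p∣N) z u-nonzero) (*-identityˡ (c p z))

    0⁻¹ : 0# ⁻¹ ≡ 0#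
    0⁻¹ with 0# ≟ 0#
    ... | yes _  = ≡.refl
    ... | no 0≢0 = contradiction ≡.refl 0≢0

    ⁻¹-involutive : ∀ x → (x ⁻¹) ⁻¹ ≡ x
    ⁻¹-involutive x with x ≟ 0#
    ... | yes ≡.refl = 0⁻¹
    ... | no x≢0 = ·-cancelˡ x⁻¹≢0
      (≡.trans (·-inverseʳ x⁻¹≢0) (≡.sym (≡.trans (R.*-comm _ x) (proj₂ (inverse x x≢0)))))
      where
      x⁻¹≢0 : proj₁ (inverse x x≢0) ≢ 0#
      x⁻¹≢0 = ·≡1⇒nonzero (≡.trans (R.*-comm _ x) (proj₂ (inverse x x≢0)))

    push-inverse : ∀ e .{{_ : ℕ.NonZero e}} {f} → f 0# ≡ 0ℤ → (∀ {x y} → x · y ≡ 1# → f x ≡ f y) →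
                   ∀ {x y} → x · y ≡ 1# → push e f x ≡ push e f y
    push-inverse e {f} f0 f-inv {x} {y} xy≡1 = ≡.trans
      (≡.sym (∑-permute (λ ξ → ⟦ x ≟ ξ ^ e ⟧ * f ξ) _⁻¹ _⁻¹ ⁻¹-involutive ⁻¹-involutive)) (∑-cong pointwise)
      where
      unique : ∀ {x y z} → x · y ≡ 1# → x · z ≡ 1# → y ≡ z
      unique xy xz = ·-cancelˡ (·≡1⇒nonzero xy) (≡.trans xy (≡.sym xz))
      pointwise : ∀ ξ → ⟦ x ≟ (ξ ⁻¹) ^ e ⟧ * f (ξ ⁻¹) ≡ ⟦ y ≟ ξ ^ e ⟧ * f ξ
      pointwise ξ = by-case (ξ ≟ 0#)
        where
        by-case : Dec (ξ ≡ 0#) → ⟦ x ≟ (ξ ⁻¹) ^ e ⟧ * f (ξ ⁻¹) ≡ ⟦ y ≟ ξ ^ e ⟧ * f ξ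
        by-case (yes ≡.refl) = ≡.trans
          (≡.trans (cong (⟦ x ≟ (0# ⁻¹) ^ e ⟧ *_) (≡.trans (cong f 0⁻¹) f0)) (*-zeroʳ ⟦ x ≟ (0# ⁻¹) ^ e ⟧))
          (≡.sym (≡.trans (cong (⟦ y ≟ 0# ^ e ⟧ *_) f0) (*-zeroʳ ⟦ y ≟ 0# ^ e ⟧)))
        by-case (no ξ≢0) = cong₂ _*_ (⟦⟧-cong (x ≟ (ξ ⁻¹) ^ e) (y ≟ ξ ^ e)
            (λ { ≡.refl → unique xy≡1 product≡1 })
            (λ { ≡.refl → unique (≡.trans (R.*-comm _ x) xy≡1) (≡.trans (R.*-comm _ _) product≡1) }))
          (f-inv (·-inverseˡ ξ≢0))
          where
          product≡1 : (ξ ⁻¹) ^ e · ξ ^ e ≡ 1#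
          product≡1 = ≡.trans (≡.sym (^-distrib-· (ξ ⁻¹) ξ e)) (≡.trans (cong (_^ e) (·-inverseˡ ξ≢0)) (1^ e))

    -- The factor 2 bounds the number of ξ with ξ^2 = 1. The list must be nonempty for the sum to
    -- vanish, as `u` sums to N.
    push-cs-admissible : ∀ {p S} → All Prime (p ∷ S) → All (p ≢_) S → All (_∣ N) (p ∷ S) →
                         Admissible (2 ℕ.* Φ (p ∷ S)) (push 2 (cs (p ∷ S)))
    push-cs-admissible {p} {S} primes@(p-prime ∷ S-primes) p≢ pS∣N@(p∣N ∷ S∣N) = record
      { positiveDefinite = push-positiveDefinite 2 {cs (p ∷ S)} (cs-positiveDefinite pS∣N)
      ; vanishes  = ∑-zero vanish
      ; inversion = push-inverse 2 {cs (p ∷ S)} (cs-0 (p ∷ S)) (cs-inverse pS∣N)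
      ; sum-zero  = begin
          ∑ (push 2 (cs (p ∷ S)))               ≡⟨ ∑-cong (λ z → *-identityʳ (push 2 (cs (p ∷ S)) z)) ⟨
          ∑ (λ z → push 2 (cs (p ∷ S)) z * 1ℤ)  ≡⟨ ∑-fibre (_^ 2) (cs (p ∷ S)) (λ _ → 1ℤ) ⟩
          ∑ (λ ξ → cs (p ∷ S) ξ * 1ℤ)           ≡⟨ ∑-cong (λ ξ → *-identityʳ (cs (p ∷ S) ξ)) ⟩
          ∑ (cs (p ∷ S))                        ≡⟨ ∑-cs p-prime S-primes p≢ p∣N S∣N ⟩
          0ℤ                                    ∎
      ; at-1      = at-1
      }
      where
      open ≡.≡-Reasoning
      vanish : ∀ ξ → ⟦ 0# ≟ ξ ^ 2 ⟧ * cs (p ∷ S) ξ ≡ 0ℤ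
      vanish ξ = ≡.trans (*-vanish-cong {cs (p ∷ S)} (cs-0 (p ∷ S)) ξ
        (λ ξ≢0 → ⟦⟧-no (0# ≟ ξ ^ 2) (^-nonzero 2 ξ≢0 ∘ ≡.sym))) (*-zeroˡ (cs (p ∷ S) ξ))
      at-1 : push 2 (cs (p ∷ S)) 1# ≤ + (2 ℕ.* Φ (p ∷ S))
      at-1 = ≤-trans (∑-mono bound) (≤-trans
        (≤-reflexive (≡.sym (*-distribʳ-∑ (+ Φ (p ∷ S)) (λ ξ → ⟦ ξ ^ 2 ≟ 1# ⟧))))
        (≤-trans (*-monoʳ-≤-nonNeg (+ Φ (p ∷ S)) (^-fibre-bound 2 1#))
          (≤-reflexive (≡.sym (pos-* 2 (Φ (p ∷ S)))))))
        where
        bound : ∀ ξ → ⟦ 1# ≟ ξ ^ 2 ⟧ * cs (p ∷ S) ξ ≤ ⟦ ξ ^ 2 ≟ 1# ⟧ * + Φ (p ∷ S)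
        bound ξ = ≤-trans (≤-reflexive
          (cong (_* cs (p ∷ S) ξ) (⟦⟧-cong (1# ≟ ξ ^ 2) (ξ ^ 2 ≟ 1#) ≡.sym ≡.sym)))
          (mono (ξ ^ 2 ≟ 1#) (≤-trans (i≤+∣i∣ (cs (p ∷ S) ξ)) (+≤+ (∣cs∣≤ primes pS∣N ξ))))
          where
          mono : ∀ {P : Set} (d : Dec P) {i j} → i ≤ j → ⟦ d ⟧ * i ≤ ⟦ d ⟧ * j
          mono (yes _) {i} {j} i≤j = ≤-trans (≤-reflexive (*-identityˡ i))
            (≤-trans i≤j (≤-reflexive (≡.sym (*-identityˡ j))))
          mono (no _)  i≤j = ≤-refl

  -- The Cauchy-Schwarz estimate for sums over elements of trace β.

  module TraceSum {p k q n′ : ℕ} (p-prime : Prime p) (1≤k : 1 ℕ.≤ k) (q≡p^k : q ≡ p ℕ.^ k)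
                  (F : FiniteField (q ℕ.^ suc n′))
                  {β : FiniteField.Carrier F} (β∈Fq : InSubfield F q β) (β≢0 : β ≢ FiniteField.0# F) where

    open Field F
    open PositiveDefiniteness F
    open ResidueProducts F
    open Trace {n′ = n′} p-prime 1≤k q≡p^k F public
    open AffineHyperplane β∈Fq β≢0 public

    -- Test positive definiteness against the indicator function of the subgroup Fq*.
    ∑-subfield-nonneg : ∀ {f} → PositiveDefinite f → f 0# ≡ 0ℤ → 0ℤ ≤ ∑ (λ z → f z * ⟦ Fq? z ⟧)
    ∑-subfield-nonneg {f} f-pd f0 = *-cancelˡ-nonneg 0<∑v (≤-trans (f-pd v v-0) (≤-reflexive rewritten))
      where
      open ≡.≡-Reasoning
      v : A → ℤ
      v x = ⟦ Fq? x ⟧ * u x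
      v-0 : v 0# ≡ 0ℤ
      v-0 = ≡.trans (cong (⟦ Fq? 0# ⟧ *_) u-0) (*-zeroʳ ⟦ Fq? 0# ⟧)
      0<∑v : 0ℤ < ∑ v
      0<∑v = ≡.subst (0ℤ <_) (≡.sym ∑v≡) (i<j⇒0<j-i (+<+ 1<q))
        where
        i<j⇒0<j-i : ∀ {i j} → i < j → 0ℤ < j - i
        i<j⇒0<j-i {i} {j} i<j = ≡.subst (_< j - i) (+-inverseʳ i) (+-monoˡ-< (- i) i<j)
        ∑v≡ : ∑ v ≡ + q - 1ℤ
        ∑v≡ = begin
          ∑ v
            ≡⟨ ∑-cong (λ x → expand ⟦ Fq? x ⟧ ⟦ x ≟ 0# ⟧) ⟩
          ∑ (λ x → ⟦ Fq? x ⟧ - ⟦ x ≟ 0# ⟧ * ⟦ Fq? x ⟧)            ≡⟨ ∑-distrib-- (λ x → ⟦ Fq? x ⟧) _ ⟩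
          ∑ (λ x → ⟦ Fq? x ⟧) - ∑ (λ x → ⟦ x ≟ 0# ⟧ * ⟦ Fq? x ⟧)
            ≡⟨ cong₂ _-_ card-Fq (≡.trans (∑-δ 0# (λ x → ⟦ Fq? x ⟧)) (⟦⟧-yes (Fq? 0#) Fq-0)) ⟩
          + q - 1ℤ                                                ∎
          where
          expand : ∀ a b → a * (1ℤ - b) ≡ a - b * a
          expand = ℤSolver.solve-∀
      v-· : ∀ z {x} → x ≢ 0# → Fq x → v (z · x) ≡ v z
      v-· z {x} x≢0 x∈ = cong₂ _*_ (⟦⟧-cong (Fq? (z · x)) (Fq? z)
          (λ zx∈ → ≡.subst Fq (≡.trans (R.*-assoc z x _)
            (≡.trans (cong (z ·_) (·-inverseʳ x≢0)) (R.*-identityʳ z))) (Fq-· zx∈ (Fq-⁻¹ x≢0 x∈)))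
          (λ z∈ → Fq-· z∈ x∈))
        (PowerResidues.u-·ʳ F z x≢0)
      -- The indicator of a subgroup is its own autocorrelation, up to the order of the subgroup.
      corr-v : ∀ z → corr v z ≡ ∑ v * v z
      corr-v z = ≡.trans (∑-cong pointwise) (≡.trans (≡.sym (*-distribˡ-∑ (v z) v)) (*-comm (v z) (∑ v)))
        where
        outside : ∀ {x} → v x ≡ 0ℤ → v (z · x) * v x ≡ v z * v x
        outside {x} vx≡0 = ≡.trans (≡.trans (cong (v (z · x) *_) vx≡0) (*-zeroʳ (v (z · x))))
          (≡.sym (≡.trans (cong (v z *_) vx≡0) (*-zeroʳ (v z))))
        pointwise : ∀ x → v (z · x) * v x ≡ v z * v x
        pointwise x = by-case (x ≟ 0#) (Fq? x)
          where
          by-case : Dec (x ≡ 0#) → Dec (Fq x) → v (z · x) * v x ≡ v z * v x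
          by-case (yes ≡.refl) _        = outside v-0
          by-case (no _)       (no x∉)  = outside (cong (_* u x) (⟦⟧-no (Fq? x) x∉))
          by-case (no x≢0)     (yes x∈) = cong (_* v x) (v-· z x≢0 x∈)
      rewritten : ∑ (λ z → f z * corr v z) ≡ ∑ v * ∑ (λ z → f z * ⟦ Fq? z ⟧)
      rewritten = begin
        ∑ (λ z → f z * corr v z)
          ≡⟨ ∑-cong (λ z → ≡.trans (cong (f z *_) (corr-v z)) (regroup (f z) (∑ v) ⟦ Fq? z ⟧ (u z))) ⟩
        ∑ (λ z → ∑ v * ⟦ Fq? z ⟧ * u z * f z)
          ≡⟨ ∑-cong (λ z → *-vanish-cong {f} f0 z
          (λ z≢0 → ≡.trans (cong (∑ v * ⟦ Fq? z ⟧ *_) (u-nonzero z≢0)) (*-identityʳ (∑ v * ⟦ Fq? z ⟧)))) ⟩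
        ∑ (λ z → ∑ v * ⟦ Fq? z ⟧ * f z)
          ≡⟨ ∑-cong (λ z → ≡.trans (*-assoc (∑ v) ⟦ Fq? z ⟧ (f z)) (cong (∑ v *_) (*-comm ⟦ Fq? z ⟧ (f z)))) ⟩
        ∑ (λ z → ∑ v * (f z * ⟦ Fq? z ⟧))            ≡⟨ *-distribˡ-∑ (∑ v) _ ⟨
        ∑ v * ∑ (λ z → f z * ⟦ Fq? z ⟧)              ∎
        where
        regroup : ∀ f V i u → f * (V * (i * u)) ≡ V * i * u * f
        regroup = ℤSolver.solve-∀

    module _ {f : A → ℤ} {b : ℕ} (f-admissible : Admissible b f) where
      open Admissible f-admissible

      private
        T = ∑ (λ y → f y * Y y)
        S = ∑ (λ z → f z * R-count z)

        S≤ : S ≤ + t * f 1#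
        S≤ = *-cancelˡ-≤-pos S (+ t * f 1#) (+ q) {{positive (+<+ (ℕ.>-nonZero⁻¹ q))}} (begin
          + q * S                             ≡⟨ qS≡ ⟩
          + q * (+ t * f 1#) - + t * ∑ (λ z → f z * ⟦ Fq? z ⟧)
            ≤⟨ +-monoʳ-≤ (+ q * (+ t * f 1#))
              (neg-mono-≤ (*-nonneg {+ t} (+≤+ ℕ.z≤n) (∑-subfield-nonneg {f} positiveDefinite vanishes))) ⟩
          + q * (+ t * f 1#) - 0ℤ             ≡⟨ +-identityʳ _ ⟩
          + q * (+ t * f 1#)                  ∎)
          where
          open ≤-Reasoning
          δ-part Fq-part : A → ℤ
          δ-part z  = + q * + t * (⟦ z ≟ 1# ⟧ * f z)
          Fq-part z = + t * (f z - f z * ⟦ Fq? z ⟧)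
          expand : ∀ q t f d i → f * (q * t * d + t * (1ℤ - i)) ≡ q * t * (d * f) + t * (f - f * i)
          expand = ℤSolver.solve-∀
          collect : ∀ q t f s → q * t * f + t * (0ℤ - s) ≡ q * (t * f) - t * s
          collect = ℤSolver.solve-∀
          swap : ∀ q f r → q * (f * r) ≡ f * (q * r)
          swap = ℤSolver.solve-∀
          qS≡ : + q * S ≡ + q * (+ t * f 1#) - + t * ∑ (λ z → f z * ⟦ Fq? z ⟧)
          qS≡ = ≡.trans (*-distribˡ-∑ (+ q) (λ z → f z * R-count z))
               (≡.trans (∑-cong (λ z → ≡.trans (swap (+ q) (f z) (R-count z))
                 (≡.trans (cong (f z *_) (R-formula z)) (expand (+ q) (+ t) (f z) ⟦ z ≟ 1# ⟧ ⟦ Fq? z ⟧))))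
               (≡.trans (∑-distrib-+ δ-part Fq-part)
               (≡.trans (cong₂ _+_ (≡.trans (≡.sym (*-distribˡ-∑ (+ q * + t) (λ z → ⟦ z ≟ 1# ⟧ * f z)))
                 (cong (+ q * + t *_) (∑-δ 1# f)))
                                   (≡.trans (≡.sym (*-distribˡ-∑ (+ t) (λ z → f z - f z * ⟦ Fq? z ⟧)))
                                     (cong (+ t *_) (≡.trans (∑-distrib-- f (λ z → f z * ⟦ Fq? z ⟧))
                                       (cong (_- ∑ (λ z → f z * ⟦ Fq? z ⟧)) sum-zero)))))
                        (collect (+ q) (+ t) (f 1#) (∑ (λ z → f z * ⟦ Fq? z ⟧))))))

        δ D : A → ℤ
        δ x = ⟦ x ≟ 1# ⟧
        D z = ∑ (λ x → δ (z · x) * Y x)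

        -- `D z` is `Y` at the inverse of z. Invariance of f under inversion makes this mixed term
        -- equal to the other one.
        ∑fD≡T : ∑ (λ z → f z * D z) ≡ T
        ∑fD≡T = begin
          ∑ (λ z → f z * D z)
            ≡⟨ ∑-cong (λ z → *-distribˡ-∑ (f z) (λ x → δ (z · x) * Y x)) ⟩
          ∑ (λ z → ∑ (λ x → f z * (δ (z · x) * Y x)))    ≡⟨ ∑-comm _ ⟩
          ∑ (λ x → ∑ (λ z → f z * (δ (z · x) * Y x)))
            ≡⟨ ∑-cong (λ x → ≡.trans (∑-cong (λ z → regroup (f z) (δ (z · x)) (Y x)))
            (≡.sym (*-distribʳ-∑ (Y x) (λ z → δ (z · x) * f z)))) ⟩
          ∑ (λ x → ∑ (λ z → δ (z · x) * f z) * Y x)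
            ≡⟨ ∑-cong (λ x → *-vanish-cong {Y} Y-0 x at-inverse) ⟩
          ∑ (λ x → f x * Y x)                            ∎
          where
          open ≡.≡-Reasoning
          regroup : ∀ a b d → a * (b * d) ≡ b * a * d
          regroup = ℤSolver.solve-∀
          at-inverse : ∀ {x} → x ≢ 0# → ∑ (λ z → δ (z · x) * f z) ≡ f x
          at-inverse {x} x≢0 = ≡.trans (∑-cong (λ z → cong (_* f z) (⟦⟧-cong (z · x ≟ 1#) (z ≟ x ⁻¹)
              (λ zx≡1 → ·-cancelˡ x≢0 (≡.trans (R.*-comm x z) (≡.trans zx≡1 (≡.sym (·-inverseʳ x≢0)))))
              (λ { ≡.refl → ·-inverseˡ x≢0 }))))
            (≡.trans (∑-δ (x ⁻¹) f) (inversion (·-inverseˡ x≢0)))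

        quadratic-form : ∀ α γ → 0ℤ ≤ α * α * f 1# + (1ℤ + 1ℤ) * (α * γ * T) + γ * γ * S
        quadratic-form α γ = ≤-trans (positiveDefinite v v-0) (≤-reflexive expanded)
          where
          open ≡.≡-Reasoning
          v : A → ℤ
          v x = α * δ x + γ * Y x
          v-0 : v 0# ≡ 0ℤ
          v-0 = ≡.trans (cong₂ (λ a c → α * a + γ * c) (⟦⟧-no (0# ≟ 1#) 0≢1) Y-0)
            (cong₂ _+_ (*-zeroʳ α) (*-zeroʳ γ))
          expand-product : ∀ α γ d d′ y y′ → (α * d′ + γ * y′) * (α * d + γ * y) ≡
            α * α * (d * d′) + (α * γ * (d′ * y) + (α * γ * (d * y′) + γ * γ * (y′ * y)))
          expand-product = ℤSolver.solve-∀
          linear₄ : ∀ g₁ g₂ g₃ g₄ {i₁ i₂ i₃ i₄} → ∑ g₁ ≡ i₁ → ∑ g₂ ≡ i₂ → ∑ g₃ ≡ i₃ → ∑ g₄ ≡ i₄ →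
            ∑ (λ x → α * α * g₁ x + (α * γ * g₂ x + (α * γ * g₃ x + γ * γ * g₄ x))) ≡ α * α * i₁ +
              (α * γ * i₂ + (α * γ * i₃ + γ * γ * i₄))
          linear₄ g₁ g₂ g₃ g₄ ≡.refl ≡.refl ≡.refl ≡.refl =
            ≡.trans (∑-distrib-+ (λ x → α * α * g₁ x) _) (cong₂ _+_ (≡.sym (*-distribˡ-∑ (α * α) g₁))
            (≡.trans (∑-distrib-+ (λ x → α * γ * g₂ x) _) (cong₂ _+_ (≡.sym (*-distribˡ-∑ (α * γ) g₂))
            (≡.trans (∑-distrib-+ (λ x → α * γ * g₃ x) _)
              (cong₂ _+_ (≡.sym (*-distribˡ-∑ (α * γ) g₃)) (≡.sym (*-distribˡ-∑ (γ * γ) g₄)))))))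
          corr-v : ∀ z → corr v z ≡ α * α * δ z + (α * γ * D z + (α * γ * Y z + γ * γ * R-count z))
          corr-v z = ≡.trans (∑-cong (λ x → expand-product α γ (δ x) (δ (z · x)) (Y x) (Y (z · x))))
            (linear₄ (λ x → δ x * δ (z · x)) (λ x → δ (z · x) * Y x) (λ x → δ x * Y (z · x))
              (λ x → Y (z · x) * Y x)
              (select δ) ≡.refl (select Y) ≡.refl)
            where
            select : ∀ g → ∑ (λ x → δ x * g (z · x)) ≡ g z
            select g = ≡.trans (∑-δ 1# (λ x → g (z · x))) (cong g (R.*-identityʳ z))
          expanded : ∑ (λ z → f z * corr v z) ≡ α * α * f 1# + (1ℤ + 1ℤ) * (α * γ * T) + γ * γ * S
          expanded = begin
            ∑ (λ z → f z * corr v z)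
              ≡⟨ ∑-cong (λ z → ≡.trans (cong (f z *_) (corr-v z))
                (distribute (f z) α γ (δ z) (D z) (Y z) (R-count z))) ⟩
            ∑ (λ z → α * α * (δ z * f z) +
              (α * γ * (f z * D z) + (α * γ * (f z * Y z) + γ * γ * (f z * R-count z))))
              ≡⟨ linear₄ (λ z → δ z * f z) (λ z → f z * D z) (λ z → f z * Y z) (λ z → f z * R-count z)
                (∑-δ 1# f) ∑fD≡T ≡.refl ≡.refl ⟩
            α * α * f 1# + (α * γ * T + (α * γ * T + γ * γ * S))
              ≡⟨ collect (α * α * f 1#) (α * γ * T) (γ * γ * S) ⟩
            α * α * f 1# + (1ℤ + 1ℤ) * (α * γ * T) + γ * γ * S ∎
            where
            distribute : ∀ f α γ δ D Y R → f * (α * α * δ + (α * γ * D + (α * γ * Y + γ * γ * R))) ≡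
              α * α * (δ * f) + (α * γ * (f * D) + (α * γ * (f * Y) + γ * γ * (f * R)))
            distribute = ℤSolver.solve-∀
            collect : ∀ a b d → a + (b + (b + d)) ≡ a + (1ℤ + 1ℤ) * b + d
            collect = ℤSolver.solve-∀

      -- The discriminant argument at α = -T, γ = b. Replacing f(1) by b, and S by its bound t b,
      -- turns the form into b (b² t - T²); the positive factor b is then cancelled.
      trace-sum-bound : 0 ℕ.< b → T * T ≤ + b * + b * + t
      trace-sum-bound 0<b = 0≤i-j⇒j≤i (*-cancelˡ-nonneg (+<+ 0<b) (begin
        0ℤ
          ≤⟨ quadratic-form (- T) (+ b) ⟩
        - T * - T * f 1# + (1ℤ + 1ℤ) * (- T * + b * T) + + b * + b * S
          ≤⟨ +-mono-≤ (+-monoˡ-≤ ((1ℤ + 1ℤ) * (- T * + b * T))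
            (*-monoˡ-≤-nonNeg (- T * - T) {{nonNegative (square-nonneg (- T))}} at-1))
                      (*-monoˡ-≤-nonNeg (+ b * + b) {{nonNegative (square-nonneg (+ b))}}
                        (≤-trans S≤ (*-monoˡ-≤-nonNeg (+ t) at-1))) ⟩
        - T * - T * + b + (1ℤ + 1ℤ) * (- T * + b * T) + + b * + b * (+ t * + b)     ≡⟨ factor T (+ b) (+ t) ⟩
        + b * (+ b * + b * + t - T * T)                                             ∎))
        where
        open ≤-Reasoning
        factor : ∀ T b t → - T * - T * b + (1ℤ + 1ℤ) * (- T * b * T) + b * b * (t * b) ≡ b *
          (b * b * t - T * T)
        factor = ℤSolver.solve-∀

  -- Bounds of the form b √t, kept as inequalities between squares.

  -- The absolute value of a is at most b √t.
  infix 4 _≤_√_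
  record _≤_√_ (a : ℤ) (b t : ℕ) : Set where
    constructor bounded
    field squares : ∣ a ∣ ℕ.* ∣ a ∣ ℕ.≤ b ℕ.* b ℕ.* t

  square-abs : ∀ a → a * a ≡ + (∣ a ∣ ℕ.* ∣ a ∣)
  square-abs (+ n)    = ≡.sym (pos-* n n)
  square-abs -[1+ n ] = ≡.refl

  module _ {t : ℕ} where

    square-cancel-≤ : ∀ {m n} → m ℕ.* m ℕ.≤ n ℕ.* n → m ℕ.≤ n
    square-cancel-≤ {m} {n} m²≤n² with m ℕ.≤? n
    ... | yes m≤n = m≤n
    ... | no m≰n = contradiction m²≤n² (ℕ.<⇒≱ (ℕ.*-mono-< (ℕ.≰⇒> m≰n) (ℕ.≰⇒> m≰n)))

    -- The triangle inequality. The cross term is bounded by multiplying the two hypotheses and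
    -- cancelling squares.
    √-+ : ∀ {a a′ b b′} → a ≤ b √ t → a′ ≤ b′ √ t → a + a′ ≤ b ℕ.+ b′ √ t
    √-+ {a} {a′} {b} {b′} (bounded a≤) (bounded a′≤) = bounded $ begin
      ∣ a + a′ ∣ ℕ.* ∣ a + a′ ∣                ≤⟨ ℕ.*-mono-≤ (∣i+j∣≤∣i∣+∣j∣ a a′) (∣i+j∣≤∣i∣+∣j∣ a a′) ⟩
      (x ℕ.+ y) ℕ.* (x ℕ.+ y)                  ≡⟨ binomial x y ⟩
      x ℕ.* x ℕ.+ 2 ℕ.* (x ℕ.* y) ℕ.+ y ℕ.* y  ≤⟨ ℕ.+-mono-≤ (ℕ.+-mono-≤ a≤ (ℕ.*-monoʳ-≤ 2 cross)) a′≤ ⟩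
      b ℕ.* b ℕ.* t ℕ.+ 2 ℕ.* (b ℕ.* b′ ℕ.* t) ℕ.+ b′ ℕ.* b′ ℕ.* t ≡⟨ collect b b′ t ⟩
      (b ℕ.+ b′) ℕ.* (b ℕ.+ b′) ℕ.* t          ∎
      where
      open ℕ.≤-Reasoning
      x = ∣ a ∣
      y = ∣ a′ ∣
      binomial : ∀ x y → (x ℕ.+ y) ℕ.* (x ℕ.+ y) ≡ x ℕ.* x ℕ.+ 2 ℕ.* (x ℕ.* y) ℕ.+ y ℕ.* y
      binomial = ℕSolver.solve-∀
      collect : ∀ b c t → b ℕ.* b ℕ.* t ℕ.+ 2 ℕ.* (b ℕ.* c ℕ.* t) ℕ.+ c ℕ.* c ℕ.* t ≡ (b ℕ.+ c) ℕ.*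
        (b ℕ.+ c) ℕ.* t
      collect = ℕSolver.solve-∀
      square-* : ∀ x y → x ℕ.* y ℕ.* (x ℕ.* y) ≡ x ℕ.* x ℕ.* (y ℕ.* y)
      square-* = ℕSolver.solve-∀
      regroup : ∀ b c t → b ℕ.* b ℕ.* t ℕ.* (c ℕ.* c ℕ.* t) ≡ b ℕ.* c ℕ.* t ℕ.* (b ℕ.* c ℕ.* t)
      regroup = ℕSolver.solve-∀
      cross : x ℕ.* y ℕ.≤ b ℕ.* b′ ℕ.* t
      cross = square-cancel-≤ (≡.subst₂ ℕ._≤_ (≡.sym (square-* x y)) (regroup b b′ t) (ℕ.*-mono-≤ a≤ a′≤))

    √-* : ∀ k {a b} → a ≤ b √ t → + k * a ≤ k ℕ.* b √ t
    √-* k {a} {b} (bounded a≤) = bounded $ begin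
      ∣ + k * a ∣ ℕ.* ∣ + k * a ∣          ≡⟨ cong₂ ℕ._*_ (abs-* (+ k) a) (abs-* (+ k) a) ⟩
      k ℕ.* ∣ a ∣ ℕ.* (k ℕ.* ∣ a ∣)        ≡⟨ regroup k ∣ a ∣ ⟩
      k ℕ.* k ℕ.* (∣ a ∣ ℕ.* ∣ a ∣)        ≤⟨ ℕ.*-monoʳ-≤ (k ℕ.* k) a≤ ⟩
      k ℕ.* k ℕ.* (b ℕ.* b ℕ.* t)          ≡⟨ regroup′ k b t ⟩
      k ℕ.* b ℕ.* (k ℕ.* b) ℕ.* t          ∎
      where
      open ℕ.≤-Reasoning
      regroup : ∀ k a → k ℕ.* a ℕ.* (k ℕ.* a) ≡ k ℕ.* k ℕ.* (a ℕ.* a)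
      regroup = ℕSolver.solve-∀
      regroup′ : ∀ k b t → k ℕ.* k ℕ.* (b ℕ.* b ℕ.* t) ≡ k ℕ.* b ℕ.* (k ℕ.* b) ℕ.* t
      regroup′ = ℕSolver.solve-∀

    √-neg : ∀ {a b} → a ≤ b √ t → - a ≤ b √ t
    √-neg {a} (bounded a≤) = bounded (≡.subst (λ x → x ℕ.* x ℕ.≤ _) (≡.sym (∣-i∣≡∣i∣ a)) a≤)

    square≤⇒√ : ∀ {a b} → a * a ≤ + b * + b * + t → a ≤ b √ t
    square≤⇒√ {a} {b} h = bounded $ drop‿+≤+ (≡.subst₂ _≤_ (square-abs a)
      (≡.trans (cong (_* + t) (≡.sym (pos-* b b))) (≡.sym (pos-* (b ℕ.* b) t))) h)

  -- This is 2^(k+1) - 1, hence 2 W(m) - 1 at k = ν m. The recursion avoids subtraction and mirrors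
  -- one step of the sieve, where a new prime adds 2 · 2^k.
  mersenne : ℕ → ℕ
  mersenne zero    = 1
  mersenne (suc k) = mersenne k ℕ.+ 2 ℕ.* 2 ℕ.^ k

  suc-mersenne : ∀ k → suc (mersenne k) ≡ 2 ℕ.* 2 ℕ.^ k
  suc-mersenne zero    = ≡.refl
  suc-mersenne (suc k) = ≡.trans (cong (ℕ._+ 2 ℕ.* 2 ℕ.^ k) (suc-mersenne k)) (double (2 ℕ.* 2 ℕ.^ k))
    where
    double : ∀ n → n ℕ.+ n ≡ 2 ℕ.* n
    double = ℕSolver.solve-∀

  0<pred-prime : ∀ {p} → Prime p → 0 ℕ.< ℕ.pred p
  0<pred-prime {suc (suc p)} _ = ℕ.s≤s ℕ.z≤n

  0<Φ : ∀ {S} → All Prime S → 0 ℕ.< Φ S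
  0<Φ []                 = ℕ.s≤s ℕ.z≤n
  0<Φ (p-prime ∷ primes) = ℕ.*-mono-< (0<pred-prime p-prime) (0<Φ primes)

  +pred+1 : ∀ {p} → Prime p → + ℕ.pred p ≡ + p - 1ℤ
  +pred+1 {suc p} _ = ≡.refl

  -- Expanding the indicator of free elements.

  module Sieve {p k q n′ : ℕ} (p-prime : Prime p) (1≤k : 1 ℕ.≤ k) (q≡p^k : q ≡ p ℕ.^ k)
               (F : FiniteField (q ℕ.^ suc n′))
               {β : FiniteField.Carrier F} (β∈Fq : InSubfield F q β) (β≢0 : β ≢ FiniteField.0# F) where

    open Field F
    open PositiveDefiniteness F
    open PowerResidues F
    open ResidueProducts F
    open TraceSum {n′ = n′} p-prime 1≤k q≡p^k F β∈Fq β≢0 public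

    weight : List ℕ → A → ℤ
    weight []      ξ = 1ℤ
    weight (r ∷ P) ξ = (+ ℕ.pred r - c r ξ) * weight P ξ

    -- A stage of the expansion: primes in `P` still carry their sieve factor, primes in `S` have
    -- contributed their `c`. `G P []` is the weighted count itself.
    G : List ℕ → List ℕ → ℤ
    G P S = ∑ (λ ξ → cs S ξ * weight P ξ * Y (ξ ^ 2))

    G-∷ : ∀ r P S → G (r ∷ P) S ≡ + ℕ.pred r * G P S + - G P (r ∷ S)
    G-∷ r P S = ≡.trans (∑-cong (λ ξ → expand (+ ℕ.pred r) (cs S ξ) (c r ξ) (weight P ξ) (Y (ξ ^ 2))))
      (≡.trans (∑-distrib-- (λ ξ → + ℕ.pred r * (cs S ξ * weight P ξ * Y (ξ ^ 2)))
        (λ ξ → cs S ξ * c r ξ * weight P ξ * Y (ξ ^ 2)))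
        (cong (_- G P (r ∷ S)) (≡.sym (*-distribˡ-∑ (+ ℕ.pred r) _))))
      where
      expand : ∀ a s c w y → s * ((a - c) * w) * y ≡ a * (s * w * y) - s * c * w * y
      expand = ℤSolver.solve-∀

    G-[] : ∀ S → G [] S ≡ ∑ (λ z → push 2 (cs S) z * Y z)
    G-[] S = ≡.trans (∑-cong (λ ξ → cong (_* Y (ξ ^ 2)) (*-identityʳ (cs S ξ))))
      (≡.sym (∑-fibre (_^ 2) (cs S) Y))

    -- Expanding one prime gives two terms with the same bound, hence the power of 2. The second
    -- list stays nonempty, so every leaf is a push-forward with zero sum and contributes only
    -- error.
    G-bound : ∀ P r S → Unique P → All (λ r′ → All (r′ ≢_) (r ∷ S)) P → All (r ≢_) S →
              All Prime P → All Prime (r ∷ S) → All (_∣ N) P → All (_∣ N) (r ∷ S) →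
              G P (r ∷ S) ≤ 2 ℕ.* Φ (r ∷ S) ℕ.* Φ P ℕ.* 2 ℕ.^ length P √ t
    G-bound [] r S _ _ r≢ _ primes _ rS∣N = ≡.subst₂ (λ a b → a ≤ b √ t) (≡.sym (G-[] (r ∷ S)))
      (simplify (2 ℕ.* Φ (r ∷ S)))
      (square≤⇒√ {b = 2 ℕ.* Φ (r ∷ S)}
        (trace-sum-bound (push-cs-admissible primes r≢ rS∣N) (ℕ.*-mono-< {0} {2} (ℕ.s≤s ℕ.z≤n) (0<Φ primes))))
      where
      simplify : ∀ n → n ≡ n ℕ.* 1 ℕ.* 1
      simplify = ℕSolver.solve-∀
    G-bound (r′ ∷ P) r S (r′≢P ∷ uniq) (r′≢rS ∷ P≢rS) r≢ (r′-prime ∷ P-primes) rS-primes (r′∣N ∷ P∣N) rS∣N =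
      ≡.subst₂ (λ a b → a ≤ b √ t) (≡.sym (G-∷ r′ P (r ∷ S)))
        (collect (ℕ.pred r′) (Φ (r ∷ S)) (Φ P) (2 ℕ.^ length P))
        (√-+ (√-* (ℕ.pred r′) (G-bound P r S uniq P≢rS r≢ P-primes rS-primes P∣N rS∣N))
             (√-neg {a = G P (r′ ∷ r ∷ S)} (G-bound P r′ (r ∷ S) uniq
               (All.zipWith (λ (r′≢ , ≢rS) → (r′≢ ∘ ≡.sym) ∷ ≢rS) (r′≢P , P≢rS))
               r′≢rS P-primes (r′-prime ∷ rS-primes) P∣N (r′∣N ∷ rS∣N))))
      where
      collect : ∀ a b c d → a ℕ.* (2 ℕ.* b ℕ.* c ℕ.* d) ℕ.+ 2 ℕ.* (a ℕ.* b) ℕ.* c ℕ.* d ≡ 2 ℕ.* b ℕ.*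
        (a ℕ.* c) ℕ.* (2 ℕ.* d)
      collect = ℕSolver.solve-∀

    -- The main term comes from the one branch that never picks a `c`. At its leaf a nonzero z has 1
    -- + c 2 z square roots: the 1 gives t, and `c 2` gives an error of at most √t. Each prime on
    -- the way adds one `G-bound` term.
    sieve-bound : 2 ∣ N → ∀ P → Unique P → All Prime P → All (_∣ N) P →
                  G P [] - + Φ P * + t ≤ Φ P ℕ.* mersenne (length P) √ t
    sieve-bound 2∣N [] _ _ _ = ≡.subst (_≤ 1 √ t) (≡.sym excess)
      (square≤⇒√ {b = 1} (trace-sum-bound (c-admissible prime[2] 2∣N) (ℕ.s≤s ℕ.z≤n)))
      where
      open ≡.≡-Reasoning
      split : ∀ z → push 2 u z * Y z ≡ Y z + c 2 z * Y z
      split z = begin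
        push 2 u z * Y z                           ≡⟨ cong (_* Y z) (push-u 2∣N z) ⟩
        + 2 * κ 2 z * Y z                          ≡⟨ expand (+ 2 * κ 2 z) (u z) (Y z) ⟩
        u z * Y z + c 2 z * Y z
          ≡⟨ cong (_+ c 2 z * Y z) (≡.trans (*-vanish-cong {Y} Y-0 z u-nonzero) (*-identityˡ (Y z))) ⟩
        Y z + c 2 z * Y z                          ∎
        where
        expand : ∀ a u y → a * y ≡ u * y + (a - u) * y
        expand = ℤSolver.solve-∀
      excess : G [] [] - 1ℤ * + t ≡ ∑ (λ z → c 2 z * Y z)
      excess = begin
        G [] [] - 1ℤ * + t
          ≡⟨ cong (_- 1ℤ * + t) (≡.trans (G-[] [])
          (≡.trans (∑-cong split) (∑-distrib-+ Y (λ z → c 2 z * Y z)))) ⟩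
        ∑ Y + ∑ (λ z → c 2 z * Y z) - 1ℤ * + t
          ≡⟨ cong (λ y → y + ∑ (λ z → c 2 z * Y z) - 1ℤ * + t) (tr-fibre β∈Fq) ⟩
        + t + ∑ (λ z → c 2 z * Y z) - 1ℤ * + t    ≡⟨ cancel (+ t) (∑ (λ z → c 2 z * Y z)) ⟩
        ∑ (λ z → c 2 z * Y z)                     ∎
        where
        cancel : ∀ t e → t + e - 1ℤ * t ≡ e
        cancel = ℤSolver.solve-∀
    sieve-bound 2∣N (r ∷ P) (r≢P ∷ uniq) (r-prime ∷ primes) (r∣N ∷ P∣N) =
      ≡.subst₂ (λ a b → a ≤ b √ t) (≡.sym difference)
        (collect (ℕ.pred r) (Φ P) (mersenne (length P)) (2 ℕ.^ length P))
        (√-+ (√-* (ℕ.pred r) (sieve-bound 2∣N P uniq primes P∣N))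
             (√-neg {a = G P (r ∷ [])} (G-bound P r [] uniq (All.map (λ r≢ → (r≢ ∘ ≡.sym) ∷ []) r≢P) [] primes
               (r-prime ∷ []) P∣N (r∣N ∷ []))))
      where
      collect : ∀ a c g d → a ℕ.* (c ℕ.* g) ℕ.+ 2 ℕ.* (a ℕ.* 1) ℕ.* c ℕ.* d ≡ a ℕ.* c ℕ.* (g ℕ.+ 2 ℕ.* d)
      collect = ℕSolver.solve-∀
      difference : G (r ∷ P) [] - + Φ (r ∷ P) * + t ≡ + ℕ.pred r * (G P [] - + Φ P * + t) + - G P (r ∷ [])
      difference = ≡.trans (cong₂ (λ g f → g - f * + t) (G-∷ r P []) (pos-* (ℕ.pred r) (Φ P)))
        (regroup (+ ℕ.pred r) (G P []) (G P (r ∷ [])) (+ Φ P) (+ t))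
        where
        regroup : ∀ a g h f t → a * g + - h - a * f * t ≡ a * (g - f * t) + - h
        regroup = ℤSolver.solve-∀

    -- Turns the length of a list into a sum over the field, to be compared with `G` term by term.
    multiplicity : List A → A → ℤ
    multiplicity []      ξ = 0ℤ
    multiplicity (x ∷ L) ξ = ⟦ ξ ≟ x ⟧ + multiplicity L ξ

    ∑-multiplicity : ∀ L → ∑ (multiplicity L) ≡ + length L
    ∑-multiplicity []      = ∑-zero (λ _ → ≡.refl)
    ∑-multiplicity (x ∷ L) = ≡.trans (∑-distrib-+ (λ ξ → ⟦ ξ ≟ x ⟧) (multiplicity L))
      (cong₂ _+_ (∑-⟦≟⟧ x) (∑-multiplicity L))

    ∉⇒multiplicity≡0 : ∀ L {ξ} → ¬ ξ ∈ L → multiplicity L ξ ≡ 0ℤ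
    ∉⇒multiplicity≡0 []          ξ∉ = ≡.refl
    ∉⇒multiplicity≡0 (x ∷ L) {ξ} ξ∉ = cong₂ _+_ (⟦⟧-no (ξ ≟ x) (ξ∉ ∘ here)) (∉⇒multiplicity≡0 L (ξ∉ ∘ there))

    ∈⇒multiplicity≡1 : ∀ {L} → Unique L → ∀ {ξ} → ξ ∈ L → multiplicity L ξ ≡ 1ℤ
    ∈⇒multiplicity≡1 {x ∷ L} (x≢ ∷ _) {ξ} (here ≡.refl) =
      cong₂ _+_ (⟦⟧-yes (ξ ≟ x) ≡.refl) (∉⇒multiplicity≡0 L (λ ξ∈L → All.lookup x≢ ξ∈L ≡.refl))
    ∈⇒multiplicity≡1 {x ∷ L} (x≢ ∷ uniq) {ξ} (there ξ∈L) =
      cong₂ _+_ (⟦⟧-no (ξ ≟ x) (λ ξ≡x → All.lookup x≢ ξ∈L (≡.sym ξ≡x))) (∈⇒multiplicity≡1 uniq ξ∈L)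

    NonResidue : List ℕ → A → Set
    NonResidue P ξ = All (λ r → ξ ^ cofactor r ≢ 1#) P

    NonResidue? : ∀ P ξ → Dec (NonResidue P ξ)
    NonResidue? P ξ = All.all? (λ r → ¬? (ξ ^ cofactor r ≟ 1#)) P

    weight-nonresidue : ∀ {P ξ} → All Prime P → ξ ≢ 0# → NonResidue P ξ → weight P ξ ≡ + product P
    weight-nonresidue [] _ [] = ≡.refl
    weight-nonresidue {r ∷ P} {ξ} (r-prime ∷ primes) ξ≢0 (≢1 ∷ rest) =
      ≡.trans (cong₂ _*_ factor (weight-nonresidue primes ξ≢0 rest)) (≡.sym (pos-* r (product P)))
      where
      simplify : ∀ r → r - 1ℤ - (r * 0ℤ - 1ℤ) ≡ r
      simplify = ℤSolver.solve-∀
      factor : + ℕ.pred r - c r ξ ≡ + r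
      factor = ≡.trans (cong₂ _-_ (+pred+1 r-prime)
        (cong₂ (λ a b → + r * a - b) (⟦⟧-no (ξ ^ cofactor r ≟ 1#) ≢1) (u-nonzero ξ≢0))) (simplify (+ r))

    weight-residue : ∀ {P ξ} → All Prime P → ξ ≢ 0# → ¬ NonResidue P ξ → weight P ξ ≡ 0ℤ
    weight-residue {[]} _ _ ¬nr = contradiction [] ¬nr
    weight-residue {r ∷ P} {ξ} (r-prime ∷ primes) ξ≢0 ¬nr with ξ ^ cofactor r ≟ 1#
    ... | yes ≡1 = cong (_* weight P ξ)
      (≡.trans (cong₂ _-_ (+pred+1 r-prime) (cong (λ b → + r * 1ℤ - b) (u-nonzero ξ≢0))) (simplify (+ r)))
      where
      simplify : ∀ r → r - 1ℤ - (r * 1ℤ - 1ℤ) ≡ 0ℤ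
      simplify = ℤSolver.solve-∀
    ... | no ≢1 = ≡.trans (cong (λ w → (+ ℕ.pred r - (+ r * 0ℤ - u ξ)) * w)
      (weight-residue primes ξ≢0 (λ nr → ¬nr (≢1 ∷ nr)))) (*-zeroʳ (+ ℕ.pred r - (+ r * 0ℤ - u ξ)))

    G-count : ∀ {P L} → All Prime P → Unique L →
              (∀ ξ → (ξ ∈ L) ⇔ (ξ ≢ 0# × NonResidue P ξ × tr (ξ ^ 2) ≡ β)) → G P [] ≡ + product P * + length L
    G-count {P} {L} primes uniq iff =
      ≡.trans (∑-cong (λ ξ → pointwise ξ (ξ ≟ 0#) (NonResidue? P ξ) (tr (ξ ^ 2) ≟ β)))
      (≡.trans (≡.sym (*-distribˡ-∑ (+ product P) (multiplicity L)))
        (cong (+ product P *_) (∑-multiplicity L)))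
      where
      outside : ∀ {ξ a} → a ≡ 0ℤ → ¬ (ξ ≢ 0# × NonResidue P ξ × tr (ξ ^ 2) ≡ β)
        → a ≡ + product P * multiplicity L ξ
      outside {ξ} a≡0 ¬h = ≡.trans a≡0
        (≡.sym (≡.trans (cong (+ product P *_) (∉⇒multiplicity≡0 L (¬h ∘ Equivalence.to (iff ξ))))
        (*-zeroʳ (+ product P))))
      pointwise : ∀ ξ → Dec (ξ ≡ 0#) → Dec (NonResidue P ξ) → Dec (tr (ξ ^ 2) ≡ β) →
                  u ξ * weight P ξ * Y (ξ ^ 2) ≡ + product P * multiplicity L ξ
      pointwise ξ (yes ξ≡0) _ _ = outside (cong (λ a → a * weight P ξ * Y (ξ ^ 2)) (≡.trans (cong u ξ≡0) u-0))
        (λ h → proj₁ h ξ≡0)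
      pointwise ξ (no ξ≢0) (no ¬nr) _ =
        outside (≡.trans (cong (λ w → u ξ * w * Y (ξ ^ 2)) (weight-residue primes ξ≢0 ¬nr))
        (cong (_* Y (ξ ^ 2)) (*-zeroʳ (u ξ)))) (λ h → ¬nr (proj₁ (proj₂ h)))
      pointwise ξ (no ξ≢0) (yes nr) (no ≢β) =
        outside (≡.trans (cong (u ξ * weight P ξ *_) (⟦⟧-no (tr (ξ ^ 2) ≟ β) ≢β))
        (*-zeroʳ (u ξ * weight P ξ))) (λ h → ≢β (proj₂ (proj₂ h)))
      pointwise ξ (no ξ≢0) (yes nr) (yes ≡β) = begin
        u ξ * weight P ξ * Y (ξ ^ 2)  ≡⟨ cong₂ _*_
          (cong₂ _*_ (u-nonzero ξ≢0) (weight-nonresidue primes ξ≢0 nr)) (⟦⟧-yes (tr (ξ ^ 2) ≟ β) ≡β) ⟩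
        1ℤ * + product P * 1ℤ         ≡⟨ cong (_* 1ℤ) (*-identityˡ (+ product P)) ⟩
        + product P * 1ℤ              ≡⟨ cong (+ product P *_)
          (∈⇒multiplicity≡1 uniq (Equivalence.from (iff ξ) (ξ≢0 , nr , ≡β))) ⟨
        + product P * multiplicity L ξ ∎
        where open ≡.≡-Reasoning

  -- Prime divisors and monotonicity of `W`.

  Unique-⊆-length : ∀ {A : Set} {xs ys : List A} → Unique xs → (∀ {x} → x ∈ xs → x ∈ ys)
    → length xs ℕ.≤ length ys
  Unique-⊆-length {xs = []} _ _ = ℕ.z≤n
  Unique-⊆-length {xs = x ∷ xs} (x≢ ∷ uniq) xs⊆ys with ∈-∃++ (xs⊆ys (here ≡.refl))
  ... | as , bs , ≡.refl = ℕ.≤-trans (ℕ.s≤s (Unique-⊆-length uniq without-x))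
    (ℕ.≤-reflexive (≡.sym (length-++-sucʳ as x bs)))
    where
    without-x : ∀ {y} → y ∈ xs → y ∈ as ++ bs
    without-x y∈xs with ∈-++⁻ as (xs⊆ys (there y∈xs))
    ... | inj₁ y∈as          = ∈-++⁺ˡ y∈as
    ... | inj₂ (here ≡.refl) = contradiction ≡.refl (All.lookup x≢ y∈xs)
    ... | inj₂ (there y∈bs)  = ∈-++⁺ʳ as y∈bs

  prime-divisor : ∀ n .{{_ : ℕ.NonZero n}} → n ≢ 1 → ∃ λ r → Prime r × r ∣ n
  prime-divisor n n≢1 with factorise n
  ... | record { factors = [] ; isFactorisation = n≡1 } = contradiction n≡1 n≢1
  ... | record { factors = r ∷ rs ; isFactorisation = n≡ ; factorsPrime = r-prime ∷ _ } =
    r , r-prime , ≡.subst (r ∣_) (≡.sym n≡) (m∣m*n (product rs))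

  module _ (m : ℕ) where

    primeDivisors-unique : Unique (primeDivisors m)
    primeDivisors-unique = Unique.filter⁺ (λ p → prime? p ×-dec (p ∣? m)) (Unique.upTo⁺ (suc m))

    private
      primeDivisors-all : All (λ r → Prime r × r ∣ m) (primeDivisors m)
      primeDivisors-all = All.all-filter (λ p → prime? p ×-dec (p ∣? m)) (upTo (suc m))

    primeDivisors-prime : All Prime (primeDivisors m)
    primeDivisors-prime = All.map proj₁ primeDivisors-all

    primeDivisors-∣ : All (_∣ m) (primeDivisors m)
    primeDivisors-∣ = All.map proj₂ primeDivisors-all

    ∈-primeDivisors : .{{_ : ℕ.NonZero m}} → ∀ {r} → Prime r → r ∣ m → r ∈ primeDivisors m
    ∈-primeDivisors r-prime r∣m = ∈-filter⁺ (λ p → prime? p ×-dec (p ∣? m)) (∈-upTo⁺ (ℕ.s≤s (∣⇒≤ r∣m)))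
      (r-prime , r∣m)

  W-mono : ∀ {m m′} → (∀ {r} → Prime r → r ∣ m → r ∈ primeDivisors m′) → W m ℕ.≤ W m′
  W-mono {m} {m′} h = ℕ.^-monoʳ-≤ 2 (Unique-⊆-length (primeDivisors-unique m)
    (λ r∈ → h (All.lookup (primeDivisors-prime m) r∈) (All.lookup (primeDivisors-∣ m) r∈)))

  W-∣ : ∀ {m m′} .{{_ : ℕ.NonZero m′}} → m ∣ m′ → W m ℕ.≤ W m′
  W-∣ {m} {m′} m∣m′ = W-mono {m} {m′} (λ r-prime r∣m → ∈-primeDivisors m′ r-prime (∣-trans r∣m m∣m′))

  -- A prime dividing a product of primes is one of them, so the primes of `mQ m Q` occur among
  -- those of m.
  W-mQ : ∀ m Q → W (mQ m Q) ℕ.≤ W m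
  W-mQ m Q = W-mono {mQ m Q} {m} (λ r-prime r∣ → proj₁ (∈-filter⁻ (_∣? Q)
    (factorisationHasAllPrimeFactors r-prime r∣ (All.filter⁺ (_∣? Q) (primeDivisors-prime m)))))

  distinct-primes-∣ : ∀ {p r n} → Prime p → Prime r → p ≢ r → r ∣ p ℕ.* n → r ∣ n
  distinct-primes-∣ {p} {r} {n} p-prime r-prime p≢r r∣pn with euclidsLemma p n r-prime r∣pn
  ... | inj₂ r∣n = r∣n
  ... | inj₁ r∣p with prime⇒irreducible p-prime r∣p
  ...   | inj₁ r≡1 = contradiction (≡.subst Prime r≡1 r-prime) ¬prime[1]
  ...   | inj₂ r≡p = contradiction (≡.sym r≡p) p≢r

  product-∣ : ∀ {P m} → Unique P → All Prime P → All (_∣ m) P → product P ∣ m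
  product-∣ [] [] [] = 1∣ _
  product-∣ {p ∷ P} (p≢ ∷ uniq) (p-prime ∷ primes) (divides m′ ≡.refl ∷ P∣m) =
    ≡.subst (p ℕ.* product P ∣_) (ℕ.*-comm p m′) (*-monoʳ-∣ p (product-∣ uniq primes
      (All.zipWith (λ {r} ((p≢r , r-prime) , r∣m) → distinct-primes-∣ p-prime r-prime p≢r
        (≡.subst (r ∣_) (ℕ.*-comm m′ p) r∣m)) (All.zip (p≢ , primes) , P∣m))))

  -- Euler's product formula.

  ∑₁ : (ℕ → ℤ) → ℕ → ℤ
  ∑₁ g zero    = 0ℤ
  ∑₁ g (suc n) = ∑₁ g n + g (suc n)

  ∑₁-cong : ∀ {f g} → (∀ k → f k ≡ g k) → ∀ n → ∑₁ f n ≡ ∑₁ g n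
  ∑₁-cong h zero    = ≡.refl
  ∑₁-cong h (suc n) = cong₂ _+_ (∑₁-cong h n) (h (suc n))

  ∑₁-distrib-+ : ∀ f g n → ∑₁ (λ k → f k + g k) n ≡ ∑₁ f n + ∑₁ g n
  ∑₁-distrib-+ f g zero    = ≡.refl
  ∑₁-distrib-+ f g (suc n) = ≡.trans (cong (_+ (f (suc n) + g (suc n))) (∑₁-distrib-+ f g n))
    (regroup (∑₁ f n) (∑₁ g n) (f (suc n)) (g (suc n)))
    where
    regroup : ∀ a b c d → a + b + (c + d) ≡ a + c + (b + d)
    regroup = ℤSolver.solve-∀

  ∑₁-1 : ∀ n → ∑₁ (λ _ → 1ℤ) n ≡ + n
  ∑₁-1 zero    = ≡.refl
  ∑₁-1 (suc n) = ≡.trans (cong (_+ 1ℤ) (∑₁-1 n)) (cong +_ (ℕ.+-comm n 1))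

  ∑₁-split : ∀ g a b → ∑₁ g (a ℕ.+ b) ≡ ∑₁ g a + ∑₁ (λ k → g (a ℕ.+ k)) b
  ∑₁-split g a zero    = ≡.trans (cong (∑₁ g) (ℕ.+-identityʳ a)) (≡.sym (+-identityʳ (∑₁ g a)))
  ∑₁-split g a (suc b) = ≡.trans (cong (∑₁ g) (ℕ.+-suc a b))
    (≡.trans (cong₂ _+_ (∑₁-split g a b) (cong g (≡.sym (ℕ.+-suc a b)))) (+-assoc (∑₁ g a) _ _))

  ∑₁-zero : ∀ g n → (∀ k → 0 ℕ.< k → k ℕ.≤ n → g k ≡ 0ℤ) → ∑₁ g n ≡ 0ℤ
  ∑₁-zero g zero    h = ≡.refl
  ∑₁-zero g (suc n) h = cong₂ _+_ (∑₁-zero g n (λ k 0<k k≤n → h k 0<k (ℕ.m≤n⇒m≤1+n k≤n)))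
    (h (suc n) (ℕ.s≤s ℕ.z≤n) ℕ.≤-refl)

  -- Cut the range into blocks of p consecutive integers; only the last one in each block is
  -- divisible by p.
  ∑₁-multiples : ∀ p .{{_ : ℕ.NonZero p}} (g : ℕ → ℤ) d → ∑₁ (λ k → ⟦ p ∣? k ⟧ * g k) (p ℕ.* d) ≡ ∑₁
    (λ j → g (p ℕ.* j)) d
  ∑₁-multiples p@(suc p-1) g zero = cong (∑₁ (λ k → ⟦ p ∣? k ⟧ * g k)) (ℕ.*-zeroʳ p)
  ∑₁-multiples p@(suc p-1) g (suc d) = begin
    ∑₁ h (p ℕ.* suc d)
      ≡⟨ cong (∑₁ h) (≡.trans (ℕ.*-suc p d) (ℕ.+-comm p (p ℕ.* d))) ⟩
    ∑₁ h (p ℕ.* d ℕ.+ p)                        ≡⟨ ∑₁-split h (p ℕ.* d) p ⟩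
    ∑₁ h (p ℕ.* d) + (∑₁ (λ k → h (p ℕ.* d ℕ.+ k)) p-1 + h (p ℕ.* d ℕ.+ p))
      ≡⟨ cong₂ (λ a b → a + b) (∑₁-multiples p g d) (cong₂ _+_ (∑₁-zero _ p-1 between) last) ⟩
    ∑₁ (λ j → g (p ℕ.* j)) d + (0ℤ + g (p ℕ.* suc d))
      ≡⟨ cong (λ e → ∑₁ (λ j → g (p ℕ.* j)) d + e) (+-identityˡ _) ⟩
    ∑₁ (λ j → g (p ℕ.* j)) d + g (p ℕ.* suc d)  ∎
    where
    open ≡.≡-Reasoning
    h : ℕ → ℤ
    h k = ⟦ p ∣? k ⟧ * g k
    between : ∀ k → 0 ℕ.< k → k ℕ.≤ p-1 → h (p ℕ.* d ℕ.+ k) ≡ 0ℤ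
    between k 0<k k≤ = cong (_* g (p ℕ.* d ℕ.+ k)) (⟦⟧-no (p ∣? (p ℕ.* d ℕ.+ k))
      (λ p∣ → ℕ.<⇒≱ (ℕ.s≤s k≤) (∣⇒≤ {{ℕ.>-nonZero 0<k}} (∣m+n∣m⇒∣n p∣ (m∣m*n d)))))
    last : h (p ℕ.* d ℕ.+ p) ≡ g (p ℕ.* suc d)
    last = ≡.trans (cong h (≡.trans (ℕ.+-comm (p ℕ.* d) p) (≡.sym (ℕ.*-suc p d))))
      (≡.trans (cong (_* g (p ℕ.* suc d)) (⟦⟧-yes (p ∣? (p ℕ.* suc d)) (m∣m*n (suc d))))
        (*-identityˡ (g (p ℕ.* suc d))))

  length-filter-∑₁ : ∀ {Q : ℕ → Set} (Q? : Decidable Q) n → + length (filter Q? (map suc (upTo n))) ≡ ∑₁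
    (λ k → ⟦ Q? k ⟧) n
  length-filter-∑₁ Q? n = ≡.trans (cong (λ l → + length (filter Q? l)) (map-upTo suc n)) (go n)
    where
    open ≡.≡-Reasoning
    single : ∀ k → + length (filter Q? [ k ]) ≡ ⟦ Q? k ⟧
    single k with Q? k
    ... | yes _ = ≡.refl
    ... | no _  = ≡.refl
    go : ∀ n → + length (filter Q? (applyUpTo suc n)) ≡ ∑₁ (λ k → ⟦ Q? k ⟧) n
    go zero    = ≡.refl
    go (suc n) = begin
      + length (filter Q? (applyUpTo suc (suc n)))
        ≡⟨ cong (λ l → + length (filter Q? l)) (applyUpTo-∷ʳ suc n) ⟨
      + length (filter Q? (applyUpTo suc n ∷ʳ suc n))
        ≡⟨ cong (λ l → + length l) (filter-++ Q? (applyUpTo suc n) [ suc n ]) ⟩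
      + length (filter Q? (applyUpTo suc n) ++ filter Q? [ suc n ])
        ≡⟨ cong +_ (length-++ (filter Q? (applyUpTo suc n))) ⟩
      + length (filter Q? (applyUpTo suc n)) + + length (filter Q? [ suc n ])
        ≡⟨ cong₂ _+_ (go n) (single (suc n)) ⟩
      ∑₁ (λ k → ⟦ Q? k ⟧) n + ⟦ Q? (suc n) ⟧                          ∎

  unsifted : List ℕ → ℕ → ℤ
  unsifted []      k = 1ℤ
  unsifted (p ∷ P) k = (1ℤ - ⟦ p ∣? k ⟧) * unsifted P k

  unsifted-* : ∀ {p P} → Prime p → All Prime P → All (p ≢_) P → ∀ k → unsifted P (p ℕ.* k) ≡ unsifted P k
  unsifted-* p-prime [] [] k = ≡.refl
  unsifted-* {p} {r ∷ P} p-prime (r-prime ∷ primes) (p≢r ∷ p≢) k = cong₂ (λ a b → (1ℤ - a) * b)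
    (⟦⟧-cong (r ∣? (p ℕ.* k)) (r ∣? k) (distinct-primes-∣ p-prime r-prime p≢r) (∣n⇒∣m*n p))
      (unsifted-* p-prime primes p≢ k)

  -- Sifting by p removes the terms at p j, and there the remaining conditions depend on j alone.
  -- The number d of periods is general because the induction is used twice: with d p periods for
  -- all k, with d periods for the multiples of p.
  ∑₁-unsifted : ∀ {P} → Unique P → All Prime P → ∀ d →
                ∑₁ (unsifted P) (d ℕ.* product P) * + product P ≡ + (d ℕ.* product P) * + Φ P
  ∑₁-unsifted [] [] d = cong (_* 1ℤ) (∑₁-1 (d ℕ.* 1))
  ∑₁-unsifted {p ∷ P} (p≢ ∷ uniq) (p-prime ∷ primes) d = begin
    ∑₁ (unsifted (p ∷ P)) M * + (p ℕ.* r)              ≡⟨ cong₂ _*_ removed (pos-* p r) ⟩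
    (∑₁ (unsifted P) M - ∑₁ (unsifted P) (d ℕ.* r)) * (+ p * + r)
      ≡⟨ expand (∑₁ (unsifted P) M) (∑₁ (unsifted P) (d ℕ.* r)) (+ p) (+ r) ⟩
    + p * (∑₁ (unsifted P) M * + r) - + p * (∑₁ (unsifted P) (d ℕ.* r) * + r)
      ≡⟨ cong₂ (λ a b → + p * a - + p * b) at-M (∑₁-unsifted uniq primes d) ⟩
    + p * (+ M * + Φ P) - + p * (+ (d ℕ.* r) * + Φ P)
      ≡⟨ cong (λ e → + p * (+ M * + Φ P) - e) (≡.sym (*-assoc (+ p) (+ (d ℕ.* r)) (+ Φ P))) ⟩
    + p * (+ M * + Φ P) - + p * + (d ℕ.* r) * + Φ P
      ≡⟨ cong (λ e → + p * (+ M * + Φ P) - e * + Φ P)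
      (≡.trans (≡.sym (pos-* p (d ℕ.* r))) (cong +_ (≡.sym M≡p*dr))) ⟩
    + p * (+ M * + Φ P) - + M * + Φ P                  ≡⟨ collect (+ p) (+ M) (+ Φ P) ⟩
    + M * ((+ p - 1ℤ) * + Φ P)                         ≡⟨ cong (λ e → + M * (e * + Φ P)) (+pred+1 p-prime) ⟨
    + M * (+ ℕ.pred p * + Φ P)                         ≡⟨ cong (+ M *_) (pos-* (ℕ.pred p) (Φ P)) ⟨
    + M * + Φ (p ∷ P)                                  ∎
    where
    open ≡.≡-Reasoning
    r = product P
    M = d ℕ.* (p ℕ.* r)
    instance _ = prime⇒nonZero p-prime
    expand : ∀ a b p r → (a - b) * (p * r) ≡ p * (a * r) - p * (b * r)
    expand = ℤSolver.solve-∀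
    collect : ∀ p m f → p * (m * f) - m * f ≡ m * ((p - 1ℤ) * f)
    collect = ℤSolver.solve-∀
    M≡p*dr : M ≡ p ℕ.* (d ℕ.* r)
    M≡p*dr = ≡.trans (≡.sym (ℕ.*-assoc d p r)) (≡.trans (cong (ℕ._* r) (ℕ.*-comm d p)) (ℕ.*-assoc p d r))
    at-M : ∑₁ (unsifted P) M * + r ≡ + M * + Φ P
    at-M = ≡.subst (λ M → ∑₁ (unsifted P) M * + r ≡ + M * + Φ P) (ℕ.*-assoc d p r)
      (∑₁-unsifted uniq primes (d ℕ.* p))
    removed : ∑₁ (unsifted (p ∷ P)) M ≡ ∑₁ (unsifted P) M - ∑₁ (unsifted P) (d ℕ.* r)
    removed = begin
      ∑₁ (unsifted (p ∷ P)) M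
        ≡⟨ add-sub (∑₁ (unsifted (p ∷ P)) M) (∑₁ (λ k → ⟦ p ∣? k ⟧ * unsifted P k) M) ⟩
      ∑₁ (unsifted (p ∷ P)) M + ∑₁ (λ k → ⟦ p ∣? k ⟧ * unsifted P k) M - ∑₁
        (λ k → ⟦ p ∣? k ⟧ * unsifted P k) M
        ≡⟨ cong₂ _-_ (≡.trans (≡.sym (∑₁-distrib-+ (unsifted (p ∷ P)) (λ k → ⟦ p ∣? k ⟧ * unsifted P k) M))
          (∑₁-cong (λ k → partition ⟦ p ∣? k ⟧ (unsifted P k)) M))
                     (≡.trans (cong (∑₁ (λ k → ⟦ p ∣? k ⟧ * unsifted P k)) M≡p*dr)
                       (≡.trans (∑₁-multiples p (unsifted P) (d ℕ.* r))
                       (∑₁-cong (unsifted-* p-prime primes p≢) (d ℕ.* r)))) ⟩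
      ∑₁ (unsifted P) M - ∑₁ (unsifted P) (d ℕ.* r) ∎
      where
      add-sub : ∀ a b → a ≡ a + b - b
      add-sub = ℤSolver.solve-∀
      partition : ∀ i w → (1ℤ - i) * w + i * w ≡ w
      partition = ℤSolver.solve-∀

  unsifted-coprime : ∀ P {k} → All (λ r → ¬ r ∣ k) P → unsifted P k ≡ 1ℤ
  unsifted-coprime [] [] = ≡.refl
  unsifted-coprime (r ∷ P) {k} (r∤k ∷ rest) =
    cong₂ (λ a b → (1ℤ - a) * b) (⟦⟧-no (r ∣? k) r∤k) (unsifted-coprime P rest)

  unsifted-divisible : ∀ P {k r} → r ∈ P → r ∣ k → unsifted P k ≡ 0ℤ
  unsifted-divisible (p ∷ P) {k} (here ≡.refl) p∣k =
    cong (λ a → (1ℤ - a) * unsifted P k) (⟦⟧-yes (p ∣? k) p∣k)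
  unsifted-divisible (p ∷ P) {k} (there r∈P) r∣k =
    ≡.trans (cong ((1ℤ - ⟦ p ∣? k ⟧) *_) (unsifted-divisible P r∈P r∣k)) (*-zeroʳ (1ℤ - ⟦ p ∣? k ⟧))

  gcd-unsifted : ∀ m .{{_ : ℕ.NonZero m}} k → ⟦ gcd k m ℕ.≟ 1 ⟧ ≡ unsifted (primeDivisors m) k
  gcd-unsifted m k with gcd k m ℕ.≟ 1
  ... | yes gcd≡1 = ≡.sym (unsifted-coprime (primeDivisors m) (All.zipWith
          (λ {r} (r-prime , r∣m) r∣k → ¬prime[1]
            (≡.subst Prime (∣1⇒≡1 (≡.subst (r ∣_) gcd≡1 (gcd-greatest r∣k r∣m))) r-prime))
          (primeDivisors-prime m , primeDivisors-∣ m)))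
  ... | no gcd≢1 with prime-divisor (gcd k m) {{ℕ.≢-nonZero (gcd[m,n]≢0 k m (inj₂ (ℕ.≢-nonZero⁻¹ m)))}} gcd≢1
  ...   | r , r-prime , r∣gcd = ≡.sym (unsifted-divisible (primeDivisors m)
          (∈-primeDivisors m r-prime (∣-trans r∣gcd (gcd[m,n]∣n k m))) (∣-trans r∣gcd (gcd[m,n]∣m k m)))

  -- φ(m)/m is the product of (1 - 1/p), with denominators cleared. The range up to m consists of
  -- whole periods because the product of the primes of m divides m.
  φ-formula : ∀ m .{{_ : ℕ.NonZero m}} → φ m ℕ.* product (primeDivisors m) ≡ m ℕ.* Φ (primeDivisors m)
  φ-formula m with product-∣ (primeDivisors-unique m) (primeDivisors-prime m) (primeDivisors-∣ m)
  ... | divides d m≡ = +-injective (begin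
    + (φ m ℕ.* product P)                ≡⟨ pos-* (φ m) (product P) ⟩
    + φ m * + product P
      ≡⟨ cong (_* + product P) (≡.trans (length-filter-∑₁ (λ k → gcd k m ℕ.≟ 1) m)
      (∑₁-cong (gcd-unsifted m) m)) ⟩
    ∑₁ (unsifted P) m * + product P
      ≡⟨ ≡.subst (λ M → ∑₁ (unsifted P) M * + product P ≡ + M * + Φ P) (≡.sym m≡)
                                              (∑₁-unsifted (primeDivisors-unique m)
                                                (primeDivisors-prime m) d) ⟩
    + m * + Φ P                          ≡⟨ pos-* m (Φ P) ⟨
    + (m ℕ.* Φ P)                        ∎)
    where
    open ≡.≡-Reasoning
    P = primeDivisors m

  -- Translation into the integer form of the statement.

  √-cancel : ∀ {t} r .{{_ : ℕ.NonZero r}} {a b} → + r * a ≤ r ℕ.* b √ t → a ≤ b √ t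
  √-cancel {t} r {a} {b} (bounded h) = bounded (ℕ.*-cancelˡ-≤ (r ℕ.* r) {{ℕ.m*n≢0 r r}}
    (≡.subst₂ ℕ._≤_ (≡.trans (cong₂ ℕ._*_ (abs-* (+ r) a) (abs-* (+ r) a)) (regroup r ∣ a ∣))
      (regroup′ r b t) h))
    where
    regroup : ∀ r a → r ℕ.* a ℕ.* (r ℕ.* a) ≡ r ℕ.* r ℕ.* (a ℕ.* a)
    regroup = ℕSolver.solve-∀
    regroup′ : ∀ r b t → r ℕ.* b ℕ.* (r ℕ.* b) ℕ.* t ≡ r ℕ.* r ℕ.* (b ℕ.* b ℕ.* t)
    regroup′ = ℕSolver.solve-∀

  √⇒square≤ : ∀ {a b t} → a ≤ b √ t → a * a ≤ + b * + b * + t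
  √⇒square≤ {a} {b} {t} (bounded h) = ≡.subst₂ _≤_ (≡.sym (square-abs a))
    (≡.trans (pos-* (b ℕ.* b) t) (cong (_* + t) (pos-* b b))) (+≤+ h)

  √-mono : ∀ {a b b′ t} → b ℕ.≤ b′ → a ≤ b √ t → a ≤ b′ √ t
  √-mono {t = t} b≤b′ (bounded h) = bounded (ℕ.≤-trans h (ℕ.*-monoˡ-≤ t (ℕ.*-mono-≤ b≤b′ b≤b′)))

  -- The coefficient -b is not positive, so comparing squares suffices whatever the sign of a.
  √⇒GeMulSqrt : ∀ {a b t} → a ≤ b √ t → GeMulSqrt a (- + b) t
  √⇒GeMulSqrt {a} {b} {t} a≤ = inj₁
    (neg-mono-≤ (+≤+ {0} {b} ℕ.z≤n) , inj₂
    (≤-trans (√⇒square≤ a≤) (≤-reflexive (cong (_* + t) (neg-square (+ b))))))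
    where
    neg-square : ∀ b → b * b ≡ - b * - b
    neg-square = ℤSolver.solve-∀

  parity : ∀ n → (2 ∣ n) ⊎ (2 ∣ suc n)
  parity zero    = inj₁ (2 ∣0)
  parity (suc n) with parity n
  ... | inj₁ 2∣n   = inj₂ (∣m∣n⇒∣m+n (∣-refl {2}) 2∣n)
  ... | inj₂ 2∣1+n = inj₁ 2∣1+n

  prime∣^⇒∣ : ∀ {p} m n → Prime p → p ∣ m ℕ.^ n → p ∣ m
  prime∣^⇒∣ m zero    p-prime p∣1 = contradiction (≡.subst Prime (∣1⇒≡1 p∣1) p-prime) ¬prime[1]
  prime∣^⇒∣ m (suc n) p-prime p∣  =
    [ (λ p∣m → p∣m) , prime∣^⇒∣ m n p-prime ]′ (euclidsLemma m (m ℕ.^ n) p-prime p∣)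

  d∣[1+d]^n∸1 : ∀ d n → d ∣ suc d ℕ.^ n ℕ.∸ 1
  d∣[1+d]^n∸1 d n with power n
    where
    power : ∀ n → ∃ λ c → suc d ℕ.^ n ≡ 1 ℕ.+ c ℕ.* d
    power zero    = 0 , ≡.refl
    power (suc n) with power n
    ... | c , eq = suc d ℕ.* c ℕ.+ 1 , ≡.trans (cong (suc d ℕ.*_) eq) (expand c d)
      where
      expand : ∀ c d → (1 ℕ.+ d) ℕ.* (1 ℕ.+ c ℕ.* d) ≡ 1 ℕ.+ ((1 ℕ.+ d) ℕ.* c ℕ.+ 1) ℕ.* d
      expand = ℕSolver.solve-∀
  ... | c , eq = divides c (cong (ℕ._∸ 1) eq)

  -- q - 1 divides q^n - 1, so the integer division in `Qof` is exact.
  Qof-∣ : ∀ q n → 1 ℕ.< q → Qof q n ∣ q ℕ.^ n ℕ.∸ 1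
  Qof-∣ (suc (suc d)) n _ = divides (suc d)
    (≡.trans (≡.sym (m/n*n≡m (d∣[1+d]^n∸1 (suc d) n))) (ℕ.*-comm _ (suc d)))
  Qof-∣ (suc zero) n (ℕ.s≤s ())

  4W≡ : ∀ m {w} → w ℕ.≤ W m → ∃ λ K → 4 ℕ.* W m ≡ 2 ℕ.* w ℕ.+ (1 ℕ.+ K) × mersenne (ν m) ℕ.≤ K
  4W≡ m {w} w≤W with ℕ.m≤n⇒∃[o]m+o≡n w≤W
  ... | e , w+e≡W = 2 ℕ.* e ℕ.+ M , (begin
    4 ℕ.* W m                         ≡⟨ split (W m) ⟩
    2 ℕ.* W m ℕ.+ 2 ℕ.* W m
      ≡⟨ cong₂ (λ a b → 2 ℕ.* a ℕ.+ b) (≡.sym w+e≡W) (≡.sym (suc-mersenne (ν m))) ⟩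
    2 ℕ.* (w ℕ.+ e) ℕ.+ (1 ℕ.+ M)     ≡⟨ regroup w e M ⟩
    2 ℕ.* w ℕ.+ (1 ℕ.+ (2 ℕ.* e ℕ.+ M)) ∎) , ℕ.m≤n+m M (2 ℕ.* e)
    where
    open ≡.≡-Reasoning
    M = mersenne (ν m)
    split : ∀ w → 4 ℕ.* w ≡ 2 ℕ.* w ℕ.+ 2 ℕ.* w
    split = ℕSolver.solve-∀
    regroup : ∀ w e M → 2 ℕ.* (w ℕ.+ e) ℕ.+ (1 ℕ.+ M) ≡ 2 ℕ.* w ℕ.+ (1 ℕ.+ (2 ℕ.* e ℕ.+ M))
    regroup = ℕSolver.solve-∀

  0<φ : ∀ m .{{_ : ℕ.NonZero m}} → 0 ℕ.< φ m
  0<φ m = ℕ.n≢0⇒n>0 (λ φ≡0 → ℕ.<⇒≢ (ℕ.*-mono-< (ℕ.>-nonZero⁻¹ m) (0<Φ (primeDivisors-prime m)))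
    (≡.trans (cong (ℕ._* product (primeDivisors m)) (≡.sym φ≡0)) (φ-formula m)))

  -- From the sieve to free elements.

  module Main {p k q n′ : ℕ} (p-prime : Prime p) (1≤k : 1 ℕ.≤ k) (q≡p^k : q ≡ p ℕ.^ k)
              (F : FiniteField (q ℕ.^ suc n′))
              {β : FiniteField.Carrier F} (β∈Fq : InSubfield F q β) (β≢0 : β ≢ FiniteField.0# F) where

    open Field F
    open PositiveDefiniteness F using (0<N)
    open PowerResidues F
    open Sieve {n′ = n′} p-prime 1≤k q≡p^k F β∈Fq β≢0 public

    ∣N⇒nonZero : ∀ {m} → m ∣ N → ℕ.NonZero m
    ∣N⇒nonZero m∣N = ℕ.≢-nonZero (λ { ≡.refl → ℕ.<⇒≢ 0<N (≡.sym (0∣⇒≡0 m∣N)) })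

    -- Primes suffice: if ξ = ζ^d with d ≠ 1 and r is a prime factor of d, then ξ is already an r-th
    -- power.
    free⇔nonresidue : ∀ {m} → m ∣ N → ∀ ξ → IsFree F m ξ ⇔ NonResidue (primeDivisors m) ξ
    free⇔nonresidue {m} m∣N ξ = mk⇔ free⇒ ⇒free
      where
      instance _ = ∣N⇒nonZero m∣N
      free⇒ : IsFree F m ξ → NonResidue (primeDivisors m) ξ
      free⇒ free = All.zipWith (λ (r-prime , r∣m) ≡1 →
        let ζ , ζ≢0 , ξ≡ζ^r = power-residue (∣-trans r∣m m∣N) ≡1
        in ¬prime[1] (≡.subst Prime (free _ ζ r∣m ζ≢0 ξ≡ζ^r) r-prime))
          (primeDivisors-prime m , primeDivisors-∣ m)
      ⇒free : NonResidue (primeDivisors m) ξ → IsFree F m ξ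
      ⇒free nr d ζ d∣m ζ≢0 ξ≡ζ^d with d ℕ.≟ 1
      ... | yes d≡1 = d≡1
      ... | no d≢1 with prime-divisor d {{∣N⇒nonZero (∣-trans d∣m m∣N)}} d≢1
      ...   | r , r-prime , r∣d@(divides e d≡er) = contradiction
        (≡.trans (cong (_^ cofactor r) (≡.trans ξ≡ζ^d (≡.trans (cong (ζ ^_) d≡er) (≡.sym (^-assoc ζ e r)))))
                 (^p^e≡1 (∣-trans (∣-trans r∣d d∣m) m∣N) (^-nonzero e ζ≢0)))
        (All.lookup nr (∈-primeDivisors m r-prime (∣-trans r∣d d∣m)))

    -- The sieve bound has r and Φ where the statement has m and φ(m). Multiplying by m and using m
    -- Φ = φ(m) r brings out a common factor r, which cancels.
    count-bound : ∀ {m L} → 2 ∣ N → m ∣ N → CountsN F q (suc n′) β m L →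
                  + (m ℕ.* length L) - + (φ m ℕ.* t) ≤ φ m ℕ.* mersenne (ν m) √ t
    count-bound {m} {L} 2∣N m∣N (uniq , iff) = √-cancel r {{productOfPrimes≢0 (primeDivisors-prime m)}}
      (≡.subst₂ (λ a b → a ≤ b √ t) scaled-difference scaled-bound
        (√-* m (sieve-bound 2∣N P (primeDivisors-unique m) (primeDivisors-prime m)
          (All.map (λ r∣m → ∣-trans r∣m m∣N) (primeDivisors-∣ m)))))
      where
      instance _ = ∣N⇒nonZero m∣N
      P = primeDivisors m
      r = product P
      ℓ = length L
      M = mersenne (ν m)
      G≡ : G P [] ≡ + r * + ℓ
      G≡ = G-count (primeDivisors-prime m) uniq (λ ξ → mk⇔
        (λ ξ∈L → let ξ≢0 , free , ≡β = Equivalence.to (iff ξ) ξ∈L in ξ≢0 , Equivalence.to (free⇔nonresidue m∣N ξ) free , ≡β)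
        (λ (ξ≢0 , nr , ≡β) → Equivalence.from (iff ξ)
          (ξ≢0 , Equivalence.from (free⇔nonresidue m∣N ξ) nr , ≡β)))
      open ≡.≡-Reasoning
      φr≡mΦ : + φ m * + r ≡ + m * + Φ P
      φr≡mΦ = ≡.trans (≡.sym (pos-* (φ m) r)) (≡.trans (cong +_ (φ-formula m)) (pos-* m (Φ P)))
      scaled-difference : + m * (G P [] - + Φ P * + t) ≡ + r * (+ (m ℕ.* ℓ) - + (φ m ℕ.* t))
      scaled-difference = begin
        + m * (G P [] - + Φ P * + t)                       ≡⟨ cong (λ g → + m * (g - + Φ P * + t)) G≡ ⟩
        + m * (+ r * + ℓ - + Φ P * + t)                    ≡⟨ expand (+ m) (+ r) (+ ℓ) (+ Φ P) (+ t) ⟩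
        + r * (+ m * + ℓ) - + m * + Φ P * + t              ≡⟨ cong (λ f → + r * (+ m * + ℓ) - f * + t) φr≡mΦ ⟨
        + r * (+ m * + ℓ) - + φ m * + r * + t              ≡⟨ collect (+ r) (+ m * + ℓ) (+ φ m) (+ t) ⟩
        + r * (+ m * + ℓ - + φ m * + t)
          ≡⟨ cong₂ (λ a b → + r * (a - b)) (pos-* m ℓ) (pos-* (φ m) t) ⟨
        + r * (+ (m ℕ.* ℓ) - + (φ m ℕ.* t))                ∎
        where
        expand : ∀ m r l f t → m * (r * l - f * t) ≡ r * (m * l) - m * f * t
        expand = ℤSolver.solve-∀
        collect : ∀ r a f t → r * a - f * r * t ≡ r * (a - f * t)
        collect = ℤSolver.solve-∀
      scaled-bound : m ℕ.* (Φ P ℕ.* M) ≡ r ℕ.* (φ m ℕ.* M)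
      scaled-bound = begin
        m ℕ.* (Φ P ℕ.* M)    ≡⟨ ℕ.*-assoc m (Φ P) M ⟨
        m ℕ.* Φ P ℕ.* M      ≡⟨ cong (ℕ._* M) (φ-formula m) ⟨
        φ m ℕ.* r ℕ.* M      ≡⟨ cong (ℕ._* M) (ℕ.*-comm (φ m) r) ⟩
        r ℕ.* φ m ℕ.* M      ≡⟨ ℕ.*-assoc r (φ m) M ⟩
        r ℕ.* (φ m ℕ.* M)    ∎

    lower-bound : ∀ m → 2 ∣ m → m ∣ N → ∀ L → CountsN F q (suc n′) β m L → ∀ {w} → w ℕ.≤ W m →
      GeAffSqrt (+ (m ℕ.* length L)) (+ (φ m ℕ.* t)) (+ φ m * (+ 1 - + (4 ℕ.* W m) + + (2 ℕ.* w))) t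
    lower-bound m 2∣m m∣N L counts {w} w≤W with 4W≡ m w≤W
    ... | K , 4W≡2w+1+K , M≤K = ≡.subst (λ a → GeAffSqrt (+ (m ℕ.* length L)) (+ (φ m ℕ.* t)) a t) coefficient
      (√⇒GeMulSqrt (√-mono (ℕ.*-monoʳ-≤ (φ m) M≤K) (count-bound (∣-trans 2∣m m∣N) m∣N counts)))
      where
      open ≡.≡-Reasoning
      simplify : ∀ f w K → - (f * K) ≡ f * (1ℤ - (w + (1ℤ + K)) + w)
      simplify = ℤSolver.solve-∀
      coefficient : - + (φ m ℕ.* K) ≡ + φ m * (+ 1 - + (4 ℕ.* W m) + + (2 ℕ.* w))
      coefficient = begin
        - + (φ m ℕ.* K)                                                   ≡⟨ cong -_ (pos-* (φ m) K) ⟩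
        - (+ φ m * + K)
          ≡⟨ simplify (+ φ m) (+ (2 ℕ.* w)) (+ K) ⟩
        + φ m * (1ℤ - + (2 ℕ.* w ℕ.+ (1 ℕ.+ K)) + + (2 ℕ.* w))
          ≡⟨ cong (λ e → + φ m * (1ℤ - + e + + (2 ℕ.* w))) 4W≡2w+1+K ⟨
        + φ m * (+ 1 - + (4 ℕ.* W m) + + (2 ℕ.* w))                       ∎

    -- If nothing were counted, `count-bound` would read φ t ≤ φ K √t, that is t ≤ K², against the
    -- assumption √t > K.
    positivity : 2 ∣ N → ∀ m → m ∣ N → ∀ {w} → w ℕ.≤ W m → SqrtGt t (+ (4 ℕ.* W m) - + (2 ℕ.* w) - + 1) →
                 ∀ L → CountsN F q (suc n′) β m L → 0 ℕ.< length L
    positivity 2∣N m m∣N {w} w≤W √t>K (x ∷ L) counts = ℕ.s≤s ℕ.z≤n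
    positivity 2∣N m m∣N {w} w≤W √t>K [] counts with 4W≡ m w≤W
    ... | K , 4W≡2w+1+K , M≤K = contradiction K²<t (ℕ.≤⇒≯ t≤K²)
      where
      instance _ = ∣N⇒nonZero m∣N
      simplify : ∀ w K → w + (1ℤ + K) - w - 1ℤ ≡ K
      simplify = ℤSolver.solve-∀
      √t>+K : SqrtGt t (+ K)
      √t>+K = ≡.subst (SqrtGt t) (≡.trans (cong (λ e → + e - + (2 ℕ.* w) - + 1) 4W≡2w+1+K)
        (simplify (+ (2 ℕ.* w)) (+ K))) √t>K
      K²<t : K ℕ.* K ℕ.< t
      K²<t with √t>+K
      ... | inj₂ (_ , h) = drop‿+<+ (≡.subst (_< + t) (≡.sym (pos-* K K)) h)
      ... | inj₁ (+<+ ())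
      φt = φ m ℕ.* t
      bound : φt ℕ.* φt ℕ.≤ φ m ℕ.* K ℕ.* (φ m ℕ.* K) ℕ.* t
      bound = ≡.subst (λ a → a ℕ.* a ℕ.≤ φ m ℕ.* K ℕ.* (φ m ℕ.* K) ℕ.* t)
        (≡.trans (cong (λ e → ∣ + e - + φt ∣) (ℕ.*-zeroʳ m))
          (≡.trans (cong ∣_∣ (+-identityˡ (- + φt))) (∣-i∣≡∣i∣ (+ φt))))
        (_≤_√_.squares (√-mono {t = t} (ℕ.*-monoʳ-≤ (φ m) M≤K) (count-bound 2∣N m∣N counts)))
      regroup : ∀ f t → f ℕ.* t ℕ.* (f ℕ.* t) ≡ f ℕ.* f ℕ.* t ℕ.* t
      regroup = ℕSolver.solve-∀
      regroup′ : ∀ f K t → f ℕ.* K ℕ.* (f ℕ.* K) ℕ.* t ≡ f ℕ.* f ℕ.* t ℕ.* (K ℕ.* K)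
      regroup′ = ℕSolver.solve-∀
      t≤K² : t ℕ.≤ K ℕ.* K
      t≤K² = ℕ.*-cancelˡ-≤ (φ m ℕ.* φ m ℕ.* t)
        {{ℕ.m*n≢0 (φ m ℕ.* φ m) t {{ℕ.m*n≢0 (φ m) (φ m) {{φ-nonZero}} {{φ-nonZero}}}}}}
        (≡.subst₂ ℕ._≤_ (regroup (φ m) t) (regroup′ (φ m) K t) bound)
        where
        φ-nonZero : ℕ.NonZero (φ m)
        φ-nonZero = ℕ.>-nonZero (0<φ m)

open import Data.Nat using (_^_; _∸_; _*_; _≤_; _<_)
open TraceOfSquares

theorem5p2 : (p k q n : ℕ) → Prime p → 1 ≤ k → q ≡ p ^ k → ¬ (2 ∣ q)
    → Prime n → 2 ∣ ((q ^ n ∸ 1) / 2)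
    → (F : FiniteField (q ^ n))
    → (β : FiniteField.Carrier F) → InSubfield F q β → β ≢ FiniteField.0# F
    → ((m : ℕ) → 2 ∣ m → m ∣ (q ^ n ∸ 1)
    → (L : List (FiniteField.Carrier F)) → CountsN F q n β m L
    → GeAffSqrt (+ (m * length L)) (+ (φ m * q ^ (n ∸ 1)))
    (+ φ m ℤ.* (+ 1 ℤ.- + (4 * W m) ℤ.+ + (2 * W (mQ m (Qof q n)))))
    (q ^ (n ∸ 1)))
    × (SqrtGt (q ^ (n ∸ 1)) (+ (4 * W (q ^ n ∸ 1)) ℤ.- + (2 * W (Qof q n)) ℤ.- + 1)
    → (L : List (FiniteField.Carrier F)) → CountsN F q n β (q ^ n ∸ 1) L
    → 0 < length L)
theorem5p2 p k q zero _ _ _ _ n-prime = contradiction n-prime ¬prime[0]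
theorem5p2 p k q (suc n′) p-prime 1≤k q≡p^k 2∤q _ _ F β β∈Fq β≢0 =
    (λ m 2∣m m∣N L counts → M.lower-bound m 2∣m m∣N L counts (W-mQ m (Qof q (suc n′))))
  , M.positivity 2∣N (q ℕ.^ suc n′ ℕ.∸ 1) ∣-refl (W-∣ {{M.∣N⇒nonZero ∣-refl}} (Qof-∣ q (suc n′) M.1<q))
  where
  module M = Main {n′ = n′} p-prime 1≤k q≡p^k F β∈Fq β≢0
  -- If instead 1 + N = q^n were even, q would be even.
  2∣N : 2 ∣ q ℕ.^ suc n′ ℕ.∸ 1
  2∣N with parity (q ℕ.^ suc n′ ℕ.∸ 1)
  ... | inj₁ 2∣N = 2∣N
  ... | inj₂ 2∣1+N = contradiction (prime∣^⇒∣ q (suc n′) prime[2] (≡.subst (2 ∣_) (≡.sym (Field.s≡1+N F)) 2∣1+N)) 2∤q
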